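{- Let $G$ be a finite, simple, connected graph on $n$ vertices such that $\Delta(\mathrm{EV}(G))\le 3$. Then either $\mathrm{pn}(G)\le\lfloor n/2\rfloor$ (i.e. $G$ is a Gallai graph), or $G$ is a SET graph.
   Context: All graphs are finite and simple. A path decomposition of a graph $G$ is a collection of edge-disjoint paths of $G$ whose union covers $E(G)$; $\mathrm{pn}(G)$ is the minimum cardinality of a path decomposition of $G$. The E-subgraph $\mathrm{EV}(G)$ is the subgraph of $G$ induced by the vertices of even degree in $G$, and $\Delta$ denotes maximum degree. A vertex is even (odd) if its degree in $G$ is even (odd). A graph $G$ is a SET graph if $\mathrm{EV}(G)$ is a triangle and every odd vertex of $G$ has at least two even neighbors. -}

module Defs where

open import Data.Nat using (ℕ; zero; suc; _+_; _≤_; _%_; _/_)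
open import Data.Bool using (Bool; true; false; T)
open import Data.Fin using (Fin; zero; suc)
open import Data.List using (List; []; _∷_; length; lookup)
open import Data.List.Relation.Unary.Any using (Any)
open import Data.List.Relation.Unary.Linked using (Linked)
open import Data.List.Relation.Unary.Unique.Propositional using (Unique)
open import Data.Product using (Σ; _×_; _,_; ∃; ∃-syntax)
open import Data.Sum using (_⊎_)
open import Relation.Binary.PropositionalEquality using (_≡_; _≢_)
open import Relation.Nullary using (¬_)

record Graph (n : ℕ) : Set where
  field
    adj    : Fin n → Fin n → Bool
    sym    : ∀ u v → adj u v ≡ adj v u
    irrefl : ∀ v → adj v v ≡ false
open Graph public

Adj : ∀ {n} → Graph n → Fin n → Fin n → Set
Adj G u v = adj G u v ≡ true

count : ∀ {n} → (Fin n → Bool) → ℕ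
count {zero}  f = 0
count {suc n} f with f zero
... | true  = suc (count (λ i → f (suc i)))
... | false = count (λ i → f (suc i))

degree : ∀ {n} → Graph n → Fin n → ℕ
degree G v = count (adj G v)

IsEven : ℕ → Set
IsEven k = k % 2 ≡ 0

isEvenB : ℕ → Bool
isEvenB k with k % 2
... | zero  = true
... | suc _ = false

EvenV : ∀ {n} → Graph n → Fin n → Set
EvenV G v = IsEven (degree G v)

OddV : ∀ {n} → Graph n → Fin n → Set
OddV G v = ¬ EvenV G v

evenVB : ∀ {n} → Graph n → Fin n → Bool
evenVB G v = isEvenB (degree G v)

evenNeighbours : ∀ {n} → Graph n → Fin n → ℕ
evenNeighbours G v = count (λ u → Data.Bool._∧_ (adj G v u) (evenVB G u))

MaxDegEV≤ : ∀ {n} → Graph n → ℕ → Set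
MaxDegEV≤ G k = ∀ v → EvenV G v → evenNeighbours G v ≤ k

data Reach {n} (G : Graph n) : Fin n → Fin n → Set where
  here : ∀ {v} → Reach G v v
  step : ∀ {u w v} → Adj G u w → Reach G w v → Reach G u v

Connected : ∀ {n} → Graph n → Set
Connected G = ∀ u v → Reach G u v

record Path {n} (G : Graph n) : Set where
  field
    verts    : List (Fin n)
    nontriv  : 2 ≤ length verts
    distinct : Unique verts
    walk     : Linked (Adj G) verts
open Path public

data EdgeOf {n} (u v : Fin n) : List (Fin n) → Set where
  fwd  : ∀ {xs} → EdgeOf u v (u ∷ v ∷ xs)
  bwd  : ∀ {xs} → EdgeOf u v (v ∷ u ∷ xs)
  there : ∀ {x xs} → EdgeOf u v xs → EdgeOf u v (x ∷ xs)

PathHasEdge : ∀ {n} {G : Graph n} → Path G → Fin n → Fin n → Set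
PathHasEdge P u v = EdgeOf u v (verts P)

record PathDecomposition {n} (G : Graph n) : Set where
  field
    paths    : List (Path G)
    covers   : ∀ u v → Adj G u v →
               ∃[ i ] PathHasEdge (lookup paths i) u v
    disjoint : ∀ u v (i j : Fin (length paths)) →
               PathHasEdge (lookup paths i) u v →
               PathHasEdge (lookup paths j) u v → i ≡ j
open PathDecomposition public

PnAtMost : ∀ {n} → Graph n → ℕ → Set
PnAtMost G k = Σ (PathDecomposition G) λ D → length (paths D) ≤ k

EVTriangle : ∀ {n} → Graph n → Set
EVTriangle {n} G = Σ (Fin n) λ a → Σ (Fin n) λ b → Σ (Fin n) λ c →
  (a ≢ b × b ≢ c × a ≢ c) ×
  (EvenV G a × EvenV G b × EvenV G c) ×
  (Adj G a b × Adj G b c × Adj G a c) ×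
  (∀ v → EvenV G v → v ≡ a ⊎ v ≡ b ⊎ v ≡ c)

SETGraph : ∀ {n} → Graph n → Set
SETGraph G = EVTriangle G × (∀ v → OddV G v → 2 ≤ evenNeighbours G v)

{-# OPTIONS --safe #-}
module Submission where

-- Fix a decomposition and let f v be the number of path ends at v; then f v has the parity of
-- deg v, and the task is to achieve ∑ f ≤ n. If the edge ab is missing from a decomposition and
-- every neighbour of a is an end of some path, the edge can be restored "at a": append it to a
-- path ending at b, or, if that path passes through a, exchange ab for the edge by which it
-- enters a and go on from there. This moves one path end from b to a and keeps ∑ f. Dead ends of
-- this walk are neighbours v of a with f v = 0, and different path ends at b lead to different
-- dead ends, so f b exceeding their number suffices. When several edges b x are missing, at least
-- half of them can be restored at b, and the others afterwards at x, at the expense of the path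
-- ends gathered at b.
--
-- Odd vertices always satisfy f v ≥ 1, so one deletes edges to make vertices odd, applies
-- induction, and restores the edges. A vertex with three even neighbours in the E-subgraph, a
-- vertex with exactly one even neighbour, and a path of the E-subgraph on a non-triangular cycle
-- can be treated in this way. What remains are isolated vertices and triangles in the E-subgraph.
-- An odd vertex adjacent to two of these components admits a reduction; otherwise, unless the
-- component is a SET graph, some triangle T has an odd vertex b attached to it with a neighbour c
-- outside, not adjacent to T, and the edge bc supplies the missing path end. If no even vertex has
-- a neighbour, all ends can be prescribed as in Lovász' theorem. Induction is on the number of
-- edges, for possibly disconnected graphs none of whose components is a SET graph.

open import Defs renaming (sym to adj-sym; verts to pverts)
open import Data.Bool using (Bool; true; false; not; _∧_; _∨_)
open import Data.Bool.Properties using (not-involutive; ∧-comm; ∨-comm)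
import Data.Bool.Properties as Bool
open import Data.Empty using (⊥; ⊥-elim)
open import Data.Fin using (Fin; zero; suc)
import Data.Fin.Properties as FinP
open import Data.Fin.Properties using (_≟_; any?; all?)
open import Data.List using (List; []; _∷_; _++_; map; length; lookup)
open import Data.List.Membership.DecPropositional using () renaming (_∈?_ to memb?)
open import Data.List.Membership.Propositional using (_∈_; _∉_)
open import Data.List.Membership.Propositional.Properties using (∈-∃++; ∈-map⁺; ∈-map⁻; ∈-++⁻; ∈-++⁺ˡ; ∈-++⁺ʳ)
open import Data.List.Properties using (map-id; map-++; length-map; ++-identityʳ)
open import Data.List.Relation.Binary.Permutation.Propositional using (_↭_; prep; swap; ↭-sym; ↭⇒↭ₛ) renaming (refl to ↭r; trans to ↭t)
open import Data.List.Relation.Binary.Permutation.Propositional.Properties using (shift; ↭-length; ∈-resp-↭; map⁺; ++⁺ˡ; ++⁺ʳ; ++-comm; drop-∷)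
import Data.List.Relation.Binary.Permutation.Setoid.Properties as SetoidPerm
open import Data.List.Relation.Unary.All using (All; []; _∷_)
import Data.List.Relation.Unary.All as All
open import Data.List.Relation.Unary.AllPairs using ([]; _∷_)
open import Data.List.Relation.Unary.Any using (here; there)
open import Data.List.Relation.Unary.Linked using (Linked; []; [-]; _∷_)
open import Data.List.Relation.Unary.Unique.Propositional using (Unique)
import Data.List.Relation.Unary.Unique.Propositional.Properties as UniqueP
open import Data.Nat using (ℕ; zero; suc; _+_; _*_; _∸_; _≤_; _<_; z≤n; s≤s; _%_; _/_)
open import Data.Nat.DivMod using ([m+n]%n≡m%n; m*n/n≡m; /-monoˡ-≤)
import Data.Nat.Properties as ℕₚ
open import Data.Nat.Properties hiding (_≟_)
open import Data.Nat.Tactic.RingSolver using (solve-∀)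
open import Data.Product using (_×_; _,_; ∃; ∃-syntax; proj₁; proj₂)
open import Data.Sum using (_⊎_; inj₁; inj₂)
import Data.Sum as Sum
open import Data.Unit using (⊤; tt)
open import Function using (_∘_)
open import Relation.Binary.PropositionalEquality
open import Relation.Nullary using (¬_; Dec; yes; no)
open import Relation.Nullary.Decidable using (⌊_⌋; ¬?; _×-dec_; _⊎-dec_)

-- What decides the cases is a count at `b`. Let the edges `b x`, `x ∈ X`, be missing. The walks
-- pair off at the two ends of free paths; one of each pair and all `u` unpaired walks can be
-- carried out, so `b` collects `length Y = length R + u` ends. Each edge left over, restored at its
-- other end `x`, costs `b` one end, and the last one needs more ends at `b` than `x` has possible
-- dead ends. These are even vertices other than `b`, since odd ones are ends by parity, and there
-- are at most two. So `f b + u ≥ 2` suffices. A star of three edges at an even centre turns the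
-- centre odd, which makes both summands positive. For odd `b` only one of them is guaranteed:
-- `f b ≥ 1` if `length X` is even, `u ≥ 1` if it is odd. This deficit of one shapes the treatment
-- of odd vertices: it is met by a last edge with only one possible dead end, or by a further
-- deleted edge that changes the parity at `b`.
--
-- The smaller graph must satisfy the hypotheses again, although deletions may cut off components.
-- Hence `NoSET` asks for witnesses, and `Safe` makes the ends of deleted edges witnesses.

-- Lists up to permutation, finite sums and parity

Unique-↭ : ∀ {A : Set} {xs ys : List A} → xs ↭ ys → Unique xs → Unique ys
Unique-↭ {A} p = SetoidPerm.Unique-resp-↭ (setoid A) (↭⇒↭ₛ p)

extract : ∀ {A : Set} {x : A} {xs} → x ∈ xs → ∃[ ys ] xs ↭ x ∷ ys
extract {x = x} x∈ with ∈-∃++ x∈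
... | ys , zs , refl = ys ++ zs , shift x ys zs

Unique-head : ∀ {A : Set} {x : A} {xs} → Unique (x ∷ xs) → x ∉ xs
Unique-head (p ∷ _) x∈ = All.lookup p x∈ refl

Unique-tail : ∀ {A : Set} {x : A} {xs} → Unique (x ∷ xs) → Unique xs
Unique-tail (_ ∷ u) = u

Unique-cons : ∀ {A : Set} {x : A} {xs} → x ∉ xs → Unique xs → Unique (x ∷ xs)
Unique-cons x∉ u = All.tabulate (λ { y∈ refl → x∉ y∈ }) ∷ u

sumBy : ∀ {A : Set} → (A → ℕ) → List A → ℕ
sumBy g []       = 0
sumBy g (x ∷ xs) = g x + sumBy g xs

sumBy-↭ : ∀ {A : Set} (g : A → ℕ) {xs ys} → xs ↭ ys → sumBy g xs ≡ sumBy g ys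
sumBy-↭ g ↭r = refl
sumBy-↭ g (prep x p) = cong (g x +_) (sumBy-↭ g p)
sumBy-↭ g (swap x y p) rewrite sumBy-↭ g p = lem (g x) (g y) _
  where lem : ∀ a b c → a + (b + c) ≡ b + (a + c)
        lem = solve-∀
sumBy-↭ g (↭t p q) = trans (sumBy-↭ g p) (sumBy-↭ g q)

sumBy-++ : ∀ {A : Set} (g : A → ℕ) xs {ys} → sumBy g (xs ++ ys) ≡ sumBy g xs + sumBy g ys
sumBy-++ g [] = refl
sumBy-++ g (x ∷ xs) = trans (cong (g x +_) (sumBy-++ g xs)) (sym (+-assoc (g x) _ _))

sumBy-cong : ∀ {A : Set} {g h : A → ℕ} → (∀ x → g x ≡ h x) → ∀ xs → sumBy g xs ≡ sumBy h xs
sumBy-cong e [] = refl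
sumBy-cong e (x ∷ xs) = cong₂ _+_ (e x) (sumBy-cong e xs)

sumBy-pos : ∀ {A : Set} (g : A → ℕ) xs → 1 ≤ sumBy g xs → ∃[ x ] x ∈ xs × 1 ≤ g x
sumBy-pos g (x ∷ xs) p with g x in eq
... | suc _ = x , here refl , subst (1 ≤_) (sym eq) (s≤s z≤n)
... | zero with sumBy-pos g xs p
... | y , y∈ , q = y , there y∈ , q

sumBy-∈ : ∀ {A : Set} (g : A → ℕ) {x xs} → x ∈ xs → g x ≤ sumBy g xs
sumBy-∈ g (here refl) = m≤m+n _ _
sumBy-∈ g (there x∈) = ≤-trans (sumBy-∈ g x∈) (m≤n+m _ _)

sumBy-0 : ∀ {A : Set} (g : A → ℕ) xs → (∀ {x} → x ∈ xs → g x ≡ 0) → sumBy g xs ≡ 0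
sumBy-0 g [] e = refl
sumBy-0 g (x ∷ xs) e rewrite e (here refl) = sumBy-0 g xs (λ x∈ → e (there x∈))

pos≢0 : ∀ {k} → 1 ≤ k → k ≢ 0
pos≢0 (s≤s _) ()

sumBy-+ : ∀ {A : Set} (g h : A → ℕ) ps → sumBy (λ p → g p + h p) ps ≡ sumBy g ps + sumBy h ps
sumBy-+ g h [] = refl
sumBy-+ g h (p ∷ ps) = trans (cong (g p + h p +_) (sumBy-+ g h ps)) (lem (g p) (h p) _ _)
  where lem : ∀ a b c d → a + b + (c + d) ≡ a + c + (b + d)
        lem = solve-∀

b2n : Bool → ℕ
b2n true  = 1
b2n false = 0

b2n≤1 : ∀ b → b2n b ≤ 1
b2n≤1 true  = s≤s z≤n
b2n≤1 false = z≤n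

b2n-pos : ∀ {b} → 1 ≤ b2n b → b ≡ true
b2n-pos {true} _ = refl

module _ {n : ℕ} where

  δ : Fin n → Fin n → ℕ
  δ x y with x ≟ y
  ... | yes _ = 1
  ... | no  _ = 0

  δ-refl : ∀ x → δ x x ≡ 1
  δ-refl x with x ≟ x
  ... | yes _ = refl
  ... | no ¬p = ⊥-elim (¬p refl)

  δ-≢ : ∀ {x y} → x ≢ y → δ x y ≡ 0
  δ-≢ {x} {y} p with x ≟ y
  ... | yes e = ⊥-elim (p e)
  ... | no  _ = refl

  δ-pos : ∀ {x y} → 1 ≤ δ x y → x ≡ y
  δ-pos {x} {y} p with x ≟ y
  ... | yes e = e

ΣF : ∀ {n} → (Fin n → ℕ) → ℕ
ΣF {zero}  f = 0
ΣF {suc n} f = f zero + ΣF (f ∘ suc)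

ΣF-cong : ∀ {n} {f g : Fin n → ℕ} → (∀ v → f v ≡ g v) → ΣF f ≡ ΣF g
ΣF-cong {zero} e = refl
ΣF-cong {suc n} e = cong₂ _+_ (e zero) (ΣF-cong (e ∘ suc))

ΣF-+ : ∀ {n} (f g : Fin n → ℕ) → ΣF (λ v → f v + g v) ≡ ΣF f + ΣF g
ΣF-+ {zero} f g = refl
ΣF-+ {suc n} f g = trans (cong (f zero + g zero +_) (ΣF-+ (f ∘ suc) (g ∘ suc))) (lem (f zero) (g zero) _ _)
  where lem : ∀ a b c d → a + b + (c + d) ≡ a + c + (b + d)
        lem = solve-∀

ΣF-* : ∀ {n} k (f : Fin n → ℕ) → ΣF (λ v → k * f v) ≡ k * ΣF f
ΣF-* {zero} k f = sym (*-zeroʳ k)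
ΣF-* {suc n} k f = trans (cong (k * f zero +_) (ΣF-* k (f ∘ suc))) (sym (*-distribˡ-+ k (f zero) _))

ΣF-0 : ∀ {n} → ΣF {n} (λ _ → 0) ≡ 0
ΣF-0 {zero} = refl
ΣF-0 {suc n} = ΣF-0 {n}

ΣF-mono : ∀ {n} {f g : Fin n → ℕ} → (∀ v → f v ≤ g v) → ΣF f ≤ ΣF g
ΣF-mono {zero} e = z≤n
ΣF-mono {suc n} e = +-mono-≤ (e zero) (ΣF-mono (e ∘ suc))

ΣF-1 : ∀ {n} → ΣF {n} (λ _ → 1) ≡ n
ΣF-1 {zero} = refl
ΣF-1 {suc n} = cong suc (ΣF-1 {n})

ΣF-∈ : ∀ {n} (f : Fin n → ℕ) v → f v ≤ ΣF f
ΣF-∈ f zero = m≤m+n _ _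
ΣF-∈ f (suc v) = ≤-trans (ΣF-∈ (f ∘ suc) v) (m≤n+m _ _)

δ-suc : ∀ {n} (x y : Fin n) → δ (suc x) (suc y) ≡ δ x y
δ-suc x y with x ≟ y
... | yes refl = refl
... | no p = refl

ΣF-δ : ∀ {n} (x : Fin n) → ΣF (λ v → δ v x) ≡ 1
ΣF-δ {suc n} zero = cong suc (trans (ΣF-cong {n} (λ v → δ-≢ {x = suc v} {zero} (λ ()))) (ΣF-0 {n}))
ΣF-δ (suc x) = trans (ΣF-cong (λ v → δ-suc v x)) (ΣF-δ x)

ΣF-sumBy : ∀ {n} {A : Set} (g : Fin n → A → ℕ) ps → ΣF (λ v → sumBy (g v) ps) ≡ sumBy (λ p → ΣF (λ v → g v p)) ps
ΣF-sumBy {n} g [] = ΣF-0 {n}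
ΣF-sumBy g (p ∷ ps) = trans (ΣF-+ (λ v → g v p) _) (cong (ΣF (λ v → g v p) +_) (ΣF-sumBy g ps))

count-ΣF : ∀ {n} (f : Fin n → Bool) → count f ≡ ΣF (b2n ∘ f)
count-ΣF {zero} f = refl
count-ΣF {suc n} f with f zero
... | true  = cong suc (count-ΣF (f ∘ suc))
... | false = count-ΣF (f ∘ suc)

-- Evenness as a Boolean. Unlike `% 2` it reduces on `suc`, so a change of parity is a `not`.
pb : ℕ → Bool
pb zero    = true
pb (suc k) = not (pb k)

pb-%2 : ∀ k → k % 2 ≡ b2n (not (pb k))
pb-%2 zero = refl
pb-%2 (suc zero) = refl
pb-%2 (suc (suc k)) = trans (cong (_% 2) (+-comm 2 k)) (trans ([m+n]%n≡m%n k 2) (trans (pb-%2 k) (cong (b2n ∘ not) (sym (not-involutive (pb k))))))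

pb-even : ∀ k → IsEven k → pb k ≡ true
pb-even k e with pb k | pb-%2 k
... | true | _ = refl
... | false | q with trans (sym q) e
... | ()

even-pb : ∀ k → pb k ≡ true → IsEven k
even-pb k e rewrite pb-%2 k | e = refl

isEvenB-pb : ∀ k → isEvenB k ≡ pb k
isEvenB-pb k with k % 2 | pb-%2 k
... | zero | q with pb k
...   | true = refl
isEvenB-pb k | suc _ | q with pb k
...   | false = refl

pb-+ : ∀ a b → pb (a + b) ≡ true → pb a ≡ pb b
pb-+ zero b e = sym e
pb-+ (suc a) b e with pb-+ a (suc b) (trans (cong pb (+-suc a b)) e)
... | q = trans (cong not q) (not-involutive (pb b))

pb-double : ∀ k → pb (k + k) ≡ true
pb-double zero = refl
pb-double (suc k) = trans (cong (not ∘ pb) (+-suc k k)) (trans (not-involutive _) (pb-double k))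

pb-odd-pos : ∀ {k} → pb k ≡ false → 1 ≤ k
pb-odd-pos {suc k} e = s≤s z≤n

b2n-∧true : ∀ b → b2n b ≡ b2n (b ∧ true) + 0
b2n-∧true true  = refl
b2n-∧true false = refl

b2n-≢ : ∀ {b} → b ≢ true → b2n b ≡ 0
b2n-≢ {true}  q = ⊥-elim (q refl)
b2n-≢ {false} q = refl

sumBy-lookup : ∀ {A : Set} (g : A → ℕ) xs → 1 ≤ sumBy g xs → ∃[ i ] 1 ≤ g (lookup xs i)
sumBy-lookup g (x ∷ xs) p with g x in eq
... | suc _ = zero , subst (1 ≤_) (sym eq) (s≤s z≤n)
... | zero with sumBy-lookup g xs p
... | i , q = suc i , q

lookup-≤ : ∀ {A : Set} (g : A → ℕ) xs i → g (lookup xs i) ≤ sumBy g xs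
lookup-≤ g (x ∷ xs) zero = m≤m+n _ _
lookup-≤ g (x ∷ xs) (suc i) = ≤-trans (lookup-≤ g xs i) (m≤n+m _ _)

sumBy-one : ∀ {A : Set} (g : A → ℕ) xs → sumBy g xs ≤ 1 → ∀ i j → 1 ≤ g (lookup xs i) → 1 ≤ g (lookup xs j) → i ≡ j
sumBy-one g (x ∷ xs) s zero zero p q = refl
sumBy-one g (x ∷ xs) s (suc i) (suc j) p q = cong suc (sumBy-one g xs (≤-trans (m≤n+m _ _) s) i j p q)
sumBy-one g (x ∷ xs) s zero (suc j) p q = ⊥-elim (<-irrefl refl (≤-trans (+-mono-≤ p (≤-trans q (lookup-≤ g xs j))) s))
sumBy-one g (x ∷ xs) s (suc i) zero p q = ⊥-elim (<-irrefl refl (≤-trans (+-mono-≤ q (≤-trans p (lookup-≤ g xs i))) s))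

elems : ∀ {n} → (Fin n → Bool) → List (Fin n)
elems {zero}  p = []
elems {suc n} p with p zero
... | true  = zero ∷ map suc (elems (p ∘ suc))
... | false = map suc (elems (p ∘ suc))

elems-length : ∀ {n} (p : Fin n → Bool) → length (elems p) ≡ count p
elems-length {zero} p = refl
elems-length {suc n} p with p zero
... | true  = cong suc (trans (length-map Fin.suc (elems (p ∘ suc))) (elems-length (p ∘ suc)))
... | false = trans (length-map Fin.suc (elems (p ∘ suc))) (elems-length (p ∘ suc))

elems-unique : ∀ {n} (p : Fin n → Bool) → Unique (elems p)
elems-unique {zero} p = []
elems-unique {suc n} p with p zero
... | true  = Unique-cons (λ q → no0 (∈-map⁻ suc q)) (UniqueP.map⁺ FinP.suc-injective (elems-unique (p ∘ suc)))
  where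
  no0 : ∀ {xs : List (Fin n)} → (∃[ y ] y ∈ xs × zero ≡ suc y) → ⊥
  no0 (_ , _ , ())
... | false = UniqueP.map⁺ FinP.suc-injective (elems-unique (p ∘ suc))

∈-elems : ∀ {n} (p : Fin n → Bool) {v} → p v ≡ true → v ∈ elems p
∈-elems {suc n} p {zero} e with p zero
∈-elems {suc n} p {zero} e | true = here refl
∈-elems {suc n} p {suc v} e with p zero
... | true  = there (∈-map⁺ suc (∈-elems (p ∘ suc) e))
... | false = ∈-map⁺ suc (∈-elems (p ∘ suc) e)

elems-∈ : ∀ {n} (p : Fin n → Bool) {v} → v ∈ elems p → p v ≡ true
elems-∈ {suc n} p {v} i with p zero in eq
elems-∈ {suc n} p i | false with ∈-map⁻ suc i
... | y , y∈ , refl = elems-∈ (p ∘ suc) y∈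
elems-∈ {suc n} p (here refl) | true = eq
elems-∈ {suc n} p (there i) | true with ∈-map⁻ suc i
... | y , y∈ , refl = elems-∈ (p ∘ suc) y∈

⊆-length : ∀ {A : Set} {xs ys : List A} → Unique xs → (∀ {x} → x ∈ xs → x ∈ ys) → length xs ≤ length ys
⊆-length {xs = []} u s = z≤n
⊆-length {xs = x ∷ xs} {ys} u s with extract (s (here refl))
... | zs , π = subst (suc (length xs) ≤_) (sym (↭-length π)) (s≤s (⊆-length (Unique-tail u) sub))
  where
  sub : ∀ {y} → y ∈ xs → y ∈ zs
  sub y∈ with ∈-resp-↭ π (s (there y∈))
  ... | here refl = ⊥-elim (Unique-head u y∈)
  ... | there q = q

Unique-++ʳ : ∀ {A : Set} (Y : List A) {R} → Unique (Y ++ R) → Unique R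
Unique-++ʳ [] u = u
Unique-++ʳ (y ∷ Y) u = Unique-++ʳ Y (Unique-tail u)

b2n-inj : ∀ {a b} → b2n a ≡ b2n b → a ≡ b
b2n-inj {true} {true} _ = refl
b2n-inj {false} {false} _ = refl

t≢f : ∀ {b} → b ≡ true → b ≡ false → ⊥
t≢f refl ()

pb-+true : ∀ a b → pb b ≡ true → pb (a + b) ≡ pb a
pb-+true zero b e = e
pb-+true (suc a) b e = cong not (pb-+true a b e)

pb-+false : ∀ a b → pb b ≡ false → pb (a + b) ≡ not (pb a)
pb-+false zero b e = e
pb-+false (suc a) b e = cong not (pb-+false a b e)

module _ {n : ℕ} where

  private V = Fin n

  -- Moving path ends around a fixed vertex

  cnt : V → List V → ℕ
  cnt v = sumBy (δ v)

  cnt-∉ : ∀ {v} X → v ∉ X → cnt v X ≡ 0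
  cnt-∉ X v∉ = sumBy-0 (δ _) X (λ x∈ → δ-≢ (λ { refl → v∉ x∈ }))

  -- With the paths cut open at a vertex a, att m o is a piece joined to a at its end m
  -- and ending at o on the other side; fr p q is a path from p to q that avoids a.
  data Item : Set where
    att fr : V → V → Item

  -- Seen from the cut vertex `a`, `hi` counts the edges from `a` to `v` and `ui` the path ends at
  -- `v`. Path ends at `a` itself appear in neither.
  hi ui : V → Item → ℕ
  hi v (att m o) = δ v m
  hi v (fr p q)  = 0
  ui v (att m o) = δ v o
  ui v (fr p q)  = δ v p + δ v q

  ni : Item → ℕ
  ni (att _ _) = 0
  ni (fr _ _)  = 1

  hc uc : List Item → V → ℕ
  hc S v = sumBy (hi v) S
  uc S v = sumBy (ui v) S

  nf : List Item → ℕ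
  nf = sumBy ni

  ui-away : ∀ {c d v it} → (it ≡ fr c d ⊎ it ≡ fr d c) → v ≢ c → v ≢ d → ui v it ≡ 0
  ui-away (inj₁ refl) v≢c v≢d = cong₂ _+_ (δ-≢ v≢c) (δ-≢ v≢d)
  ui-away (inj₂ refl) v≢c v≢d = cong₂ _+_ (δ-≢ v≢d) (δ-≢ v≢c)

  data Grp : Set where
    one : V → Grp
    two : V → V → Grp

  verts : List Grp → List V
  verts []             = []
  verts (one x ∷ gs)   = x ∷ verts gs
  verts (two x y ∷ gs) = x ∷ y ∷ verts gs

  -- The two walks of a group `two` lead to the two ends of the same free path. Attaching this path
  -- to `a` uses it up, so exactly one of them is carried out (`A`) and the other is not (`R`). A
  -- walk on its own may go either way.
  data Sel : List Grp → List V → List V → Set where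
    nil  : Sel [] [] []
    in₁  : ∀ {x gs A R} → Sel gs A R → Sel (one x ∷ gs) (x ∷ A) R
    out₁ : ∀ {x gs A R} → Sel gs A R → Sel (one x ∷ gs) A (x ∷ R)
    inˡ  : ∀ {x y gs A R} → Sel gs A R → Sel (two x y ∷ gs) (x ∷ A) (y ∷ R)
    inʳ  : ∀ {x y gs A R} → Sel gs A R → Sel (two x y ∷ gs) (y ∷ A) (x ∷ R)

  Sel-↭ : ∀ {gs A R} → Sel gs A R → A ++ R ↭ verts gs
  Sel-↭ nil = ↭r
  Sel-↭ (in₁ s) = prep _ (Sel-↭ s)
  Sel-↭ (out₁ {x} {A = A} {R} s) = ↭t (shift x A R) (prep x (Sel-↭ s))
  Sel-↭ (inˡ {x} {y} {A = A} {R} s) = prep x (↭t (shift y A R) (prep y (Sel-↭ s)))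
  Sel-↭ (inʳ {x} {y} {A = A} {R} s) = ↭t (prep y (shift x A R)) (swap y x (Sel-↭ s))

  -- `W S` stands for: `S` is the list of items of some path system with given edges away from `a`.
  -- The walks need only three moves, kept abstract here: `flip` exchanges the edge from `a` to one
  -- end of a piece for the edge to its other end; `attL` and `attR` join a free path to `a`.
  module Orient
    (W    : List Item → Set)
    (W-↭  : ∀ {S T} → S ↭ T → W S → W T)
    (flip : ∀ {m o S} → W (att m o ∷ S) → W (att o m ∷ S))
    (attL : ∀ {p q S} → W (fr p q ∷ S) → W (att p q ∷ S))
    (attR : ∀ {p q S} → W (fr p q ∷ S) → W (att q p ∷ S))
    where

    -- Since `tot` preserves heads plus outer ends, every new edge `a x` costs a path end at `x`. By
    -- `frees` every new edge uses up one free path, and attaching a free path creates a path end at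
    -- `a`.
    record Gain (S : List Item) (X : List V) : Set where
      constructor gain
      field
        S′    : List Item
        w     : W S′
        heads : ∀ v → hc S′ v ≡ hc S v + cnt v X
        tot   : ∀ v → hc S′ v + uc S′ v ≡ hc S v + uc S v
        frees : nf S′ + length X ≡ nf S

    Gain-↭ : ∀ {S T X} → S ↭ T → Gain T X → Gain S X
    Gain-↭ {S} {T} {X} p (gain S′ w hd tot′ ff) = gain S′ w
      (λ v → trans (hd v) (cong (_+ cnt v X) (sym (sumBy-↭ (hi v) p))))
      (λ v → trans (tot′ v) (sym (cong₂ _+_ (sumBy-↭ (hi v) p) (sumBy-↭ (ui v) p))))
      (trans ff (sym (sumBy-↭ ni p)))

    Gain-nil : ∀ {S} → W S → Gain S []
    Gain-nil w = gain _ w (λ v → sym (+-identityʳ _)) (λ v → refl) (+-identityʳ _)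

    Gain-attach : ∀ {c d S Y it} → (it ≡ fr c d ⊎ it ≡ fr d c) →
      Gain (att c d ∷ S) Y → Gain (it ∷ S) (c ∷ Y)
    Gain-attach {c} {d} {S} {Y} e (gain S′ w hd tot′ ff) = gain S′ w
      (λ v → trans (hd v) (trans (lem (δ v c) (hc S v) (cnt v Y)) (cong (_+ (δ v c + cnt v Y)) (sym (h0 e v)))))
      (λ v → trans (tot′ v) (trans (lem2 (δ v c) (hc S v) (δ v d) (uc S v)) (sym (u0 e v))))
      (trans (+-suc (nf S′) (length Y)) (trans (cong suc ff) (sym (n0 e))))
      where
      h0 : ∀ {it} → (it ≡ fr c d ⊎ it ≡ fr d c) → ∀ v → hc (it ∷ S) v ≡ hc S v
      h0 (inj₁ refl) v = refl
      h0 (inj₂ refl) v = refl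
      u0 : ∀ {it} → (it ≡ fr c d ⊎ it ≡ fr d c) → ∀ v → hc (it ∷ S) v + uc (it ∷ S) v ≡ hc S v + ((δ v c + δ v d) + uc S v)
      u0 (inj₁ refl) v = refl
      u0 (inj₂ refl) v = cong (λ z → hc S v + (z + uc S v)) (+-comm (δ v d) (δ v c))
      n0 : ∀ {it} → (it ≡ fr c d ⊎ it ≡ fr d c) → nf (it ∷ S) ≡ suc (nf S)
      n0 (inj₁ refl) = refl
      n0 (inj₂ refl) = refl
      lem : ∀ a b c → a + b + c ≡ b + (a + c)
      lem = solve-∀
      lem2 : ∀ a b c d → (a + b) + (c + d) ≡ b + ((a + c) + d)
      lem2 = solve-∀

    -- Flipping trades the head `m` for `c`, so the walk for `c` goes on as a walk for `m`: as
    -- multisets, `Y′` is `Y` with `c` replaced by `m`.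
    Gain-flip : ∀ {c m S Y Y′} → (∀ v → δ v c + cnt v Y′ ≡ δ v m + cnt v Y) → length Y ≡ length Y′ →
      Gain (att c m ∷ S) Y′ → Gain (att m c ∷ S) Y
    Gain-flip {c} {m} {S} {Y} {Y′} e l (gain S′ w hd tot′ ff) = gain S′ w
      (λ v → trans (hd v) (trans (lem (δ v c) (hc S v) (cnt v Y′)) (trans (cong (_+ hc S v) (e v)) (sym (lem (δ v m) (hc S v) (cnt v Y))))))
      (λ v → trans (tot′ v) (lem2 (δ v c) (hc S v) (δ v m) (uc S v)))
      (trans (cong (nf S′ +_) l) ff)
      where
      lem : ∀ a b c → a + b + c ≡ a + c + b
      lem = solve-∀
      lem2 : ∀ a b c d → (a + b) + (c + d) ≡ (c + b) + (a + d)
      lem2 = solve-∀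

    attach : ∀ {c d it S} → (it ≡ fr c d ⊎ it ≡ fr d c) → W (it ∷ S) → W (att c d ∷ S)
    attach (inj₁ refl) = attL
    attach (inj₂ refl) = attR

    zeroHead? : ∀ (U : V → ℕ) S →
      (∃[ v ] ∃[ o ] att v o ∈ S × U v ≡ 0) ⊎ (∀ v → 1 ≤ hc S v → 1 ≤ U v)
    zeroHead? U [] = inj₂ (λ v ())
    zeroHead? U (it ∷ S) with zeroHead? U S
    ... | inj₁ (v , o , i , e) = inj₁ (v , o , there i , e)
    zeroHead? U (fr p q ∷ S) | inj₂ k = inj₂ k
    zeroHead? U (att m o ∷ S) | inj₂ k with U m in eq
    ... | zero  = inj₁ (m , o , here refl , eq)
    ... | suc j = inj₂ f
      where
      f : ∀ v → 1 ≤ δ v m + hc S v → 1 ≤ U v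
      f v p with v ≟ m
      ... | yes refl = subst (1 ≤_) (sym eq) (s≤s z≤n)
      ... | no  _    = k v p

    split-↭ : ∀ (Fz : List Item) {Act Act′ : List Item} {it : Item} → Act ↭ it ∷ Act′ → Fz ++ Act ↭ it ∷ Fz ++ Act′
    split-↭ Fz {Act} {Act′} {it} p = ↭t (++⁺ˡ Fz p) (shift it Fz Act′)

    -- Heads without a spare end are frozen together with their item; afterwards an
    -- augmenting walk from b cannot get stuck, because a flipped item is never used again.
    pull : ∀ k Act Fz b Z → length Act ≡ k → W (Fz ++ Act) → (∀ v → hc Act v ≤ 1) → hc Act b ≡ 0 →
      (∀ v → 1 ≤ hc Act v → 1 ≤ uc Act v ⊎ v ∈ Z) → length Z < uc Act b → Gain (Fz ++ Act) (b ∷ [])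
    pull zero [] Fz b Z l w h1 hb cv ()
    pull (suc k) Act Fz b Z l w h1 hb cv lt with zeroHead? (uc Act) Act
    ... | inj₁ (v , o , i , uv) with extract i
    ... | Act′ , σ = go (v∈Z) (o ≟ b)
      where
      hcE : ∀ x → hc Act x ≡ δ x v + hc Act′ x
      hcE x = sumBy-↭ (hi x) σ
      ucE : ∀ x → uc Act x ≡ δ x o + uc Act′ x
      ucE x = sumBy-↭ (ui x) σ
      h1′ : ∀ x → hc Act′ x ≤ 1
      h1′ x = ≤-trans (m≤n+m _ _) (subst (_≤ 1) (hcE x) (h1 x))
      hv′ : hc Act′ v ≡ 0
      hv′ = n≤0⇒n≡0 (≤-pred (subst (_≤ 1) (trans (hcE v) (cong (_+ hc Act′ v) (δ-refl v))) (h1 v)))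
      hb′ : hc Act′ b ≡ 0
      hb′ = m+n≡0⇒n≡0 (δ b v) (trans (sym (hcE b)) hb)
      v∈Z : v ∈ Z
      v∈Z with cv v (subst (1 ≤_) (sym (trans (hcE v) (cong (_+ hc Act′ v) (δ-refl v)))) (s≤s z≤n))
      ... | inj₁ p = ⊥-elim (pos≢0 p uv)
      ... | inj₂ p = p
      l′ : length Act′ ≡ k
      l′ = suc-injective (trans (sym (↭-length σ)) l)
      σ′ = split-↭ Fz σ
      hcup : ∀ x → 1 ≤ hc Act′ x → 1 ≤ hc Act x
      hcup x p = subst (1 ≤_) (sym (hcE x)) (≤-trans p (m≤n+m _ _))
      go : v ∈ Z → Dec (o ≡ b) → Gain (Fz ++ Act) (b ∷ [])
      go v∈ d with extract v∈
      -- Freezing this item costs an end at `b`, but it also removes the dead end `v`, so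
      -- `length Z < uc Act b` survives.
      go v∈ (yes refl) | Z′ , ζ = Gain-↭ σ′ (pull k Act′ (att v o ∷ Fz) b Z′ l′ (W-↭ σ′ w) h1′ hb′ cv′
          (≤-pred (subst₂ _<_ (↭-length ζ) (trans (ucE b) (cong (_+ uc Act′ b) (δ-refl b))) lt)))
        where
        cv′ : ∀ x → 1 ≤ hc Act′ x → 1 ≤ uc Act′ x ⊎ x ∈ Z′
        cv′ x p with cv x (hcup x p)
        ... | inj₂ x∈ with ∈-resp-↭ ζ x∈
        ...   | here refl = ⊥-elim (pos≢0 p hv′)
        ...   | there q = inj₂ q
        cv′ x p | inj₁ q with x ≟ b
        ...   | yes refl = ⊥-elim (pos≢0 p hb′)
        ...   | no x≢ = inj₁ (subst (1 ≤_) (trans (ucE x) (cong (_+ uc Act′ x) (δ-≢ x≢))) q)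
      -- Here the lost end is at `o`, which may become a dead end; it takes the place of `v` in `Z`.
      go v∈ (no o≢b) | Z′ , ζ = Gain-↭ σ′ (pull k Act′ (att v o ∷ Fz) b (o ∷ Z′) l′ (W-↭ σ′ w) h1′ hb′ cv′
          (subst₂ _<_ (↭-length ζ) (trans (ucE b) (cong (_+ uc Act′ b) (δ-≢ (λ e → o≢b (sym e))))) lt))
        where
        cv′ : ∀ x → 1 ≤ hc Act′ x → 1 ≤ uc Act′ x ⊎ x ∈ (o ∷ Z′)
        cv′ x p with cv x (hcup x p)
        ... | inj₂ x∈ with ∈-resp-↭ ζ x∈
        ...   | here refl = ⊥-elim (pos≢0 p hv′)
        ...   | there q = inj₂ (there q)
        cv′ x p | inj₁ q with x ≟ o
        ...   | yes refl = inj₂ (here refl)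
        ...   | no x≢ = inj₁ (subst (1 ≤_) (trans (ucE x) (cong (_+ uc Act′ x) (δ-≢ x≢))) q)
    pull (suc k) Act Fz b Z l w h1 hb cv lt | inj₂ nz with sumBy-pos (ui b) Act (≤-trans (s≤s z≤n) lt)
    ... | fr p q , i , ub with extract i | b ≟ p | b ≟ q
    ...   | Act′ , σ | yes refl | _ = Gain-↭ (split-↭ Fz σ) (Gain-attach (inj₁ refl) (Gain-nil (attL (W-↭ (split-↭ Fz σ) w))))
    ...   | Act′ , σ | no _ | yes refl = Gain-↭ (split-↭ Fz σ) (Gain-attach (inj₂ refl) (Gain-nil (attR (W-↭ (split-↭ Fz σ) w))))
    pull (suc k) Act Fz b Z l w h1 hb cv lt | inj₂ nz | att m o , i , ub with δ-pos {x = b} {o} ub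
    ... | refl with extract i
    -- Every head now has a spare end, and removing this item lowers the ends only at `b`, which is
    -- not a head. So the walk continues from `m` with an empty list of dead ends.
    ... | Act′ , σ = Gain-↭ σ′ (Gain-flip (λ v → +-comm (δ v b) _ ∙ lem (δ v m) (δ v b)) refl
            (pull k Act′ (att b m ∷ Fz) m [] l′ (flip (W-↭ σ′ w)) h1′ hm′ cv′ um′))
      where
      _∙_ = trans
      lem : ∀ a b → (a + 0) + b ≡ a + (b + 0)
      lem = solve-∀
      σ′ = split-↭ Fz σ
      hcE : ∀ x → hc Act x ≡ δ x m + hc Act′ x
      hcE x = sumBy-↭ (hi x) σ
      ucE : ∀ x → uc Act x ≡ δ x b + uc Act′ x
      ucE x = sumBy-↭ (ui x) σ
      l′ : length Act′ ≡ k
      l′ = suc-injective (trans (sym (↭-length σ)) l)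
      h1′ : ∀ x → hc Act′ x ≤ 1
      h1′ x = ≤-trans (m≤n+m _ _) (subst (_≤ 1) (hcE x) (h1 x))
      hmE : hc Act m ≡ suc (hc Act′ m)
      hmE = trans (hcE m) (cong (_+ hc Act′ m) (δ-refl m))
      hm′ : hc Act′ m ≡ 0
      hm′ = n≤0⇒n≡0 (≤-pred (subst (_≤ 1) hmE (h1 m)))
      ne : ∀ {x} → 1 ≤ hc Act x → x ≢ b
      ne p refl = pos≢0 p hb
      um′ : 1 ≤ uc Act′ m
      um′ = let p = subst (1 ≤_) (sym hmE) (s≤s z≤n) in
        subst (1 ≤_) (trans (ucE m) (cong (_+ uc Act′ m) (δ-≢ (ne p)))) (nz m p)
      cv′ : ∀ x → 1 ≤ hc Act′ x → 1 ≤ uc Act′ x ⊎ x ∈ []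
      cv′ x p = let p′ = subst (1 ≤_) (sym (hcE x)) (≤-trans p (m≤n+m _ _)) in
        inj₁ (subst (1 ≤_) (trans (ucE x) (cong (_+ uc Act′ x) (δ-≢ (ne p′)))) (nz x p′))

    -- The walks from the different x ∈ X are disjoint and each ends at a free path. A free
    -- path has two ends, so at most two walks meet there: these are the groups `two`.
    -- cur x is the vertex that the walk from x has reached so far.
    Plan : List Item → (V → V) → List V → Set
    Plan Act cur X = ∃[ gs ] verts gs ↭ X ×
      (∀ A R → Sel gs A R → ∀ Fz → W (Fz ++ Act) → Gain (Fz ++ Act) (map cur A))

    attEnd? : ∀ S (Y : List V) →
      (∃[ m ] ∃[ o ] att m o ∈ S × o ∈ Y) ⊎ (∀ {m o} → att m o ∈ S → o ∉ Y)
    attEnd? [] Y = inj₂ (λ ())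
    attEnd? (it ∷ S) Y with attEnd? S Y
    ... | inj₁ (m , o , i , j) = inj₁ (m , o , there i , j)
    attEnd? (fr p q ∷ S) Y | inj₂ k = inj₂ λ { (there i) → k i }
    attEnd? (att m o ∷ S) Y | inj₂ k with memb? _≟_ o Y
    ... | yes j = inj₁ (m , o , here refl , j)
    ... | no ¬j = inj₂ λ { (here refl) → ¬j ; (there i) → k i }

    -- No attached piece ends at the position of a walk, so every walk has arrived at an end of a
    -- free path. The other end of that path either carries another walk, which makes a pair, or it
    -- carries none.
    starFree : ∀ k Act cur X → length X ≤ k → Unique (map cur X) →
      (∀ {m o} → att m o ∈ Act → o ∉ map cur X) → (∀ {x} → x ∈ X → 1 ≤ uc Act (cur x)) → Plan Act cur X
    starFree k Act cur [] l u na pos = [] , ↭r , λ { _ _ nil Fz w → Gain-nil w }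
    starFree (suc k) Act cur (x ∷ X) (s≤s l) u na pos with sumBy-pos (ui (cur x)) Act (pos (here refl))
    ... | att m o , i , ub = ⊥-elim (na i (here (sym (δ-pos ub))))
    ... | fr p q , i , ub = go (ends ub)
      where
      c = cur x
      ends : 1 ≤ δ c p + δ c q → ∃[ d ] (fr p q ≡ fr c d ⊎ fr p q ≡ fr d c)
      ends h with c ≟ p | c ≟ q
      ... | yes refl | _ = q , inj₁ refl
      ... | no _ | yes refl = p , inj₂ refl
      go : ∃[ d ] (fr p q ≡ fr c d ⊎ fr p q ≡ fr d c) → Plan Act cur (x ∷ X)
      go (d , e) with extract i | memb? _≟_ d (map cur X)
      ... | Act′ , σ | no d∉ = one x ∷ gs , prep x π , sel
        where
        uE : ∀ {v} → v ≢ c → v ≢ d → uc Act v ≡ uc Act′ v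
        uE {v} v≢c v≢d = trans (sumBy-↭ (ui v) σ) (cong (_+ uc Act′ v) (ui-away e v≢c v≢d))
        rec = starFree k Act′ cur X l (Unique-tail u)
          (λ j o∈ → na (∈-resp-↭ (↭-sym σ) (there j)) (there o∈))
          (λ y∈ → subst (1 ≤_) (uE (λ eq → Unique-head u (subst (_∈ map cur X) eq (∈-map⁺ cur y∈)))
                                    (λ eq → d∉ (subst (_∈ map cur X) eq (∈-map⁺ cur y∈)))) (pos (there y∈)))
        gs = proj₁ rec
        π = proj₁ (proj₂ rec)
        sel : ∀ A R → Sel (one x ∷ gs) A R → ∀ Fz → W (Fz ++ Act) → Gain (Fz ++ Act) (map cur A)
        sel _ _ (in₁ s) Fz w = Gain-↭ (split-↭ Fz σ) (Gain-attach e (proj₂ (proj₂ rec) _ _ s (att c d ∷ Fz) (attach e (W-↭ (split-↭ Fz σ) w))))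
        sel _ _ (out₁ s) Fz w = Gain-↭ (split-↭ Fz σ) (proj₂ (proj₂ rec) _ _ s (fr p q ∷ Fz) (W-↭ (split-↭ Fz σ) w))
      ... | Act′ , σ | yes d∈ with ∈-map⁻ cur d∈
      ... | y , y∈ , refl with extract y∈
      ... | X′ , τ = two x y ∷ gs , ↭t (prep x (prep y π)) (prep x (↭-sym τ)) , sel
        where
        uE : ∀ {v} → v ≢ c → v ≢ cur y → uc Act v ≡ uc Act′ v
        uE {v} v≢c v≢d = trans (sumBy-↭ (ui v) σ) (cong (_+ uc Act′ v) (ui-away e v≢c v≢d))
        u′ : Unique (cur y ∷ map cur X′)
        u′ = Unique-↭ (map⁺ cur τ) (Unique-tail u)
        up : ∀ {z} → z ∈ X′ → z ∈ X
        up z∈ = ∈-resp-↭ (↭-sym τ) (there z∈)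
        upm : ∀ {z} → z ∈ map cur X′ → z ∈ map cur X
        upm z∈ = ∈-resp-↭ (↭-sym (map⁺ cur τ)) (there z∈)
        rec = starFree k Act′ cur X′ (≤-trans (n≤1+n _) (subst (_≤ k) (↭-length τ) l)) (Unique-tail u′)
          (λ j o∈ → na (∈-resp-↭ (↭-sym σ) (there j)) (there (upm o∈)))
          (λ z∈ → subst (1 ≤_) (uE (λ eq → Unique-head u (subst (_∈ map cur X) eq (∈-map⁺ cur (up z∈))))
                                    (λ eq → Unique-head u′ (subst (_∈ map cur X′) eq (∈-map⁺ cur z∈)))) (pos (there (up z∈))))
        gs = proj₁ rec
        π = proj₁ (proj₂ rec)
        sel : ∀ A R → Sel (two x y ∷ gs) A R → ∀ Fz → W (Fz ++ Act) → Gain (Fz ++ Act) (map cur A)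
        sel _ _ (inˡ s) Fz w = Gain-↭ (split-↭ Fz σ) (Gain-attach e (proj₂ (proj₂ rec) _ _ s (att c (cur y) ∷ Fz) (attach e (W-↭ (split-↭ Fz σ) w))))
        sel _ _ (inʳ s) Fz w = Gain-↭ (split-↭ Fz σ) (Gain-attach (Sum.swap e) (proj₂ (proj₂ rec) _ _ s (att (cur y) c ∷ Fz) (attach (Sum.swap e) (W-↭ (split-↭ Fz σ) w))))

    upd : (V → V) → V → V → V → V
    upd cur x m y with y ≟ x
    ... | yes _ = m
    ... | no  _ = cur y

    upd-≡ : ∀ cur x m → upd cur x m x ≡ m
    upd-≡ cur x m with x ≟ x
    ... | yes _ = refl
    ... | no p = ⊥-elim (p refl)

    upd-≢ : ∀ cur x m {y} → y ≢ x → upd cur x m y ≡ cur y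
    upd-≢ cur x m {y} p with y ≟ x
    ... | yes e = ⊥-elim (p e)
    ... | no _ = refl

    upd-map : ∀ cur x m X → x ∉ X → map (upd cur x m) X ≡ map cur X
    upd-map cur x m [] p = refl
    upd-map cur x m (y ∷ X) p = cong₂ _∷_ (upd-≢ cur x m (λ { refl → p (here refl) })) (upd-map cur x m X (λ q → p (there q)))

    -- A walk at the outer end of an attached piece moves to the head `m` of this piece. Positions
    -- are never heads (`hX`) and no vertex is a head twice (`h1`), so the walks stay apart. Each
    -- move consumes a piece, so all of them finally reach free paths.
    starPlan : ∀ k Act cur X → length Act ≡ k → Unique X → Unique (map cur X) → (∀ v → hc Act v ≤ 1) →
      (∀ {x} → x ∈ X → hc Act (cur x) ≡ 0) → (∀ v → 1 ≤ hc Act v → 1 ≤ uc Act v) →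
      (∀ {x} → x ∈ X → 1 ≤ uc Act (cur x)) → Plan Act cur X
    starPlan k Act cur X l uX u h1 hX ph pX with attEnd? Act (map cur X)
    ... | inj₂ na = starFree (length X) Act cur X ≤-refl u na pX
    ... | inj₁ (m , o , i , o∈) with ∈-map⁻ cur o∈ | extract i
    starPlan zero [] cur X l uX u h1 hX ph pX | inj₁ (m , o , () , o∈) | _ | _
    starPlan (suc k) Act cur X l uX u h1 hX ph pX | inj₁ (m , o , i , o∈) | x , x∈ , refl | Act′ , σ with extract x∈
    ... | X′ , τ = gs , π , sel
      where
      c = cur x
      cur′ = upd cur x m
      hcE : ∀ y → hc Act y ≡ δ y m + hc Act′ y
      hcE y = sumBy-↭ (hi y) σ
      ucE : ∀ y → uc Act y ≡ δ y c + uc Act′ y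
      ucE y = sumBy-↭ (ui y) σ
      hmE : hc Act m ≡ suc (hc Act′ m)
      hmE = trans (hcE m) (cong (_+ hc Act′ m) (δ-refl m))
      hm1 : 1 ≤ hc Act m
      hm1 = subst (1 ≤_) (sym hmE) (s≤s z≤n)
      hm′ : hc Act′ m ≡ 0
      hm′ = n≤0⇒n≡0 (≤-pred (subst (_≤ 1) hmE (h1 m)))
      ne : ∀ {y} → 1 ≤ hc Act y → y ≢ c
      ne p refl = pos≢0 p (hX x∈)
      uE : ∀ {y} → y ≢ c → uc Act y ≡ uc Act′ y
      uE {y} p = trans (ucE y) (cong (_+ uc Act′ y) (δ-≢ p))
      uτ : Unique (x ∷ X′)
      uτ = Unique-↭ τ uX
      x∉ : x ∉ X′
      x∉ = Unique-head uτ
      mapE : map cur′ X′ ≡ map cur X′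
      mapE = upd-map cur x m X′ x∉
      u′ : Unique (map cur′ X)
      u′ = Unique-↭ (map⁺ cur′ (↭-sym τ)) (subst Unique (cong₂ _∷_ (sym (upd-≡ cur x m)) (sym mapE))
             (Unique-cons m∉ (Unique-tail (Unique-↭ (map⁺ cur τ) u))))
        where
        m∉ : m ∉ map cur X′
        m∉ q with ∈-map⁻ cur q
        ... | y , y∈ , refl = pos≢0 hm1 (hX (∈-resp-↭ (↭-sym τ) (there y∈)))
      hX′ : ∀ {y} → y ∈ X → hc Act′ (cur′ y) ≡ 0
      hX′ {y} y∈ with y ≟ x
      ... | yes refl = hm′
      ... | no y≢ = m+n≡0⇒n≡0 (δ (cur y) m) (trans (sym (hcE (cur y))) (hX y∈))
      pX′ : ∀ {y} → y ∈ X → 1 ≤ uc Act′ (cur′ y)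
      pX′ {y} y∈ with y ≟ x
      ... | yes refl = subst (1 ≤_) (uE (ne hm1)) (ph m hm1)
      ... | no y≢ = subst (1 ≤_) (uE (λ e → Unique-head (Unique-↭ (map⁺ cur τ) u) (subst (_∈ map cur X′) e (∈-map⁺ cur y∈′)))) (pX y∈)
        where
        y∈′ : y ∈ X′
        y∈′ with ∈-resp-↭ τ y∈
        ... | here e = ⊥-elim (y≢ e)
        ... | there q = q
      rec = starPlan k Act′ cur′ X (suc-injective (trans (sym (↭-length σ)) l)) uX u′
        (λ y → ≤-trans (m≤n+m _ _) (subst (_≤ 1) (hcE y) (h1 y))) hX′
        (λ y p → let p′ = subst (1 ≤_) (sym (hcE y)) (≤-trans p (m≤n+m _ _)) in subst (1 ≤_) (uE (ne p′)) (ph y p′)) pX′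
      gs = proj₁ rec
      π = proj₁ (proj₂ rec)
      sel : ∀ A R → Sel gs A R → ∀ Fz → W (Fz ++ Act) → Gain (Fz ++ Act) (map cur A)
      -- The piece is only reserved for the walk of `x`; it is flipped exactly if this walk is
      -- carried out.
      sel A R s Fz w with memb? _≟_ x A
      ... | no x∉A = Gain-↭ σ′ (subst (Gain _) (upd-map cur x m A x∉A) (proj₂ (proj₂ rec) A R s (att m c ∷ Fz) (W-↭ σ′ w)))
        where σ′ = split-↭ Fz σ
      ... | yes x∈A with extract x∈A
      ... | A′ , α = Gain-↭ σ′ (Gain-flip bal (trans (length-map cur A) (sym (length-map cur′ A)))
              (proj₂ (proj₂ rec) A R s (att c m ∷ Fz) (flip (W-↭ σ′ w))))
        where
        σ′ = split-↭ Fz σ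
        x∉A′ : x ∉ A′
        x∉A′ q = Unique-head (Unique-↭ (++↭ α) (Unique-↭ (↭-sym (↭t (Sel-↭ s) π)) uX)) (++∈ q)
          where
          ++↭ : A ↭ x ∷ A′ → A ++ R ↭ x ∷ (A′ ++ R)
          ++↭ p = ++⁺ʳ R p
          ++∈ : x ∈ A′ → x ∈ A′ ++ R
          ++∈ = ∈-++⁺ˡ
        bal : ∀ v → δ v c + cnt v (map cur′ A) ≡ δ v m + cnt v (map cur A)
        bal v = trans (cong (δ v c +_) (trans (sumBy-↭ (δ v) (map⁺ cur′ α)) (cong₂ _+_ (cong (δ v) (upd-≡ cur x m)) (cong (cnt v) (upd-map cur x m A′ x∉A′)))))
                 (trans (lem (δ v c) (δ v m) _) (cong (δ v m +_) (sym (sumBy-↭ (δ v) (map⁺ cur α)))))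
          where
          lem : ∀ a b c → a + (b + c) ≡ b + (a + c)
          lem = solve-∀

  -- Decompositions cut open at a vertex

  pc : V → V → V → V → ℕ
  pc u v x y = δ u x * δ v y + δ u y * δ v x

  pc-sym : ∀ u v x y → pc u v x y ≡ pc u v y x
  pc-sym u v x y = +-comm (δ u x * δ v y) _

  -- How often the list runs along the edge `u v`, in either direction. With multiplicities,
  -- covering and disjointness become the single equation `edges` of `Dcp`.
  ec : V → V → List V → ℕ
  ec u v []           = 0
  ec u v (x ∷ [])     = 0
  ec u v (x ∷ y ∷ xs) = pc u v x y + ec u v (y ∷ xs)

  ec-∉ : ∀ u v xs → u ∉ xs → ec u v xs ≡ 0
  ec-∉ u v [] p = refl
  ec-∉ u v (x ∷ []) p = refl
  ec-∉ u v (x ∷ y ∷ xs) p = cong₂ _+_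
    (cong₂ (λ a b → a * δ v y + b * δ v x) (δ-≢ {x = u} {x} (λ { refl → p (here refl) })) (δ-≢ {x = u} {y} (λ { refl → p (there (here refl)) })))
    (ec-∉ u v (y ∷ xs) (λ q → p (there q)))

  lastv : V → List V → V
  lastv x []      = x
  lastv x (y ∷ l) = lastv y l

  lastv-∈ : ∀ x l → lastv x l ∈ x ∷ l
  lastv-∈ x [] = here refl
  lastv-∈ x (y ∷ l) = there (lastv-∈ y l)

  zipL : List V → V → List V → V × List V
  zipL []      a r = a , r
  zipL (x ∷ l) a r = zipL l x (a ∷ r)

  zip-fst : ∀ l a r → proj₁ (zipL l a r) ≡ lastv a l
  zip-fst [] a r = refl
  zip-fst (x ∷ l) a r = zip-fst l x (a ∷ r)

  zip-last : ∀ l a r → lastv (proj₁ (zipL l a r)) (proj₂ (zipL l a r)) ≡ lastv a r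
  zip-last [] a r = refl
  zip-last (x ∷ l) a r = zip-last l x (a ∷ r)

  ver : V × List V → List V
  ver (x , l) = x ∷ l

  zip-ec : ∀ u v l a r → ec u v (ver (zipL l a r)) ≡ ec u v (a ∷ l) + ec u v (a ∷ r)
  zip-ec u v [] a r = refl
  zip-ec u v (x ∷ l) a r = trans (zip-ec u v l x (a ∷ r))
    (trans (cong (λ z → ec u v (x ∷ l) + (z + ec u v (a ∷ r))) (pc-sym u v x a)) (lem (ec u v (x ∷ l)) (pc u v a x) _))
    where lem : ∀ a b c → a + (b + c) ≡ b + a + c
          lem = solve-∀

  zip-↭ : ∀ l a r → ver (zipL l a r) ↭ a ∷ l ++ r
  zip-↭ [] a r = ↭r
  zip-↭ (x ∷ l) a r = ↭t (zip-↭ l x (a ∷ r)) (↭t (prep x (shift a l r)) (swap x a ↭r))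

  unzip : ∀ a acc x l → a ∈ x ∷ l → ∃[ l′ ] ∃[ r ] zipL l′ a r ≡ zipL acc x l
  unzip a acc x l (here refl) = acc , l , refl
  unzip a acc x (y ∷ l) (there p) = unzip a (x ∷ acc) y l p

  en : V → V × List V → ℕ
  en v (x , l) = δ v x + δ v (lastv x l)

  -- One-vertex paths are allowed; they add 2 to the number of ends at their vertex.
  record Dcp (A : V → V → Bool) (f : V → ℕ) : Set where
    constructor dcp
    field
      ps    : List (V × List V)
      uniq  : All (λ p → Unique (ver p)) ps
      edges : ∀ u v → sumBy (λ p → ec u v (ver p)) ps ≡ b2n (A u v)
      ends  : ∀ v → sumBy (en v) ps ≡ f v

  Dcp-adj : ∀ {A A′ f} → (∀ u v → A u v ≡ A′ u v) → Dcp A f → Dcp A′ f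
  Dcp-adj e (dcp ps u ed en′) = dcp ps u (λ x y → trans (ed x y) (cong b2n (e x y))) en′

  module Local (a : V) where

    -- arms l r is the path whose vertices are l reversed, then a, then r.
    data Pth : Set where
      arms : List V → List V → Pth
      free : V → List V → Pth

    Ok : Pth → Set
    Ok (arms l r) = Unique (a ∷ l ++ r)
    Ok (free x l) = Unique (x ∷ l) × a ∉ (x ∷ l)

    armI : List V → List Item
    armI []      = []
    armI (m ∷ l) = att m (lastv m l) ∷ []

    itemsOf : Pth → List Item
    itemsOf (arms l r) = armI l ++ armI r
    itemsOf (free x l) = fr x (lastv x l) ∷ []

    items : List Pth → List Item
    items []       = []
    items (q ∷ qs) = itemsOf q ++ items qs

    ie : V → V → Pth → ℕ
    ie u v (arms l r) = ec u v l + ec u v r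
    ie u v (free x l) = ec u v (x ∷ l)

    -- An empty arm is a path end at `a`; with both arms empty the path is the single vertex `a`,
    -- with two ends there.
    em : List V → ℕ
    em []      = 1
    em (_ ∷ _) = 0

    eE : Pth → ℕ
    eE (arms l r) = em l + em r
    eE (free _ _) = 0

    -- The effect of one move on the whole system: a single item changes, the edges away from `a`
    -- stay, and `a` gains `d` path ends.
    record Rep (it it′ : Item) (d : ℕ) (qs qs′ : List Pth) : Set where
      constructor rep
      field
        rest : List Item
        old  : items qs ↭ it ∷ rest
        new  : items qs′ ↭ it′ ∷ rest
        ies  : ∀ u v → sumBy (ie u v) qs′ ≡ sumBy (ie u v) qs
        ees  : sumBy eE qs′ ≡ d + sumBy eE qs

    lift : ∀ {it it′ d} → (∀ q → Ok q → it ∈ itemsOf q → ∃[ q′ ] Ok q′ × Rep it it′ d (q ∷ []) (q′ ∷ [])) →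
      ∀ qs → All Ok qs → it ∈ items qs → ∃[ qs′ ] All Ok qs′ × Rep it it′ d qs qs′
    lift {it} {it′} {d} h (q ∷ qs) (o ∷ os) i with ∈-++⁻ (itemsOf q) i
    ... | inj₁ j with h q o j
    ...   | q′ , o′ , rep rs p p′ e e′ = q′ ∷ qs , o′ ∷ os , rep (rs ++ items qs)
            (++⁺ʳ (items qs) (subst (_↭ it ∷ rs) (++-identityʳ _) p)) (++⁺ʳ (items qs) (subst (_↭ it′ ∷ rs) (++-identityʳ _) p′))
            (λ u v → cong (_+ sumBy (ie u v) qs) (trans (sym (+-identityʳ _)) (trans (e u v) (+-identityʳ _))))
            (trans (cong (_+ sumBy eE qs) (trans (sym (+-identityʳ _)) e′)) (lem d (eE q) _))
      where
      lem : ∀ a b c → a + (b + 0) + c ≡ a + (b + c)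
      lem = solve-∀
    lift {it} {it′} {d} h (q ∷ qs) (o ∷ os) i | inj₂ j with lift h qs os j
    ...   | qs′ , os′ , rep rs p p′ e e′ = q ∷ qs′ , o ∷ os′ , rep (itemsOf q ++ rs)
            (↭t (++⁺ˡ (itemsOf q) p) (shift it (itemsOf q) rs)) (↭t (++⁺ˡ (itemsOf q) p′) (shift it′ (itemsOf q) rs))
            (λ u v → cong (ie u v q +_) (e u v))
            (trans (cong (eE q +_) e′) (lem (eE q) d _))
      where
      lem : ∀ a b c → a + (b + c) ≡ b + (a + c)
      lem = solve-∀

    rev : ∀ m l → ∃[ l′ ] lastv (lastv m l) l′ ≡ m × (∀ u v → ec u v (lastv m l ∷ l′) ≡ ec u v (m ∷ l)) × (lastv m l ∷ l′ ↭ m ∷ l)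
    rev m l = l′ , subst (λ z → lastv z l′ ≡ m) e (zip-last l m []) ,
        (λ u v → trans (subst (λ z → ec u v (z ∷ l′) ≡ ec u v (m ∷ l) + 0) e (zip-ec u v l m [])) (+-identityʳ _)) ,
        subst (λ z → z ∷ l′ ↭ m ∷ l) e (subst (λ z → ver (zipL l m []) ↭ m ∷ z) (++-identityʳ l) (zip-↭ l m []))
      where
      l′ = proj₂ (zipL l m [])
      e = zip-fst l m []

    -- Reversing an arm keeps the vertex set of the path, so the result is again a path; only its
    -- edge at `a` on this side changes.
    flipQ : ∀ {m o} q → Ok q → att m o ∈ itemsOf q → ∃[ q′ ] Ok q′ × Rep (att m o) (att o m) 0 (q ∷ []) (q′ ∷ [])
    flipQ (free x l) o (here ())
    flipQ (arms (m ∷ l) r) ok (here refl) with rev m l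
    ... | l′ , e1 , e2 , p = arms (lastv m l ∷ l′) r , Unique-↭ (prep a (++⁺ʳ r (↭-sym p))) ok ,
          rep (armI r ++ []) ↭r (subst (λ z → att (lastv m l) (lastv (lastv m l) l′) ∷ armI r ++ [] ↭ att (lastv m l) z ∷ armI r ++ []) e1 ↭r)
            (λ u v → cong (λ z → z + ec u v r + 0) (e2 u v)) refl
    flipQ (arms [] (m ∷ r)) ok (here refl) with rev m r
    ... | r′ , e1 , e2 , p = arms [] (lastv m r ∷ r′) , Unique-↭ (prep a (↭-sym p)) ok ,
          rep [] ↭r (subst (λ z → att (lastv m r) (lastv (lastv m r) r′) ∷ [] ↭ att (lastv m r) z ∷ []) e1 ↭r)
            (λ u v → cong (_+ 0) (e2 u v)) refl
    flipQ (arms (m′ ∷ l) (m ∷ r)) ok (there (here refl)) with rev m r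
    ... | r′ , e1 , e2 , p = arms (m′ ∷ l) (lastv m r ∷ r′) , Unique-↭ (prep a (++⁺ˡ (m′ ∷ l) (↭-sym p))) ok ,
          rep (att m′ (lastv m′ l) ∷ []) (swap _ _ ↭r)
            (subst (λ z → att m′ (lastv m′ l) ∷ att (lastv m r) (lastv (lastv m r) r′) ∷ [] ↭ att (lastv m r) z ∷ att m′ (lastv m′ l) ∷ []) e1 (swap _ _ ↭r))
            (λ u v → cong (λ z → ec u v (m′ ∷ l) + z + 0) (e2 u v)) refl

    attLQ : ∀ {p q′} q → Ok q → fr p q′ ∈ itemsOf q → ∃[ q″ ] Ok q″ × Rep (fr p q′) (att p q′) 1 (q ∷ []) (q″ ∷ [])
    attLQ (free x l) (u , a∉) (here refl) = arms (x ∷ l) [] , subst (λ z → Unique (a ∷ z)) (sym (++-identityʳ (x ∷ l))) (Unique-cons a∉ u) ,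
          rep [] ↭r ↭r (λ u v → cong (_+ 0) (+-identityʳ _)) refl
    attLQ (arms [] (m ∷ r)) ok (here ())
    attLQ (arms (x ∷ l) []) ok (here ())
    attLQ (arms (x ∷ l) (m ∷ r)) ok (there (here ()))

    attRQ : ∀ {p q′} q → Ok q → fr p q′ ∈ itemsOf q → ∃[ q″ ] Ok q″ × Rep (fr p q′) (att q′ p) 1 (q ∷ []) (q″ ∷ [])
    attRQ (free x l) (u , a∉) (here refl) with rev x l
    ... | l′ , e1 , e2 , p = arms (lastv x l ∷ l′) [] ,
          subst (λ z → Unique (a ∷ z)) (sym (++-identityʳ (lastv x l ∷ l′))) (Unique-↭ (prep a (↭-sym p)) (Unique-cons a∉ u)) ,
          rep [] ↭r (subst (λ z → att (lastv x l) (lastv (lastv x l) l′) ∷ [] ↭ att (lastv x l) z ∷ []) e1 ↭r)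
            (λ u v → cong (_+ 0) (trans (+-identityʳ _) (e2 u v))) refl
    attRQ (arms [] (m ∷ r)) ok (here ())
    attRQ (arms (x ∷ l) []) ok (here ())
    attRQ (arms (x ∷ l) (m ∷ r)) ok (there (here ()))

    module Fixed (B : V → V → ℕ) (K : ℕ) where

      -- `B` fixes the edges that avoid `a`, while those at `a` are the heads in `S`. `K` is
      -- invariant because a free path that is attached leaves a path end at `a`.
      W : List Item → Set
      W S = ∃[ qs ] All Ok qs × (items qs ↭ S) × (∀ u v → sumBy (ie u v) qs ≡ B u v) × sumBy eE qs + nf S ≡ K

      W-↭ : ∀ {S T} → S ↭ T → W S → W T
      W-↭ p (qs , ok , q , e , k) = qs , ok , ↭t q p , e , trans (cong (sumBy eE qs +_) (sym (sumBy-↭ ni p))) k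

      move : ∀ {it it′ d S} → ni it ≡ d + ni it′ →
        (∀ q → Ok q → it ∈ itemsOf q → ∃[ q′ ] Ok q′ × Rep it it′ d (q ∷ []) (q′ ∷ [])) → W (it ∷ S) → W (it′ ∷ S)
      move {it} {it′} {d} {S} ne h (qs , ok , p , e , k) with lift h qs ok (∈-resp-↭ (↭-sym p) (here refl))
      ... | qs′ , ok′ , rep rs o nw i′ e′ = qs′ , ok′ , ↭t nw (prep it′ (drop-∷ (↭t (↭-sym o) p))) ,
            (λ u v → trans (i′ u v) (e u v)) ,
            trans (cong (_+ nf (it′ ∷ S)) e′) (trans (lem d (sumBy eE qs) (ni it′) (nf S)) (trans (cong (λ z → sumBy eE qs + (z + nf S)) (sym ne)) k))
        where
        lem : ∀ a b c d → a + b + (c + d) ≡ b + (a + c + d)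
        lem = solve-∀

      open Orient W W-↭ (move refl flipQ) (move refl attLQ) (move refl attRQ) public

    Match : V × List V → Pth → Set
    Match p q = (∀ u v → ec u v (ver p) ≡ ie u v q + (δ u a * hc (itemsOf q) v + δ v a * hc (itemsOf q) u))
              × (∀ v → en v p ≡ uc (itemsOf q) v + δ v a * eE q)

    arm-ec : ∀ u v l → ec u v (a ∷ l) ≡ ec u v l + (δ u a * hc (armI l) v + δ v a * hc (armI l) u)
    arm-ec u v [] = sym (cong₂ _+_ (*-zeroʳ (δ u a)) (*-zeroʳ (δ v a)))
    arm-ec u v (m ∷ l) = lem (δ u a) (δ v m) (δ u m) (δ v a) (ec u v (m ∷ l))
      where
      lem : ∀ a b c d e → (a * b + c * d) + e ≡ e + (a * (b + 0) + d * (c + 0))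
      lem = solve-∀

    arm-en : ∀ v l → δ v (lastv a l) ≡ uc (armI l) v + δ v a * em l
    arm-en v [] = sym (*-identityʳ _)
    arm-en v (m ∷ l) = lem (δ v (lastv m l)) (δ v a)
      where
      lem : ∀ a b → a ≡ a + 0 + b * 0
      lem = solve-∀

    match-arms : ∀ l r → Match (zipL l a r) (arms l r)
    match-arms l r = (λ u v → trans (zip-ec u v l a r) (trans (cong₂ _+_ (arm-ec u v l) (arm-ec u v r))
        (trans (lem (ec u v l) (ec u v r) (δ u a) (δ v a) (hc (armI l) v) (hc (armI l) u) (hc (armI r) v) (hc (armI r) u))
          (sym (cong₂ (λ y z → ec u v l + ec u v r + (δ u a * y + δ v a * z)) (sumBy-++ (hi v) (armI l)) (sumBy-++ (hi u) (armI l)))))))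
      , (λ v → trans (cong₂ _+_ (trans (cong (δ v) (zip-fst l a r)) (arm-en v l)) (trans (cong (δ v) (zip-last l a r)) (arm-en v r)))
         (trans (lem2 (uc (armI l) v) (uc (armI r) v) (δ v a) (em l) (em r)) (cong (_+ δ v a * (em l + em r)) (sym (sumBy-++ (ui v) (armI l))))))
      where
      lem : ∀ e f a b p q r s → (e + (a * p + b * q)) + (f + (a * r + b * s)) ≡ (e + f) + (a * (p + r) + b * (q + s))
      lem = solve-∀
      lem2 : ∀ p q d e f → (p + d * e) + (q + d * f) ≡ (p + q) + d * (e + f)
      lem2 = solve-∀

    match-free : ∀ x l → Match (x , l) (free x l)
    match-free x l = (λ u v → lem (ec u v (x ∷ l)) (δ u a) (δ v a)) , (λ v → lem2 (δ v x + δ v (lastv x l)) (δ v a))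
      where
      lem : ∀ e a b → e ≡ e + (a * 0 + b * 0)
      lem = solve-∀
      lem2 : ∀ e a → e ≡ e + 0 + a * 0
      lem2 = solve-∀

    toQ : ∀ p → Unique (ver p) → ∃[ q ] Ok q × Match p q
    toQ (x , l) u with memb? _≟_ a (x ∷ l)
    ... | no a∉ = free x l , (u , a∉) , match-free x l
    ... | yes a∈ with unzip a [] x l a∈
    ...   | l′ , r , e = arms l′ r , Unique-↭ (zip-↭ l′ a r) (subst (λ z → Unique (ver z)) (sym e) u) ,
              subst (λ z → Match z (arms l′ r)) e (match-arms l′ r)

    toP : ∀ q → Ok q → ∃[ p ] Unique (ver p) × Match p q
    toP (arms l r) ok = zipL l a r , Unique-↭ (↭-sym (zip-↭ l a r)) ok , match-arms l r
    toP (free x l) (u , _) = (x , l) , u , match-free x l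

    Matches : List (V × List V) → List Pth → Set
    Matches ps qs = (∀ u v → sumBy (λ p → ec u v (ver p)) ps ≡ sumBy (ie u v) qs + (δ u a * hc (items qs) v + δ v a * hc (items qs) u))
              × (∀ v → sumBy (en v) ps ≡ uc (items qs) v + δ v a * sumBy eE qs)

    matches-nil : Matches [] []
    matches-nil = (λ u v → sym (cong₂ _+_ (*-zeroʳ (δ u a)) (*-zeroʳ (δ v a)))) , (λ v → sym (*-zeroʳ (δ v a)))

    matches-cons : ∀ {p q ps qs} → Match p q → Matches ps qs → Matches (p ∷ ps) (q ∷ qs)
    matches-cons {p} {q} {ps} {qs} (m1 , m2) (e1 , e2) =
        (λ u v → trans (cong₂ _+_ (m1 u v) (e1 u v))
          (trans (lem (ie u v q) (sumBy (ie u v) qs) (δ u a) (δ v a) _ _ _ _)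
            (sym (cong₂ (λ y z → ie u v q + sumBy (ie u v) qs + (δ u a * y + δ v a * z)) (sumBy-++ (hi v) (itemsOf q)) (sumBy-++ (hi u) (itemsOf q))))))
      , (λ v → trans (cong₂ _+_ (m2 v) (e2 v)) (trans (lem2 (uc (itemsOf q) v) (uc (items qs) v) (δ v a) (eE q) _)
            (cong (_+ δ v a * (eE q + sumBy eE qs)) (sym (sumBy-++ (ui v) (itemsOf q))))))
      where
      lem : ∀ e f a b p q r s → (e + (a * p + b * q)) + (f + (a * r + b * s)) ≡ (e + f) + (a * (p + r) + b * (q + s))
      lem = solve-∀
      lem2 : ∀ p q d e f → (p + d * e) + (q + d * f) ≡ (p + q) + d * (e + f)
      lem2 = solve-∀

    toQs : ∀ ps → All (λ p → Unique (ver p)) ps → ∃[ qs ] All Ok qs × Matches ps qs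
    toQs [] [] = [] , [] , matches-nil
    toQs (p ∷ ps) (u ∷ us) with toQ p u | toQs ps us
    ... | q , o , m | qs , os , ms = q ∷ qs , o ∷ os , matches-cons {p} {q} {ps} {qs} m ms

    toPs : ∀ qs → All Ok qs → ∃[ ps ] All (λ p → Unique (ver p)) ps × Matches ps qs
    toPs [] [] = [] , [] , matches-nil
    toPs (q ∷ qs) (o ∷ os) with toP q o | toPs qs os
    ... | p , u , m | ps , us , ms = p ∷ ps , u ∷ us , matches-cons {p} {q} {ps} {qs} m ms

    ie-a : ∀ v qs → All Ok qs → sumBy (ie a v) qs ≡ 0
    ie-a v [] [] = refl
    ie-a v (arms l r ∷ qs) (o ∷ os) = cong₂ _+_ (cong₂ _+_
      (ec-∉ a v l (λ p → Unique-head o (∈-++⁺ˡ p))) (ec-∉ a v r (λ p → Unique-head o (∈-++⁺ʳ l p)))) (ie-a v qs os)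
    ie-a v (free x l ∷ qs) ((_ , a∉) ∷ os) = cong₂ _+_ (ec-∉ a v (x ∷ l) a∉) (ie-a v qs os)

    hc-a : ∀ qs → All Ok qs → hc (items qs) a ≡ 0
    hc-a [] [] = refl
    hc-a (q ∷ qs) (o ∷ os) = trans (sumBy-++ (hi a) (itemsOf q)) (cong₂ _+_ (h q o) (hc-a qs os))
      where
      g : ∀ l → a ∉ l → hc (armI l) a ≡ 0
      g [] p = refl
      g (m ∷ l) p = trans (+-identityʳ _) (δ-≢ (λ { refl → p (here refl) }))
      h : ∀ q → Ok q → hc (itemsOf q) a ≡ 0
      h (free x l) o = refl
      h (arms l r) o = trans (sumBy-++ (hi a) (armI l)) (cong₂ _+_ (g l (λ p → Unique-head o (∈-++⁺ˡ p))) (g r (λ p → Unique-head o (∈-++⁺ʳ l p))))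

    module Cut {A : V → V → Bool} {f : V → ℕ} (D : Dcp A f) where
      open Dcp D
      private
        loc = toQs ps uniq
      qs = proj₁ loc
      ok = proj₁ (proj₂ loc)
      mt = proj₂ (proj₂ loc)
      S₀ = items qs
      open Fixed (λ u v → sumBy (ie u v) qs) (sumBy eE qs + nf S₀) public

      w₀ : W S₀
      w₀ = qs , ok , ↭r , (λ u v → refl) , refl

      hc₀ : ∀ {v} → v ≢ a → hc S₀ v ≡ b2n (A a v)
      hc₀ {v} p = trans (sym lem) (trans (sym (proj₁ mt a v)) (edges a v))
        where
        lem : sumBy (ie a v) qs + (δ a a * hc S₀ v + δ v a * hc S₀ a) ≡ hc S₀ v
        lem rewrite ie-a v qs ok | δ-refl a | δ-≢ p = trans (+-identityʳ _) (+-identityʳ _)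

      hc₀a : hc S₀ a ≡ 0
      hc₀a = hc-a qs ok

      hc₀≤1 : ∀ v → hc S₀ v ≤ 1
      hc₀≤1 v with v ≟ a
      ... | yes refl = subst (_≤ 1) (sym hc₀a) z≤n
      ... | no p = subst (_≤ 1) (sym (hc₀ p)) (b2n≤1 _)

      hc₀-pos : ∀ v → 1 ≤ hc S₀ v → v ≢ a × A a v ≡ true
      hc₀-pos v p with v ≟ a
      ... | yes refl = ⊥-elim (pos≢0 p hc₀a)
      ... | no q = q , b2n-pos (subst (1 ≤_) (hc₀ q) p)

      uc₀ : ∀ {v} → v ≢ a → uc S₀ v ≡ f v
      uc₀ {v} p = trans (sym lem) (trans (sym (proj₂ mt v)) (ends v))
        where
        lem : uc S₀ v + δ v a * sumBy eE qs ≡ uc S₀ v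
        lem rewrite δ-≢ p = +-identityʳ _

      -- For each regained edge `a x`, `tot` takes an end away from `x`, and the invariant `K`
      -- returns one at `a`.
      exit : ∀ {X A′} → Gain S₀ X → (∀ u v → b2n (A′ u v) ≡ b2n (A u v) + (δ u a * cnt v X + δ v a * cnt u X)) →
        ∃[ f′ ] Dcp A′ f′ × (∀ v → f′ v + cnt v X ≡ f v + δ v a * length X)
      exit {X} {A′} (gain S′ (qs′ , ok′ , p , B′ , K′) hd tot′ ff) adjE with toPs qs′ ok′
      ... | ps′ , us , m1 , m2 = f′ , dcp ps′ us ed m2 , fe
        where
        E = sumBy eE qs
        E′ = sumBy eE qs′
        f′ : V → ℕ
        f′ v = uc (items qs′) v + δ v a * E′
        hE : ∀ v → hc (items qs′) v ≡ hc S₀ v + cnt v X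
        hE v = trans (sumBy-↭ (hi v) p) (hd v)
        ed : ∀ u v → sumBy (λ q → ec u v (ver q)) ps′ ≡ b2n (A′ u v)
        ed u v = trans (m1 u v) (trans (cong₂ _+_ (B′ u v) (cong₂ (λ y z → δ u a * y + δ v a * z) (hE v) (hE u)))
          (trans (lem (sumBy (ie u v) qs) (δ u a) (hc S₀ v) (cnt v X) (δ v a) (hc S₀ u) (cnt u X))
            (trans (cong (_+ (δ u a * cnt v X + δ v a * cnt u X)) (trans (sym (proj₁ mt u v)) (edges u v))) (sym (adjE u v)))))
          where
          lem : ∀ b d h x d′ h′ x′ → b + (d * (h + x) + d′ * (h′ + x′)) ≡ (b + (d * h + d′ * h′)) + (d * x + d′ * x′)
          lem = solve-∀
        uE : ∀ v → uc (items qs′) v + cnt v X ≡ uc S₀ v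
        uE v = +-cancelˡ-≡ (hc S₀ v) _ _ (trans (lem (hc S₀ v) (uc (items qs′) v) (cnt v X)) (trans (cong₂ _+_ (sym (hd v)) (sumBy-↭ (ui v) p)) (tot′ v)))
          where
          lem : ∀ h u x → h + (u + x) ≡ (h + x) + u
          lem = solve-∀
        EE : E′ ≡ E + length X
        EE = +-cancelʳ-≡ (nf S′) _ _ (trans K′ (trans (cong (E +_) (sym ff)) (lem E (nf S′) (length X))))
          where
          lem : ∀ e s l → e + (s + l) ≡ e + l + s
          lem = solve-∀
        fe : ∀ v → f′ v + cnt v X ≡ f v + δ v a * length X
        fe v = trans (cong (λ z → uc (items qs′) v + δ v a * z + cnt v X) EE)
          (trans (lem (uc (items qs′) v) (δ v a) E (length X) (cnt v X))
            (trans (cong (λ z → z + δ v a * E + δ v a * length X) (uE v)) (cong (_+ δ v a * length X) (trans (sym (proj₂ mt v)) (ends v)))))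
          where
          lem : ∀ u d e l x → u + d * (e + l) + x ≡ (u + x) + d * e + d * l
          lem = solve-∀

  opaque
    pullD : ∀ {A A′ f} a b Z → a ≢ b → Dcp A f → A a b ≡ false →
      (∀ v → v ≢ a → A a v ≡ true → 1 ≤ f v ⊎ v ∈ Z) → length Z < f b →
      (∀ u v → b2n (A′ u v) ≡ b2n (A u v) + (δ u a * δ v b + δ v a * δ u b)) →
      ∃[ f′ ] Dcp A′ f′ × (∀ v → f′ v + δ v b ≡ f v + δ v a)
    pullD {A} {A′} {f} a b Z a≢b D Aab cov lt adjE = tidy (exit {A′ = A′} pulled adjE′)
      where
      open Local a
      open Cut D
      b≢a : b ≢ a
      b≢a e = a≢b (sym e)
      cv : ∀ {v} → v ≢ a → 1 ≤ f v ⊎ v ∈ Z → 1 ≤ uc S₀ v ⊎ v ∈ Z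
      cv q (inj₁ x) = inj₁ (subst (1 ≤_) (sym (uc₀ q)) x)
      cv q (inj₂ x) = inj₂ x
      pulled : Gain S₀ (b ∷ [])
      pulled = pull (length S₀) S₀ [] b Z refl w₀ hc₀≤1 (trans (hc₀ b≢a) (cong b2n Aab))
        (λ v p → cv (proj₁ (hc₀-pos v p)) (cov v (proj₁ (hc₀-pos v p)) (proj₂ (hc₀-pos v p)))) (subst (length Z <_) (sym (uc₀ b≢a)) lt)
      adjE′ : ∀ u v → b2n (A′ u v) ≡ b2n (A u v) + (δ u a * cnt v (b ∷ []) + δ v a * cnt u (b ∷ []))
      adjE′ u v = trans (adjE u v) (cong₂ (λ y z → b2n (A u v) + (δ u a * y + δ v a * z)) (sym (+-identityʳ _)) (sym (+-identityʳ _)))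
      tidy : ∃[ f′ ] Dcp A′ f′ × (∀ v → f′ v + cnt v (b ∷ []) ≡ f v + δ v a * 1) → ∃[ f′ ] Dcp A′ f′ × (∀ v → f′ v + δ v b ≡ f v + δ v a)
      tidy (f′ , D′ , fe) = f′ , D′ , λ v → trans (cong (f′ v +_) (sym (+-identityʳ _))) (trans (fe v) (cong (f v +_) (*-identityʳ _)))

  opaque
    starD : ∀ {A f} a X → a ∉ X → Unique X → Dcp A f → (∀ {x} → x ∈ X → A a x ≡ false) →
      (∀ v → v ≢ a → A a v ≡ true → 1 ≤ f v) → (∀ {x} → x ∈ X → 1 ≤ f x) →
      ∃[ gs ] verts gs ↭ X × (∀ Y R → Sel gs Y R → ∀ A′ →
        (∀ u v → b2n (A′ u v) ≡ b2n (A u v) + (δ u a * cnt v Y + δ v a * cnt u Y)) →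
        ∃[ f′ ] Dcp A′ f′ × (∀ v → f′ v + cnt v Y ≡ f v + δ v a * length Y))
    starD {A} {f} a X a∉ uX D AX posN posX = proj₁ plan , proj₁ (proj₂ plan) ,
        λ Y R s A′ adjE → exit {A′ = A′} (subst (Gain S₀) (map-id Y) (proj₂ (proj₂ plan) Y R s [] w₀)) adjE
      where
      open Local a
      open Cut D
      X≢ : ∀ {x} → x ∈ X → x ≢ a
      X≢ x∈ refl = a∉ x∈
      plan : Plan S₀ (λ x → x) X
      plan = starPlan (length S₀) S₀ (λ x → x) X refl uX (subst Unique (sym (map-id X)) uX) hc₀≤1
        (λ x∈ → trans (hc₀ (X≢ x∈)) (cong b2n (AX x∈)))
        (λ v p → let (q , r) = hc₀-pos v p in subst (1 ≤_) (sym (uc₀ q)) (posN v q r))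
        (λ x∈ → subst (1 ≤_) (sym (uc₀ (X≢ x∈))) (posX x∈))

  -- Restoring a single edge

  ev : Graph n → V → Bool
  ev G v = pb (degree G v)

  degree-ΣF : ∀ (G : Graph n) v → degree G v ≡ ΣF (λ u → b2n (adj G v u))
  degree-ΣF G v = count-ΣF (adj G v)

  hit : V → V → V → V → Bool
  hit u v x y = (⌊ x ≟ u ⌋ ∧ ⌊ y ≟ v ⌋) ∨ (⌊ x ≟ v ⌋ ∧ ⌊ y ≟ u ⌋)

  hit-sym : ∀ u v x y → hit u v x y ≡ hit u v y x
  hit-sym u v x y = trans (∨-comm (⌊ x ≟ u ⌋ ∧ ⌊ y ≟ v ⌋) _) (cong₂ _∨_ (∧-comm ⌊ x ≟ v ⌋ _) (∧-comm ⌊ x ≟ u ⌋ _))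

  del : V → V → Graph n → Graph n
  del u v G = record
    { adj    = λ x y → adj G x y ∧ not (hit u v x y)
    ; sym    = λ x y → cong₂ (λ a b → a ∧ not b) (adj-sym G x y) (hit-sym u v x y)
    ; irrefl = λ x → cong (_∧ not (hit u v x x)) (irrefl G x)
    }

  Adj-sym : ∀ (G : Graph n) {u v} → Adj G u v → Adj G v u
  Adj-sym G {u} {v} p = trans (adj-sym G v u) p

  Adj-≢ : ∀ (G : Graph n) {u v} → Adj G u v → u ≢ v
  Adj-≢ G {u} p refl with trans (sym p) (irrefl G u)
  ... | ()

  del-b2n : ∀ (G : Graph n) u v → Adj G u v → ∀ x y →
    b2n (adj G x y) ≡ b2n (adj (del u v G) x y) + (δ x u * δ y v + δ y u * δ x v)
  del-b2n G u v uv x y with x ≟ u | y ≟ v | x ≟ v | y ≟ u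
  ... | yes refl | yes refl | yes refl | _ = ⊥-elim (Adj-≢ G uv refl)
  ... | yes refl | yes refl | no _ | yes refl = ⊥-elim (Adj-≢ G uv refl)
  ... | yes refl | yes refl | no _ | no _ rewrite uv = refl
  ... | yes refl | no _ | yes refl | _ = ⊥-elim (Adj-≢ G uv refl)
  ... | yes refl | no _ | no _ | yes refl = b2n-∧true (adj G x y)
  ... | yes refl | no _ | no _ | no _ = b2n-∧true (adj G x y)
  ... | no _ | yes refl | yes refl | yes refl = ⊥-elim (Adj-≢ G uv refl)
  ... | no _ | yes refl | yes refl | no _ = b2n-∧true (adj G x y)
  ... | no _ | yes refl | no _ | yes refl = ⊥-elim (Adj-≢ G uv refl)
  ... | no _ | yes refl | no _ | no _ = b2n-∧true (adj G x y)
  ... | no _ | no _ | yes refl | yes refl rewrite Adj-sym G uv = refl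
  ... | no _ | no _ | yes refl | no _ = b2n-∧true (adj G x y)
  ... | no _ | no _ | no _ | yes refl = b2n-∧true (adj G x y)
  ... | no _ | no _ | no _ | no _ = b2n-∧true (adj G x y)

  del-swap : ∀ (G : Graph n) u v x y → adj (del u v G) x y ≡ adj (del v u G) x y
  del-swap G u v x y = cong (λ z → adj G x y ∧ not z) (∨-comm (⌊ x ≟ u ⌋ ∧ ⌊ y ≟ v ⌋) _)

  del-Adj : ∀ (G : Graph n) {u v x y} → Adj (del u v G) x y → Adj G x y
  del-Adj G {u} {v} {x} {y} p with adj G x y
  ... | true = refl

  del-gone : ∀ (G : Graph n) u v → adj (del u v G) u v ≡ false
  del-gone G u v with u ≟ u | v ≟ v
  ... | yes _ | yes _ = Bool.∧-zeroʳ (adj G u v)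
  ... | no p | _ = ⊥-elim (p refl)
  ... | yes _ | no p = ⊥-elim (p refl)

  del-goneʳ : ∀ (G : Graph n) u v → adj (del u v G) v u ≡ false
  del-goneʳ G u v = trans (del-swap G u v v u) (del-gone G v u)

  -- One end of `x y` outside the pair already shows that the two edges differ.
  data Miss (x y : V) : V × V → Set where
    missˡ : ∀ {u v} → x ≢ u → x ≢ v → Miss x y (u , v)
    missʳ : ∀ {u v} → y ≢ u → y ≢ v → Miss x y (u , v)

  del-keep : ∀ (G : Graph n) {u v x y} → Adj G x y → Miss x y (u , v) → Adj (del u v G) x y
  del-keep G {u} {v} {x} {y} p m = trans (cong₂ (λ a b → a ∧ not b) p (h m)) refl
    where
    h : Miss x y (u , v) → hit u v x y ≡ false
    h (missˡ a b) with x ≟ u | x ≟ v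
    ... | yes e | _ = ⊥-elim (a e)
    ... | no _ | yes e = ⊥-elim (b e)
    ... | no _ | no _ = refl
    h (missʳ a b) with y ≟ u | y ≟ v | x ≟ u | x ≟ v
    ... | yes e | _ | _ | _ = ⊥-elim (a e)
    ... | no _ | yes e | _ | _ = ⊥-elim (b e)
    ... | no _ | no _ | yes _ | yes _ = refl
    ... | no _ | no _ | yes _ | no _ = refl
    ... | no _ | no _ | no _ | yes _ = refl
    ... | no _ | no _ | no _ | no _ = refl

  del-degree : ∀ (G : Graph n) {u v} → Adj G u v → ∀ x → degree G x ≡ degree (del u v G) x + (δ x u + δ x v)
  del-degree G {u} {v} uv x = trans (degree-ΣF G x) (trans (ΣF-cong (del-b2n G u v uv x))
    (trans (ΣF-+ (λ y → b2n (adj (del u v G) x y)) _) (cong₂ _+_ (sym (degree-ΣF (del u v G) x))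
      (trans (ΣF-+ (λ y → δ x u * δ y v) (λ y → δ y u * δ x v)) (cong₂ _+_
        (trans (ΣF-* (δ x u) (λ y → δ y v)) (trans (cong (δ x u *_) (ΣF-δ v)) (*-identityʳ (δ x u))))
        (trans (ΣF-cong (λ y → *-comm (δ y u) (δ x v))) (trans (ΣF-* (δ x v) (λ y → δ y u)) (trans (cong (δ x v *_) (ΣF-δ u)) (*-identityʳ (δ x v))))))))))

  -- Twice the number of edges.
  size : Graph n → ℕ
  size G = ΣF (degree G)

  del-size : ∀ (G : Graph n) {u v} → Adj G u v → size (del u v G) < size G
  del-size G {u} {v} uv = subst (size (del u v G) <_) (sym (trans (ΣF-cong (del-degree G uv)) (trans (ΣF-+ (degree (del u v G)) _)
      (cong (size (del u v G) +_) (trans (ΣF-+ (λ x → δ x u) _) (cong₂ _+_ (ΣF-δ u) (ΣF-δ v)))))))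
    (m<m+n _ (s≤s z≤n))

  St : Graph n → (V → ℕ) → Set
  St G f = Dcp (adj G) f × ΣF f ≤ n

  -- Every occurrence of `v` on a path has two sides, and each side is either an edge of the path or
  -- a path end. Summed over all paths, degree plus ends is even at every vertex.
  ec-row : ∀ (v x : V) l → ΣF (λ u → ec v u (x ∷ l)) + en v (x , l) ≡ cnt v (x ∷ l) + cnt v (x ∷ l)
  ec-row v x [] = trans (cong (_+ (δ v x + δ v x)) (ΣF-0 {n})) (lem (δ v x))
    where lem : ∀ a → a + a ≡ a + 0 + (a + 0)
          lem = solve-∀
  ec-row v x (y ∷ l) = trans (cong (_+ en v (x , y ∷ l)) (trans (ΣF-+ (λ u → pc v u x y) (λ u → ec v u (y ∷ l))) (cong (_+ ΣF (λ u → ec v u (y ∷ l))) pcs)))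
      (trans (lem (δ v x) (δ v y) _ (δ v (lastv y l))) (trans (cong (_+ (δ v x + δ v x)) (ec-row v y l)) (lem2 (cnt v (y ∷ l)) (δ v x))))
    where
    pcs : ΣF (λ u → pc v u x y) ≡ δ v x + δ v y
    pcs = trans (ΣF-+ (λ u → δ v x * δ u y) (λ u → δ v y * δ u x)) (cong₂ _+_
      (trans (ΣF-* (δ v x) (λ u → δ u y)) (trans (cong (δ v x *_) (ΣF-δ y)) (*-identityʳ (δ v x))))
      (trans (ΣF-* (δ v y) (λ u → δ u x)) (trans (cong (δ v y *_) (ΣF-δ x)) (*-identityʳ (δ v y)))))
    lem : ∀ a b s e → a + b + s + (a + e) ≡ s + (b + e) + (a + a)
    lem = solve-∀
    lem2 : ∀ c a → c + c + (a + a) ≡ a + c + (a + c)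
    lem2 = solve-∀

  parity : ∀ (G : Graph n) {f} → Dcp (adj G) f → ∀ v → pb (f v) ≡ ev G v
  parity G {f} (dcp ps us ed en′) v = sym (pb-+ (degree G v) (f v) (trans (cong pb tot) (pb-double C)))
    where
    C = sumBy (λ p → cnt v (ver p)) ps
    tot : degree G v + f v ≡ C + C
    tot = trans (cong₂ _+_ (trans (degree-ΣF G v) (trans (ΣF-cong (λ u → sym (ed v u))) (ΣF-sumBy (λ u p → ec v u (ver p)) ps))) (sym (en′ v)))
      (trans (sym (sumBy-+ (λ p → ΣF (λ u → ec v u (ver p))) (en v) ps))
        (trans (sumBy-cong (λ { (x , l) → ec-row v x l }) ps) (sumBy-+ (λ p → cnt v (ver p)) (λ p → cnt v (ver p)) ps)))

  odd-pos : ∀ (G : Graph n) {f} → St G f → ∀ {v} → ev G v ≡ false → 1 ≤ f v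
  odd-pos G (D , _) {v} e = pb-odd-pos (trans (parity G D v) e)

  Σ-shift : ∀ {f f′ : V → ℕ} a b → (∀ v → f′ v + δ v b ≡ f v + δ v a) → ΣF f′ ≡ ΣF f
  Σ-shift {f} {f′} a b e = +-cancelʳ-≡ 1 _ _ (trans (cong (ΣF f′ +_) (sym (ΣF-δ b))) (trans (sym (ΣF-+ f′ _))
    (trans (ΣF-cong e) (trans (ΣF-+ f _) (cong (ΣF f +_) (ΣF-δ a))))))

  opaque
    pullDˡ : ∀ (G : Graph n) {a b f} Z → Adj G a b → Dcp (adj (del a b G)) f →
      (∀ v → Adj (del a b G) a v → 1 ≤ f v ⊎ v ∈ Z) → length Z < f b →
      ∃[ f′ ] Dcp (adj G) f′ × (∀ v → f′ v + δ v b ≡ f v + δ v a)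
    pullDˡ G {a} {b} Z ab D cov lt = pullD a b Z (Adj-≢ G ab) D (del-gone G a b) (λ v _ p → cov v p) lt (del-b2n G a b ab)

  opaque
    pullˡ : ∀ (G : Graph n) {a b f} Z → Adj G a b → St (del a b G) f →
      (∀ v → Adj (del a b G) a v → 1 ≤ f v ⊎ v ∈ Z) → length Z < f b →
      ∃[ f′ ] St G f′ × (∀ v → f′ v + δ v b ≡ f v + δ v a)
    pullˡ G {a} {b} Z ab (D , s) cov lt with pullDˡ G Z ab D cov lt
    ... | f′ , D′ , e = f′ , (D′ , subst (_≤ n) (sym (Σ-shift a b e)) s) , e

  opaque
    pullʳ : ∀ (G : Graph n) {a b f} Z → Adj G a b → St (del b a G) f →
      (∀ v → Adj (del b a G) a v → 1 ≤ f v ⊎ v ∈ Z) → length Z < f b →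
      ∃[ f′ ] St G f′ × (∀ v → f′ v + δ v b ≡ f v + δ v a)
    pullʳ G {a} {b} Z ab (D , s) cov lt = pullˡ G Z ab (Dcp-adj (del-swap G b a) D , s)
      (λ v p → cov v (trans (del-swap G b a a v) p)) lt

  ev-del-≢ : ∀ (G : Graph n) {u v x} → Adj G u v → x ≢ u → x ≢ v → ev (del u v G) x ≡ ev G x
  ev-del-≢ G {u} {v} {x} uv p q = sym (cong pb (trans (del-degree G uv x) (trans (cong₂ (λ a b → degree (del u v G) x + (a + b)) (δ-≢ p) (δ-≢ q)) (+-identityʳ _))))

  ev-delˡ : ∀ (G : Graph n) {u v} → Adj G u v → ev (del u v G) u ≡ not (ev G u)
  ev-delˡ G {u} {v} uv = sym (trans (cong (not ∘ pb) (trans (del-degree G uv u)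
    (trans (cong₂ (λ a b → degree (del u v G) u + (a + b)) (δ-refl u) (δ-≢ (Adj-≢ G uv))) (+-comm _ 1)))) (not-involutive _))

  ev-delʳ : ∀ (G : Graph n) {u v} → Adj G u v → ev (del u v G) v ≡ not (ev G v)
  ev-delʳ G {u} {v} uv = sym (trans (cong (not ∘ pb) (trans (del-degree G uv v)
    (trans (cong₂ (λ a b → degree (del u v G) v + (a + b)) (δ-≢ (λ e → Adj-≢ G uv (sym e))) (δ-refl v)) (+-comm _ 1)))) (not-involutive _))

  adj? : ∀ (G : Graph n) u v → Dec (Adj G u v)
  adj? G u v = adj G u v Bool.≟ true

  -- Lovász' theorem with prescribed path ends

  addTrivial : ∀ {A : V → V → Bool} {f} (x : V) → Dcp A f → Dcp A (λ v → f v + (δ v x + δ v x))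
  addTrivial x (dcp ps us ed en′) = dcp ((x , []) ∷ ps) (([] ∷ []) ∷ us) ed
    (λ v → trans (cong (δ v x + δ v x +_) (en′ v)) (+-comm (δ v x + δ v x) _))

  Dcp-f : ∀ {A : V → V → Bool} {f g} → (∀ v → f v ≡ g v) → Dcp A f → Dcp A g
  Dcp-f e (dcp ps us ed en′) = dcp ps us ed (λ v → trans (en′ v) (e v))

  -- One-vertex paths absorb the prescribed ends in pairs.
  edgeless : ∀ k (G : Graph n) f → ΣF f ≤ k → (∀ u v → ¬ Adj G u v) → (∀ v → pb (f v) ≡ true) → Dcp (adj G) f
  edgeless k G f s no-e p with any? (λ v → 1 ≤? f v)
  ... | no none = dcp [] [] (λ u v → sym (b2n-≢ (no-e u v))) (λ v → sym (n≤0⇒n≡0 (≤-pred (≰⇒> (λ q → none (v , q))))))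
  edgeless zero G f s no-e p | yes (v , q) = ⊥-elim (pos≢0 q (n≤0⇒n≡0 (≤-trans (ΣF-∈ f v) s)))
  edgeless (suc k) G f s no-e p | yes (x , q) = Dcp-f back (addTrivial x (edgeless k G f′ s′ no-e p′))
    where
    f′ : V → ℕ
    f′ v = f v ∸ (δ v x + δ v x)
    two≤ : 2 ≤ f x
    two≤ = big q (p x)
      where
      big : ∀ {j} → 1 ≤ j → pb j ≡ true → 2 ≤ j
      big {suc (suc j)} _ _ = s≤s (s≤s z≤n)
    le : ∀ v → δ v x + δ v x ≤ f v
    le v with v ≟ x
    ... | yes refl = two≤
    ... | no _ = z≤n
    back : ∀ v → f′ v + (δ v x + δ v x) ≡ f v
    back v = m∸n+n≡m (le v)
    s′ : ΣF f′ ≤ k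
    s′ = ≤-pred (≤-trans (m<m+n _ (s≤s z≤n)) (subst (_≤ suc k) (trans (ΣF-cong (λ v → sym (back v)))
          (trans (ΣF-+ f′ _) (cong (ΣF f′ +_) (trans (ΣF-+ (λ v → δ v x) _) (cong₂ _+_ (ΣF-δ x) (ΣF-δ x)))))) s))
    p′ : ∀ v → pb (f′ v) ≡ true
    p′ v = trans (pb-+ (f′ v) (f v) (trans (cong pb eq) (pb-double (f′ v + δ v x)))) (p v)
      where
      eq : f′ v + f v ≡ (f′ v + δ v x) + (f′ v + δ v x)
      eq = trans (cong (f′ v +_) (sym (back v))) (lem (f′ v) (δ v x))
        where lem : ∀ a b → a + (a + (b + b)) ≡ a + b + (a + b)
              lem = solve-∀

  -- Undoes in advance the effect of restoring `a b` at `a`: to have an end at `a` afterwards, the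
  -- smaller graph must have it at `b`. The truncated subtraction is exact because `f a` is
  -- positive.
  module Shift (f : V → ℕ) {a b : V} (a≢b : a ≢ b) (fa : 1 ≤ f a) where

    f′ : V → ℕ
    f′ v = f v + δ v b ∸ δ v a

    at-a : suc (f′ a) ≡ f a
    at-a = trans (cong₂ (λ x y → suc (f a + x ∸ y)) (δ-≢ a≢b) (δ-refl a))
             (trans (cong (λ x → suc (x ∸ 1)) (+-identityʳ (f a))) (m+[n∸m]≡n fa))

    at-b : f′ b ≡ suc (f b)
    at-b = trans (cong₂ (λ x y → f b + x ∸ y) (δ-refl b) (δ-≢ (λ e → a≢b (sym e)))) (+-comm _ 1)

    elsewhere : ∀ {v} → v ≢ a → v ≢ b → f′ v ≡ f v
    elsewhere {v} p q = trans (cong₂ (λ x y → f v + x ∸ y) (δ-≢ q) (δ-≢ p)) (+-identityʳ _)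

    balance : ∀ v → f′ v + δ v a ≡ f v + δ v b
    balance v = m∸n+n≡m (le (v ≟ a))
      where
      le : Dec (v ≡ a) → δ v a ≤ f v + δ v b
      le (yes refl) = subst (_≤ f v + δ v b) (sym (δ-refl v)) (≤-trans fa (m≤m+n _ _))
      le (no p) = subst (_≤ f v + δ v b) (sym (δ-≢ p)) z≤n

  ev-isolated : ∀ (G : Graph n) {v} → (∀ u → ¬ Adj G v u) → ev G v ≡ true
  ev-isolated G {v} p = cong pb (trans (degree-ΣF G v) (trans (ΣF-cong (λ u → b2n-≢ (p u))) (ΣF-0 {n})))

  Zero : Graph n → (V → ℕ) → V → Set
  Zero G f y = (∃[ w ] Adj G y w) × f y ≡ 0

  -- Lovász' theorem in the form: any f of the right parity with at most one non-isolated
  -- zero counts the ends of a decomposition.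
  lovasz : ∀ k (G : Graph n) f → size G ≤ k → (∀ v → pb (f v) ≡ ev G v) →
    (∀ {y z} → Zero G f y → Zero G f z → y ≡ z) → Dcp (adj G) f

  -- Here `b` is the only vertex that may be a zero. Without `a b`, and with one end shifted from
  -- `a` to `b`, the only possible zero is `a`. All neighbours of `a` are then ends, so the edge can
  -- be restored at `a` without dead ends.
  lovasz-edge : ∀ k (G : Graph n) f → size G ≤ k → (∀ v → pb (f v) ≡ ev G v) → ∀ {b a} → Adj G b a →
    (∀ {y w} → Adj G y w → y ≢ b → 1 ≤ f y) → Dcp (adj G) f
  lovasz-edge zero G f s par ba pos = ⊥-elim (pos≢0 (≤-trans (s≤s z≤n) (del-size G ba)) (n≤0⇒n≡0 s))
  lovasz-edge (suc k) G f s par {b} {a} ba pos = finish (pullDˡ G [] ab (lovasz k H f′ (≤-pred (≤-trans (del-size G ab) s)) par′ uz′) cov one≤)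
    where
    ab : Adj G a b
    ab = Adj-sym G ba
    open Shift f (Adj-≢ G ab) (pos ab (Adj-≢ G ab))
    H = del a b G
    par′ : ∀ v → pb (f′ v) ≡ ev H v
    par′ v = h (v ≟ a) (v ≟ b)
      where
      h : Dec (v ≡ a) → Dec (v ≡ b) → pb (f′ v) ≡ ev H v
      h (yes refl) _ = trans (sym (not-involutive _)) (trans (cong not (trans (cong pb at-a) (par a))) (sym (ev-delˡ G ab)))
      h (no _) (yes refl) = trans (cong pb at-b) (trans (cong not (par b)) (sym (ev-delʳ G ab)))
      h (no v≢a) (no v≢b) = trans (cong pb (elsewhere v≢a v≢b)) (trans (par v) (sym (ev-del-≢ G ab v≢a v≢b)))
    uz1 : ∀ {y} → Zero H f′ y → y ≡ a
    uz1 {y} ((w , yw) , y0) = h (y ≟ a) (y ≟ b)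
      where
      h : Dec (y ≡ a) → Dec (y ≡ b) → y ≡ a
      h (yes e) _ = e
      h (no _) (yes refl) = ⊥-elim (pos≢0 (subst (1 ≤_) (sym at-b) (s≤s z≤n)) y0)
      h (no y≢a) (no y≢b) = ⊥-elim (pos≢0 (subst (1 ≤_) (sym (elsewhere y≢a y≢b)) (pos (del-Adj G yw) y≢b)) y0)
    uz′ : ∀ {y z} → Zero H f′ y → Zero H f′ z → y ≡ z
    uz′ p q = trans (uz1 p) (sym (uz1 q))
    one≤ : 1 ≤ f′ b
    one≤ = subst (1 ≤_) (sym at-b) (s≤s z≤n)
    cov : ∀ v → Adj H a v → 1 ≤ f′ v ⊎ v ∈ []
    cov v av = inj₁ (h (v ≟ b))
      where
      h : Dec (v ≡ b) → 1 ≤ f′ v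
      h (yes refl) = one≤
      h (no v≢b) = subst (1 ≤_) (sym (elsewhere (λ e → Adj-≢ H av (sym e)) v≢b)) (pos (Adj-sym G (del-Adj G av)) v≢b)
    finish : ∃[ f″ ] Dcp (adj G) f″ × (∀ v → f″ v + δ v b ≡ f′ v + δ v a) → Dcp (adj G) f
    finish (f″ , D , fe) = Dcp-f (λ v → +-cancelʳ-≡ (δ v b) _ _ (trans (fe v) (balance v))) D

  lovasz k G f s par uz = h (any? (λ b → any? (adj? G b) ×-dec (f b ℕₚ.≟ 0))) (any? (λ b → any? (adj? G b)))
    where
    h : Dec (∃ (Zero G f)) → Dec (∃[ b ] ∃[ a ] Adj G b a) → Dcp (adj G) f
    h (yes (b , (a , ba) , b0)) _ = lovasz-edge k G f s par ba (λ {y} {w} yw y≢b → n≢0⇒n>0 (λ y0 → y≢b (uz ((w , yw) , y0) ((a , ba) , b0))))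
    h (no nz) (yes (b , a , ba)) = lovasz-edge k G f s par ba (λ {y} {w} yw _ → n≢0⇒n>0 (λ y0 → nz (y , (w , yw) , y0)))
    h (no nz) (no none) = edgeless (ΣF f) G f ≤-refl (λ u v e → none (u , v , e))
      (λ v → trans (par v) (ev-isolated G (λ u e → none (v , u , e))))

  -- From multiplicities to a `PathDecomposition`

  pc-pos : ∀ {u v x y : V} → 1 ≤ pc u v x y → (u ≡ x × v ≡ y) ⊎ (u ≡ y × v ≡ x)
  pc-pos {u} {v} {x} {y} p with u ≟ x | v ≟ y | u ≟ y | v ≟ x
  ... | yes a | yes b | _ | _ = inj₁ (a , b)
  ... | yes _ | no _ | yes a | yes b = inj₂ (a , b)
  ... | no _ | yes _ | yes a | yes b = inj₂ (a , b)
  ... | no _ | no _ | yes a | yes b = inj₂ (a , b)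

  pc-self : ∀ (u v : V) → 1 ≤ pc u v u v
  pc-self u v = subst (λ z → 1 ≤ z + δ u v * δ v u) (sym (cong₂ _*_ (δ-refl u) (δ-refl v))) (s≤s z≤n)

  edge-ec : ∀ {u v : V} {xs} → EdgeOf u v xs → 1 ≤ ec u v xs
  edge-ec {u} {v} fwd = ≤-trans (pc-self u v) (m≤m+n _ _)
  edge-ec {u} {v} bwd = ≤-trans (subst (1 ≤_) (pc-sym u v u v) (pc-self u v)) (m≤m+n _ _)
  edge-ec {u} {v} (there {x = z} {xs = x ∷ y ∷ xs} e) = ≤-trans (edge-ec e) (m≤n+m _ (pc u v z x))
  edge-ec (there {xs = x ∷ []} (there ()))

  ec-edge : ∀ {u v : V} x xs → 1 ≤ ec u v (x ∷ xs) → EdgeOf u v (x ∷ xs)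
  ec-edge {u} {v} x (y ∷ xs) p = h (1 ≤? pc u v x y)
    where
    h : Dec (1 ≤ pc u v x y) → EdgeOf u v (x ∷ y ∷ xs)
    h (no q) = there (ec-edge y xs (subst (λ z → 1 ≤ z + ec u v (y ∷ xs)) (n≤0⇒n≡0 (≤-pred (≰⇒> q))) p))
    h (yes q) with pc-pos {u} {v} {x} {y} q
    ... | inj₁ (refl , refl) = fwd
    ... | inj₂ (refl , refl) = bwd

  ec-edge′ : ∀ {u v : V} xs → 1 ≤ ec u v xs → EdgeOf u v xs
  ec-edge′ (x ∷ xs) = ec-edge x xs

  ec-linked : ∀ (G : Graph n) xs → (∀ u v → 1 ≤ ec u v xs → Adj G u v) → Linked (Adj G) xs
  ec-linked G [] h = []
  ec-linked G (x ∷ []) h = [-]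
  ec-linked G (x ∷ y ∷ xs) h = h x y (≤-trans (pc-self x y) (m≤m+n _ _)) ∷ ec-linked G (y ∷ xs) (λ u v p → h u v (≤-trans p (m≤n+m _ _)))

  -- One-vertex paths carry no edge and are dropped, hence the inequality between the lengths.
  toPaths : ∀ (G : Graph n) ps → All (λ p → Unique (ver p)) ps →
    (∀ u v → 1 ≤ sumBy (λ p → ec u v (ver p)) ps → Adj G u v) →
    ∃[ Ps ] (∀ u v → sumBy (λ (P : Path G) → ec u v (pverts P)) Ps ≡ sumBy (λ p → ec u v (ver p)) ps) × length Ps ≤ length ps
  toPaths G [] [] h = [] , (λ u v → refl) , z≤n
  toPaths G ((x , []) ∷ ps) (_ ∷ us) h with toPaths G ps us h
  ... | Ps , e , l = Ps , e , ≤-trans l (n≤1+n _)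
  toPaths G ((x , y ∷ l) ∷ ps) (u ∷ us) h with toPaths G ps us (λ u v p → h u v (≤-trans p (m≤n+m _ _)))
  ... | Ps , e , le = record { verts = x ∷ y ∷ l ; nontriv = s≤s (s≤s z≤n) ; distinct = u
                             ; walk = ec-linked G (x ∷ y ∷ l) (λ u v p → h u v (≤-trans p (m≤m+n _ _))) } ∷ Ps
                    , (λ u v → cong (ec u v (x ∷ y ∷ l) +_) (e u v)) , s≤s le

  two-ends : ∀ {A : V → V → Bool} {f} (D : Dcp A f) → ΣF f ≡ length (Dcp.ps D) * 2
  two-ends (dcp ps us ed en′) = trans (ΣF-cong (λ v → sym (en′ v))) (trans (ΣF-sumBy en ps) (h ps))
    where
    h : ∀ qs → sumBy (λ p → ΣF (λ v → en v p)) qs ≡ length qs * 2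
    h [] = refl
    h ((x , l) ∷ qs) = cong₂ _+_ (trans (ΣF-+ (λ v → δ v x) (λ v → δ v (lastv x l))) (cong₂ _+_ (ΣF-δ x) (ΣF-δ (lastv x l)))) (h qs)

  St-Pn : ∀ (G : Graph n) {f} → St G f → PnAtMost G (n / 2)
  St-Pn G {f} (D@(dcp ps us ed en′) , s) with toPaths G ps us (λ u v p → b2n-pos (subst (1 ≤_) (ed u v) p))
  ... | Ps , e , l = record
    { paths    = Ps
    ; covers   = λ u v uv → let (i , p) = sumBy-lookup (λ P → ec u v (pverts P)) Ps (subst (1 ≤_) (sym (trans (e u v) (trans (ed u v) (cong b2n uv)))) (s≤s z≤n))
                            in i , ec-edge′ _ p
    ; disjoint = λ u v i j p q → sumBy-one (λ P → ec u v (pverts P)) Ps (subst (_≤ 1) (sym (trans (e u v) (ed u v))) (b2n≤1 _)) i j (edge-ec p) (edge-ec q)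
    } , ≤-trans l (subst (_≤ n / 2) (m*n/n≡m (length ps) 2) (/-monoˡ-≤ 2 (subst (_≤ n) (two-ends D) s)))

  -- Deleting and restoring sets of edges

  elist : Graph n → V → List V
  elist G v = elems (λ u → adj G v u ∧ ev G u)

  elist-length : ∀ (G : Graph n) v → length (elist G v) ≡ evenNeighbours G v
  elist-length G v = trans (elems-length (λ u → adj G v u ∧ ev G u)) (cnt-cong (λ u → cong (adj G v u ∧_) (sym (isEvenB-pb (degree G u)))))
    where
    cnt-cong : ∀ {m} {p q : Fin m → Bool} → (∀ u → p u ≡ q u) → count p ≡ count q
    cnt-cong {p = p} {q} e = trans (count-ΣF p) (trans (ΣF-cong (λ u → cong b2n (e u))) (sym (count-ΣF q)))

  ∈-elist : ∀ (G : Graph n) {v u} → Adj G v u → ev G u ≡ true → u ∈ elist G v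
  ∈-elist G {v} {u} a e = ∈-elems (λ u → adj G v u ∧ ev G u) (cong₂ _∧_ a e)

  elist-∈ : ∀ (G : Graph n) {v u} → u ∈ elist G v → Adj G v u × ev G u ≡ true
  elist-∈ G {v} {u} i = both (elems-∈ (λ u → adj G v u ∧ ev G u) i)
    where
    both : ∀ {a b} → a ∧ b ≡ true → a ≡ true × b ≡ true
    both {true} {true} _ = refl , refl

  elist-unique : ∀ (G : Graph n) v → Unique (elist G v)
  elist-unique G v = elems-unique (λ u → adj G v u ∧ ev G u)

  infixl 6 _∖_

  _∖_ : Graph n → List (V × V) → Graph n
  G ∖ []            = G
  G ∖ ((u , v) ∷ L) = del u v (G ∖ L)

  -- Each pair is still an edge after the deletions listed behind it, so no edge occurs twice. The
  -- head of the list is deleted last and can be restored first.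
  Valid : Graph n → List (V × V) → Set
  Valid G []            = ⊤
  Valid G ((u , v) ∷ L) = Adj (G ∖ L) u v × Valid G L

  ends : List (V × V) → List V
  ends []            = []
  ends ((u , v) ∷ L) = u ∷ v ∷ ends L

  ∖-degree : ∀ (G : Graph n) L → Valid G L → ∀ x → degree G x ≡ degree (G ∖ L) x + cnt x (ends L)
  ∖-degree G [] _ x = sym (+-identityʳ _)
  ∖-degree G ((u , v) ∷ L) (a , va) x = trans (∖-degree G L va x) (trans (cong (_+ cnt x (ends L)) (del-degree (G ∖ L) a x))
    (lem (degree (del u v (G ∖ L)) x) (δ x u) (δ x v) _))
    where lem : ∀ a b c d → a + (b + c) + d ≡ a + (b + (c + d))
          lem = solve-∀

  ev-same : ∀ (G : Graph n) L → Valid G L → ∀ {x} → pb (cnt x (ends L)) ≡ true → ev (G ∖ L) x ≡ ev G x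
  ev-same G L va {x} e = sym (trans (cong pb (∖-degree G L va x)) (pb-+true (degree (G ∖ L) x) _ e))

  ev-flip : ∀ (G : Graph n) L → Valid G L → ∀ {x} → pb (cnt x (ends L)) ≡ false → ev (G ∖ L) x ≡ not (ev G x)
  ev-flip G L va {x} e = trans (sym (not-involutive _)) (cong not (sym (trans (cong pb (∖-degree G L va x)) (pb-+false (degree (G ∖ L) x) _ e))))

  ev-∉ : ∀ (G : Graph n) L → Valid G L → ∀ {x} → x ∉ ends L → ev (G ∖ L) x ≡ ev G x
  ev-∉ G L va p = ev-same G L va (cong pb (cnt-∉ (ends L) p))

  ∖-Adj : ∀ (G : Graph n) L {x y} → Adj (G ∖ L) x y → Adj G x y
  ∖-Adj G [] p = p
  ∖-Adj G (_ ∷ L) p = ∖-Adj G L (del-Adj (G ∖ L) p)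

  ∖-keep : ∀ (G : Graph n) L {x y} → Adj G x y → All (Miss x y) L → Adj (G ∖ L) x y
  ∖-keep G [] p [] = p
  ∖-keep G (_ ∷ L) p (m ∷ ms) = del-keep (G ∖ L) (∖-keep G L p ms) m

  ∖-gone : ∀ (G : Graph n) L {u v} → (u , v) ∈ L → ¬ Adj (G ∖ L) u v
  ∖-gone G ((u , v) ∷ L) (here refl) p = t≢f p (del-gone (G ∖ L) u v)
  ∖-gone G (_ ∷ L) (there i) p = ∖-gone G L i (del-Adj (G ∖ L) p)

  miss-ends : ∀ {x y} L → x ∉ ends L → All (Miss x y) L
  miss-ends [] p = []
  miss-ends ((u , v) ∷ L) p = missˡ (λ { refl → p (here refl) }) (λ { refl → p (there (here refl)) }) ∷ miss-ends L (λ q → p (there (there q)))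

  ∖-size≤ : ∀ (G : Graph n) L → Valid G L → size (G ∖ L) ≤ size G
  ∖-size≤ G [] _ = ≤-refl
  ∖-size≤ G ((u , v) ∷ L) (a , va) = ≤-trans (<⇒≤ (del-size (G ∖ L) a)) (∖-size≤ G L va)

  ∖-++ : ∀ (G : Graph n) L M → G ∖ (L ++ M) ≡ (G ∖ M) ∖ L
  ∖-++ G [] M = refl
  ∖-++ G ((u , v) ∷ L) M = cong (del u v) (∖-++ G L M)

  -- Graphs without SET components and admissible deletions

  Tri : Graph n → V → V → V → Set
  Tri G a b c = (ev G a ≡ true × ev G b ≡ true × ev G c ≡ true) × (Adj G a b × Adj G b c × Adj G a c)

  NotTwo : Graph n → V → V → V → V → Set
  NotTwo G v a b c = ¬ (Adj G v a × Adj G v b) × ¬ (Adj G v b × Adj G v c) × ¬ (Adj G v a × Adj G v c)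

  -- How `v` can violate the SET conditions for the triangle `a b c`: as a further even vertex, or
  -- as a vertex with at most one neighbour in the triangle.
  Off : Graph n → V → V → V → V → Set
  Off G v a b c = (v ≢ a × v ≢ b × v ≢ c) × (ev G v ≡ true ⊎ NotTwo G v a b c)

  -- No component is a SET graph: every triangle of the E-subgraph reaches a witness against it.
  NoSET : Graph n → Set
  NoSET G = ∀ a b c → Tri G a b c → ∃[ v ] Reach G a v × Off G v a b c

  Deg≤ : ℕ → Graph n → Set
  Deg≤ k G = ∀ v → ev G v ≡ true → length (elist G v) ≤ k

  Goal : Graph n → Set
  Goal G = ∃[ f ] St G f

  IH : ℕ → Set
  IH k = ∀ (H : Graph n) → size H < k → Deg≤ 3 H → NoSET H → Goal H

  -- If the walk from a triangle to its old witness is cut by the deletion, the triangle still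
  -- reaches an end of a deleted edge. `Safe` makes this end a new witness.
  Safe : Graph n → List (V × V) → Set
  Safe G L = ∀ e → e ∈ ends L → ∀ a b c → Tri (G ∖ L) a b c → Off (G ∖ L) e a b c

  -- Vertices that turn even stay isolated in the E-subgraph. So the deletion creates no edge of the
  -- E-subgraph, which therefore inherits its degree bound and has no new triangles.
  NewIsolated : Graph n → List (V × V) → Set
  NewIsolated G L = ∀ v → ev G v ≡ false → ev (G ∖ L) v ≡ true → ∀ w → Adj (G ∖ L) v w → ev (G ∖ L) w ≡ false

  reach-∖ : ∀ (G : Graph n) L {u v} → Reach G u v → Reach (G ∖ L) u v ⊎ ∃[ e ] e ∈ ends L × Reach (G ∖ L) u e
  reach-∖ G L {u} here = inj₁ here
  reach-∖ G L {u} (step a r) with memb? _≟_ u (ends L)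
  ... | yes i = inj₂ (u , i , here)
  ... | no i with reach-∖ G L r
  ...   | inj₁ r′ = inj₁ (step (∖-keep G L a (miss-ends L i)) r′)
  ...   | inj₂ (e , j , r′) = inj₂ (e , j , step (∖-keep G L a (miss-ends L i)) r′)

  old-even : ∀ (G : Graph n) L → NewIsolated G L → ∀ {v w} → ev (G ∖ L) v ≡ true → Adj (G ∖ L) v w → ev (G ∖ L) w ≡ true → ev G v ≡ true
  old-even G L iso {v} {w} e a e′ with ev G v in eq
  ... | true = refl
  ... | false = ⊥-elim (t≢f e′ (iso v eq e w a))

  old-tri : ∀ (G : Graph n) L → NewIsolated G L → ∀ {a b c} → Tri (G ∖ L) a b c → Tri G a b c
  old-tri G L iso ((ea , eb , ec′) , (ab , bc , ac)) =
    (old-even G L iso ea ab eb , old-even G L iso eb bc ec′ , old-even G L iso ec′ (Adj-sym (G ∖ L) ac) ea) ,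
    (∖-Adj G L ab , ∖-Adj G L bc , ∖-Adj G L ac)

  reduce : ∀ (G : Graph n) e L → Valid G (e ∷ L) → Deg≤ 3 G → NoSET G → IH (size G) →
    NewIsolated G (e ∷ L) → Safe G (e ∷ L) → Goal (G ∖ (e ∷ L))
  reduce G e@(u , v) L′ va d3 ns ih iso safe = ih H (≤-trans (del-size (G ∖ L′) (proj₁ va)) (∖-size≤ G L′ (proj₂ va))) d3′ ns′
    where
    L = e ∷ L′
    H = G ∖ L
    d3′ : Deg≤ 3 H
    d3′ x ex with ev G x in eq
    ... | true = ≤-trans (⊆-length (elist-unique H x) sub) (d3 x eq)
      where
      sub : ∀ {w} → w ∈ elist H x → w ∈ elist G x
      sub i = let (a , ew) = elist-∈ H i in ∈-elist G (∖-Adj G L a) (old-even G L iso ew (Adj-sym H a) ex)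
    ... | false with elist H x in eq′
    ...   | [] = z≤n
    ...   | w ∷ ws = let (a , ew) = elist-∈ H {x} {w} (subst (w ∈_) (sym eq′) (here refl)) in ⊥-elim (t≢f ew (iso x eq ex w a))
    ns′ : NoSET H
    ns′ a b c t with ns a b c (old-tri G L iso t)
    ... | w , r , off with reach-∖ G L r
    ...   | inj₂ (x , i , r′) = x , r′ , safe x i a b c t
    ...   | inj₁ r′ with memb? _≟_ w (ends L)
    ...     | yes i = w , r′ , safe w i a b c t
    ...     | no i = w , r′ , proj₁ off , cl (proj₂ off)
      where
      cl : ev G w ≡ true ⊎ NotTwo G w a b c → ev H w ≡ true ⊎ NotTwo H w a b c
      cl (inj₁ x) = inj₁ (trans (ev-∉ G L va i) x)
      cl (inj₂ (p , q , r)) = inj₂ ((λ { (x , y) → p (∖-Adj G L x , ∖-Adj G L y) }) , (λ { (x , y) → q (∖-Adj G L x , ∖-Adj G L y) }) , (λ { (x , y) → r (∖-Adj G L x , ∖-Adj G L y) }))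

  Fine : Graph n → List (V × V) → V → Set
  Fine G L e = (ev G e ≡ true × ev (G ∖ L) e ≡ false) ⊎ (ev G e ≡ false × (∀ w → Adj (G ∖ L) e w → ev (G ∖ L) w ≡ false))

  Deg-mono : ∀ {G : Graph n} → Deg≤ 2 G → Deg≤ 3 G
  Deg-mono d v e = ≤-trans (d v e) (s≤s (s≤s z≤n))

  -- An end that turned odd cannot be adjacent to a triangle of `G ∖ L`, since its neighbour there
  -- would have had three even neighbours in `G`. An end without even neighbours is adjacent to no
  -- triangle either. Both are witnesses.
  reduce₂ : ∀ (G : Graph n) e L → Valid G (e ∷ L) → Deg≤ 2 G → NoSET G → IH (size G) →
    (∀ {x} → x ∈ ends (e ∷ L) → Fine G (e ∷ L) x) → Goal (G ∖ (e ∷ L))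
  reduce₂ G e L′ va d2 ns ih fine = reduce G e L′ va (Deg-mono {G} d2) ns ih iso safe
    where
    L = e ∷ L′
    H = G ∖ L
    iso : NewIsolated G L
    iso v o ev′ with memb? _≟_ v (ends L)
    ... | no i = ⊥-elim (t≢f (trans (sym (ev-∉ G L va i)) ev′) o)
    ... | yes i with fine i
    ...   | inj₁ (x , _) = ⊥-elim (t≢f x o)
    ...   | inj₂ (_ , y) = y
    safe : Safe G L
    safe x i a b c t@((ea , eb , ec′) , (ab , bc , ac)) with fine i
    ... | inj₂ (_ , y) = ((λ { refl → t≢f eb (y _ ab) }) , (λ { refl → t≢f ec′ (y _ bc) }) , (λ { refl → t≢f ea (y _ (Adj-sym H ac)) })) ,
          inj₂ ((λ { (p , _) → t≢f ea (y _ p) }) , (λ { (p , _) → t≢f eb (y _ p) }) , (λ { (p , _) → t≢f ea (y _ p) }))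
    ... | inj₁ (xe , xo) = (ne ea , ne eb , ne ec′) ,
          inj₂ ((λ { (p , _) → far t p }) , (λ { (p , _) → far ((eb , ea , ec′) , (Adj-sym H ab , ac , bc)) p }) , (λ { (p , _) → far t p }))
      where
      ne : ∀ {y} → ev H y ≡ true → x ≢ y
      ne p refl = t≢f p xo
      far : ∀ {p q r} → Tri H p q r → ¬ Adj H x p
      far {p} {q} {r} t@((_ , eq , er) , (pq , qr , pr)) xp = <-irrefl refl (≤-trans (⊆-length {xs = x ∷ q ∷ r ∷ []} {elist G p}
          ((ne eq ∷ ne er ∷ []) ∷ (Adj-≢ H qr ∷ []) ∷ [] ∷ [])
          (λ { (here refl) → ∈-elist G (Adj-sym G (∖-Adj G L xp)) xe ; (there (here refl)) → ∈-elist G (∖-Adj G L pq) (proj₁ (proj₂ (proj₁ old)))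
             ; (there (there (here refl))) → ∈-elist G (∖-Adj G L pr) (proj₂ (proj₂ (proj₁ old))) }))
          (d2 p (proj₁ (proj₁ old))))
        where
        old = old-tri G L iso t

  -- Deleting and restoring a star

  star : V → List V → List (V × V)
  star b = map (b ,_)

  eo : V → V → V × V → ℕ
  eo x y (u , v) = δ x u * δ y v + δ y u * δ x v

  ∖-b2n : ∀ (G : Graph n) L → Valid G L → ∀ x y → b2n (adj G x y) ≡ b2n (adj (G ∖ L) x y) + sumBy (eo x y) L
  ∖-b2n G [] _ x y = sym (+-identityʳ _)
  ∖-b2n G ((u , v) ∷ L) (a , va) x y = trans (∖-b2n G L va x y) (trans (cong (_+ sumBy (eo x y) L) (del-b2n (G ∖ L) u v a x y)) (+-assoc (b2n (adj (del u v (G ∖ L)) x y)) (eo x y (u , v)) (sumBy (eo x y) L)))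

  ∖-↭ : ∀ (G : Graph n) {L M} → Valid G L → Valid G M → L ↭ M → ∀ x y → adj (G ∖ L) x y ≡ adj (G ∖ M) x y
  ∖-↭ G {L} {M} vL vM π x y = b2n-inj (+-cancelʳ-≡ (sumBy (eo x y) L) _ _
    (trans (sym (∖-b2n G L vL x y)) (trans (∖-b2n G M vM x y) (cong (b2n (adj (G ∖ M) x y) +_) (sym (sumBy-↭ (eo x y) π))))))

  eo-star : ∀ x y b X → sumBy (eo x y) (star b X) ≡ δ x b * cnt y X + δ y b * cnt x X
  eo-star x y b [] = sym (cong₂ _+_ (*-zeroʳ (δ x b)) (*-zeroʳ (δ y b)))
  eo-star x y b (z ∷ X) = trans (cong (eo x y (b , z) +_) (eo-star x y b X)) (lem (δ x b) (δ y z) (δ y b) (δ x z) (cnt y X) (cnt x X))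
    where lem : ∀ a b c d e f → (a * b + c * d) + (a * e + c * f) ≡ a * (b + e) + c * (d + f)
          lem = solve-∀

  valid-star : ∀ (G : Graph n) b X → Unique X → (∀ {x} → x ∈ X → Adj G b x) → Valid G (star b X)
  valid-star G b [] u h = tt
  valid-star G b (x ∷ X) u h = ∖-keep G (star b X) bx (misses X (Unique-head u)) , valid-star G b X (Unique-tail u) (h ∘ there)
    where
    bx = h (here refl)
    misses : ∀ Y → x ∉ Y → All (Miss b x) (star b Y)
    misses [] p = []
    misses (y ∷ Y) p = missʳ (λ e → Adj-≢ G bx (sym e)) (λ { refl → p (here refl) }) ∷ misses Y (p ∘ there)

  star-∈ : ∀ {b : V} {X x} → x ∈ X → (b , x) ∈ star b X
  star-∈ = ∈-map⁺ _

  ends-star-b : ∀ b X → b ∉ X → cnt b (ends (star b X)) ≡ length X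
  ends-star-b b [] p = refl
  ends-star-b b (x ∷ X) p = cong₂ (λ y z → y + z) (δ-refl b) (trans (cong (_+ cnt b (ends (star b X))) (δ-≢ (λ { refl → p (here refl) }))) (ends-star-b b X (p ∘ there)))

  ends-star-x : ∀ b X {x} → x ≢ b → cnt x (ends (star b X)) ≡ cnt x X
  ends-star-x b [] p = refl
  ends-star-x b (y ∷ X) {x} p = trans (cong (_+ (δ x y + cnt x (ends (star b X)))) (δ-≢ p)) (cong (δ x y +_) (ends-star-x b X p))

  ends-star-∈ : ∀ b X {x} → x ∈ ends (star b X) → x ≡ b ⊎ x ∈ X
  ends-star-∈ b (y ∷ X) (here refl) = inj₁ refl
  ends-star-∈ b (y ∷ X) (there (here refl)) = inj₂ (here refl)
  ends-star-∈ b (y ∷ X) (there (there i)) with ends-star-∈ b X i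
  ... | inj₁ e = inj₁ e
  ... | inj₂ j = inj₂ (there j)

  cnt-unique : ∀ {x : V} {X} → Unique X → cnt x X ≤ 1
  cnt-unique {x} {[]} u = z≤n
  cnt-unique {x} {y ∷ X} u = h (x ≟ y)
    where
    h : Dec (x ≡ y) → δ x y + cnt x X ≤ 1
    h (yes refl) = ≤-reflexive (cong₂ _+_ (δ-refl x) (cnt-∉ X (Unique-head u)))
    h (no p) = subst (λ z → z + cnt x X ≤ 1) (sym (δ-≢ p)) (cnt-unique (Unique-tail u))

  cnt-∈ : ∀ {x : V} {X} → x ∈ X → 1 ≤ cnt x X
  cnt-∈ {x} {X} i = subst (_≤ cnt x X) (δ-refl x) (sumBy-∈ (δ x) i)

  ∈-cnt : ∀ {x : V} {X} → 1 ≤ cnt x X → x ∈ X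
  ∈-cnt {x} {X} p with sumBy-pos (δ x) X p
  ... | y , i , q with δ-pos {x = x} {y} q
  ... | refl = i

  cnt-one : ∀ {x : V} {X} → Unique X → x ∈ X → cnt x X ≡ 1
  cnt-one u i = ≤-antisym (cnt-unique u) (cnt-∈ i)

  opaque
    -- The groups are fixed before the selection, so which member of a pair returns at `b` can be
    -- decided with the later restorations in view.
    starG : ∀ (G : Graph n) {b X f} → Unique X → (∀ {x} → x ∈ X → Adj G b x) → St (G ∖ star b X) f → (∀ v → Adj G b v → 1 ≤ f v) →
      ∃[ gs ] verts gs ↭ X × (∀ Y R → Sel gs Y R → ∃[ f′ ] St (G ∖ star b R) f′ × (∀ v → f′ v + cnt v Y ≡ f v + δ v b * length Y))
    starG G {b} {X} {f} uX aX (D , s) pos with starD b X b∉ uX D (λ x∈ → gone (∖-gone G (star b X) (star-∈ x∈)))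
        (λ v _ a → pos v (∖-Adj G (star b X) a)) (λ x∈ → pos _ (aX x∈))
      where
      b∉ : b ∉ X
      b∉ i = Adj-≢ G (aX i) refl
      gone : ∀ {z} → z ≢ true → z ≡ false
      gone {true} p = ⊥-elim (p refl)
      gone {false} p = refl
    ... | gs , π , h = gs , π , λ Y R sl → fin Y R (h Y R sl (adj (G ∖ star b R)) (adjE Y R (↭t (Sel-↭ sl) π)))
      where
      adjE : ∀ Y R → Y ++ R ↭ X → ∀ u v → b2n (adj (G ∖ star b R) u v) ≡ b2n (adj (G ∖ star b X) u v) + (δ u b * cnt v Y + δ v b * cnt u Y)
      adjE Y R σ u v = +-cancelʳ-≡ (sumBy (eo u v) (star b R)) _ _
        (trans (sym (∖-b2n G (star b R) (valid-star G b R (Unique-++ʳ Y uYR) (λ i → aX (∈-resp-↭ σ (∈-++⁺ʳ Y i)))) u v))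
         (trans (∖-b2n G (star b X) (valid-star G b X uX aX) u v)
           (trans (cong (b2n (adj (G ∖ star b X) u v) +_) (trans (eo-star u v b X) (trans
              (cong₂ (λ p q → δ u b * p + δ v b * q) (ce v) (ce u))
                (lem (δ u b) (cnt v Y) (cnt v R) (δ v b) (cnt u Y) (cnt u R)))))
             (trans (cong (λ z → b2n (adj (G ∖ star b X) u v) + (δ u b * cnt v Y + δ v b * cnt u Y + z)) (sym (eo-star u v b R)))
               (sym (+-assoc (b2n (adj (G ∖ star b X) u v)) (δ u b * cnt v Y + δ v b * cnt u Y) _))))))
        where
        uYR : Unique (Y ++ R)
        uYR = Unique-↭ (↭-sym σ) uX
        ce : ∀ z → cnt z X ≡ cnt z Y + cnt z R
        ce z = trans (sumBy-↭ (δ z) (↭-sym σ)) (sumBy-++ (δ z) Y)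
        lem : ∀ a b c d e f → a * (b + c) + d * (e + f) ≡ (a * b + d * e) + (a * c + d * f)
        lem = solve-∀
      fin : ∀ Y R → ∃[ f′ ] Dcp (adj (G ∖ star b R)) f′ × (∀ v → f′ v + cnt v Y ≡ f v + δ v b * length Y) →
            ∃[ f′ ] St (G ∖ star b R) f′ × (∀ v → f′ v + cnt v Y ≡ f v + δ v b * length Y)
      fin Y R (f′ , D′ , e) = f′ , (D′ , subst (_≤ n) (sym Σe) s) , e
        where
        Σcnt : ∀ (Y : List V) → ΣF (λ (v : V) → cnt v Y) ≡ length Y
        Σcnt [] = ΣF-0 {n}
        Σcnt (y ∷ Y) = trans (ΣF-+ (λ v → δ v y) (λ v → cnt v Y)) (cong₂ _+_ (ΣF-δ y) (Σcnt Y))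
        Σe : ΣF f′ ≡ ΣF f
        Σe = +-cancelʳ-≡ (length Y) _ _ (trans (cong (ΣF f′ +_) (sym (Σcnt Y))) (trans (sym (ΣF-+ f′ (λ v → cnt v Y))) (trans (ΣF-cong e)
              (trans (ΣF-+ f (λ v → δ v b * length Y)) (cong (ΣF f +_) (trans (ΣF-cong (λ v → *-comm (δ v b) (length Y)))
                (trans (ΣF-* (length Y) (λ v → δ v b)) (trans (cong (length Y *_) (ΣF-δ b)) (*-identityʳ (length Y))))))))))

  shift-≥ : ∀ {f f′ : V → ℕ} {a b} → (∀ v → f′ v + δ v b ≡ f v + δ v a) → ∀ v → v ≢ b → f v ≤ f′ v
  shift-≥ {f} {f′} {a} {b} e v p = subst (f v ≤_) (sym (trans (sym (+-identityʳ (f′ v))) (trans (cong (f′ v +_) (sym (δ-≢ p))) (e v)))) (m≤m+n _ _)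

  shift-b : ∀ {f f′ : V → ℕ} {a b} → a ≢ b → (∀ v → f′ v + δ v b ≡ f v + δ v a) → f′ b + 1 ≡ f b
  shift-b {f} {f′} {a} {b} p e = trans (cong (f′ b +_) (sym (δ-refl b))) (trans (e b) (trans (cong (f b +_) (δ-≢ (λ q → p (sym q)))) (+-identityʳ (f b))))

  shift-a : ∀ {f f′ : V → ℕ} {a b} → a ≢ b → (∀ v → f′ v + δ v b ≡ f v + δ v a) → f′ a ≡ f a + 1
  shift-a {f} {f′} {a} {b} p e = trans (sym (+-identityʳ (f′ a))) (trans (cong (f′ a +_) (sym (δ-≢ p))) (trans (e a) (cong (f a +_) (δ-refl a))))

  -- `k` bounds the dead ends when `b x` is restored at `x`; `b` is left out because the edge to it
  -- is the one that is missing.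
  Cov : Graph n → V → (V → ℕ) → ℕ → V → Set
  Cov G b f k x = ∃[ Z ] length Z ≤ k × (∀ w → Adj G x w → w ≢ b → 1 ≤ f w ⊎ w ∈ Z)

  Cov-mono : ∀ {G : Graph n} {b f f′ k x} → (∀ v → v ≢ b → f v ≤ f′ v) → Cov G b f k x → Cov G b f′ k x
  Cov-mono h (Z , l , c) = Z , l , λ w a p → up (c w a p) (h w p)
    where
    up : ∀ {A : Set} {i j} → 1 ≤ i ⊎ A → i ≤ j → 1 ≤ j ⊎ A
    up (inj₁ x) q = inj₁ (≤-trans x q)
    up (inj₂ x) q = inj₂ x

  opaque
    push : ∀ (G : Graph n) {b x f k} → Adj G b x → St (del b x G) f → Cov G b f k x → k < f b →
      ∃[ f′ ] St G f′ × (∀ v → f′ v + δ v b ≡ f v + δ v x)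
    push G {b} {x} bx st (Z , l , c) lt = pullʳ G Z (Adj-sym G bx) st
      (λ w a → c w (del-Adj G a) (λ { refl → t≢f a (del-goneʳ G b x) })) (≤-trans (s≤s l) lt)

  opaque
    -- Every restoration takes one end from `b`, and with two possible dead ends three ends must be
    -- present before the last one: hence `length R + 2`.
    pushAll : ∀ (G : Graph n) {b} R {f} → Unique R → (∀ {x} → x ∈ R → Adj G b x) → St (G ∖ star b R) f →
      (∀ {x} → x ∈ R → Cov G b f 2 x) → length R + 2 ≤ f b →
      ∃[ f′ ] St G f′ × (∀ v → v ≢ b → f v ≤ f′ v) × f′ b + length R ≡ f b × (∀ {x} → x ∈ R → 1 ≤ f′ x)
    pushAll G [] {f} u a st c le = f , st , (λ v _ → ≤-refl) , +-identityʳ _ , λ ()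
    pushAll G {b} (x ∷ R) {f} u a st c le with push (G ∖ star b R) {k = 2} bx st
          (let (Z , l , h) = c (here refl) in Z , l , λ w p → h w (∖-Adj G (star b R) p)) (≤-trans (s≤s (m≤n+m 2 (length R))) le)
      where
      bx : Adj (G ∖ star b R) b x
      bx = proj₁ (valid-star G b (x ∷ R) u a)
    ... | f₁ , st₁ , e with pushAll G R (Unique-tail u) (a ∘ there) st₁ (λ i → Cov-mono {G = G} (shift-≥ {f} {f₁} e) (c (there i)))
            (≤-pred (subst (suc (length R + 2) ≤_) (trans (sym (shift-b {f} {f₁} x≢b e)) (+-comm (f₁ b) 1)) le))
      where
      x≢b : x ≢ b
      x≢b q = Adj-≢ G (a (here refl)) (sym q)
    ... | f₂ , st₂ , ge , eb , pos = f₂ , st₂ , (λ v p → ≤-trans (shift-≥ {f} {f₁} e v p) (ge v p)) ,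
        trans (+-suc (f₂ b) (length R)) (trans (cong suc eb) (trans (+-comm 1 (f₁ b)) (shift-b {f} {f₁} x≢b e))) ,
        λ { (here refl) → ≤-trans (subst (1 ≤_) (sym (shift-a {f} {f₁} x≢b e)) (m≤n+m 1 (f x))) (ge x x≢b) ; (there i) → pos i }
      where
      x≢b : x ≢ b
      x≢b q = Adj-≢ G (a (here refl)) (sym q)

  opaque
    -- Putting `x` last saves one end at `b`: the others are followed by an edge with a single
    -- possible dead end, for which two ends are enough. Moreover, by then all vertices of `R′` are
    -- path ends, which `last` may use.
    pushLast : ∀ (G : Graph n) {b x R R′ f} → Unique R → (∀ {y} → y ∈ R → Adj G b y) → R ↭ x ∷ R′ → St (G ∖ star b R) f →
      (∀ {y} → y ∈ R′ → Cov G b f 2 y) → length R′ + 2 ≤ f b →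
      (∀ f′ → (∀ v → v ≢ b → f v ≤ f′ v) → (∀ {y} → y ∈ R′ → 1 ≤ f′ y) → Cov G b f′ 1 x) → Goal G
    pushLast G {b} {x} {R} {R′} {f} u a π (D , s) c le last with pushAll G₁ R′ (Unique-tail u′) a₁ st₁
          (λ i → let (Z , l , h) = c i in Z , l , λ w p → h w (del-Adj G p)) le
      where
      G₁ : Graph n
      G₁ = del b x G
      u′ : Unique (x ∷ R′)
      u′ = Unique-↭ π u
      a₁ : ∀ {y} → y ∈ R′ → Adj G₁ b y
      a₁ {y} i = let by = a (∈-resp-↭ (↭-sym π) (there i)) in
        del-keep G by (missʳ (λ e → Adj-≢ G by (sym e)) (λ { refl → Unique-head u′ i }))
      σ : R ↭ R′ ++ x ∷ []
      σ = ↭t π (++-comm (x ∷ []) R′)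
      st₁ : St (G₁ ∖ star b R′) f
      st₁ = subst (λ H → Dcp (adj H) f) (trans (cong (G ∖_) (map-++ (b ,_) R′ (x ∷ []))) (∖-++ G (star b R′) (star b (x ∷ []))))
              (Dcp-adj (∖-↭ G (valid-star G b R u a) (valid-star G b (R′ ++ x ∷ []) (Unique-↭ σ u) (λ i → a (∈-resp-↭ (↭-sym σ) i))) (map⁺ (b ,_) σ)) D) , s
    ... | f₁ , st , ge , eb , pos with push G (a (∈-resp-↭ (↭-sym π) (here refl))) st (last f₁ ge pos)
            (+-cancelʳ-≤ (length R′) 2 (f₁ b) (subst₂ _≤_ (+-comm (length R′) 2) (sym eb) le))
    ... | f₂ , st₂ , _ = f₂ , st₂

  ones pairs : List Grp → List V
  ones []             = []
  ones (one x ∷ gs)   = x ∷ ones gs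
  ones (two x y ∷ gs) = ones gs
  pairs []             = []
  pairs (one x ∷ gs)   = pairs gs
  pairs (two x y ∷ gs) = x ∷ y ∷ pairs gs

  sum-verts : ∀ (w : V → ℕ) gs → sumBy w (verts gs) ≡ sumBy w (ones gs) + sumBy w (pairs gs)
  sum-verts w [] = refl
  sum-verts w (one x ∷ gs) = trans (cong (w x +_) (sum-verts w gs)) (sym (+-assoc (w x) _ _))
  sum-verts w (two x y ∷ gs) = trans (cong (λ z → w x + (w y + z)) (sum-verts w gs)) (lem (w x) (w y) (sumBy w (ones gs)) (sumBy w (pairs gs)))
    where lem : ∀ a b c d → a + (b + (c + d)) ≡ c + (a + (b + d))
          lem = solve-∀

  par-verts : ∀ gs → pb (length (verts gs)) ≡ pb (length (ones gs))
  par-verts [] = refl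
  par-verts (one x ∷ gs) = cong not (par-verts gs)
  par-verts (two x y ∷ gs) = trans (not-involutive _) (par-verts gs)

  opaque
    -- All unpaired walks are carried out, and of each pair the heavier vertex is left in `R`. So
    -- `R` gets at least half of the weight of the pairs.
    select : ∀ (w : V → ℕ) gs → ∃[ Y ] ∃[ R ] Sel gs Y R × length Y ≡ length R + length (ones gs) × sumBy w (pairs gs) ≤ 2 * sumBy w R
    select w [] = [] , [] , nil , refl , z≤n
    select w (one x ∷ gs) with select w gs
    ... | Y , R , s , l , h = x ∷ Y , R , in₁ s , trans (cong suc l) (sym (+-suc (length R) _)) , h
    select w (two x y ∷ gs) with select w gs | ≤-total (w x) (w y)
    ... | Y , R , s , l , h | inj₁ q = x ∷ Y , y ∷ R , inˡ s , cong suc l ,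
          ≤-trans (+-mono-≤ q (+-monoʳ-≤ (w y) h)) (≤-reflexive (lem (w y) (sumBy w R)))
      where lem : ∀ a b → a + (a + 2 * b) ≡ 2 * (a + b)
            lem = solve-∀
    ... | Y , R , s , l , h | inj₂ q = y ∷ Y , x ∷ R , inʳ s , cong suc l ,
          ≤-trans (+-monoʳ-≤ (w x) (+-mono-≤ q h)) (≤-reflexive (lem (w x) (sumBy w R)))
      where lem : ∀ a b → a + (a + 2 * b) ≡ 2 * (a + b)
            lem = solve-∀

  -- Path ends in `X` do not count yet: a vertex of `Y` gives up an end when its edge is restored at
  -- `b`. Outside `X` and `b` nothing is lost, so `PreCov` becomes `Cov` after that.
  PreCov : Graph n → V → (V → ℕ) → List V → ℕ → V → Set
  PreCov G b f X k x = ∃[ Z ] length Z ≤ k × (∀ w → Adj G x w → w ≢ b → (1 ≤ f w × w ∉ X) ⊎ w ∈ Z)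

  module Close (G : Graph n) {b X f} (uX : Unique X) (aX : ∀ {x} → x ∈ X → Adj G b x) (st : St (G ∖ star b X) f)
    (pos : ∀ v → Adj G b v → 1 ≤ f v) (cov : ∀ {x} → x ∈ X → PreCov G b f X 2 x) where

    b∉X : b ∉ X
    b∉X i = Adj-≢ G (aX i) refl

    gs = proj₁ (starG G uX aX st pos)
    π = proj₁ (proj₂ (starG G uX aX st pos))

    module Chosen {Y R} (sl : Sel gs Y R) where
      res = proj₂ (proj₂ (starG G uX aX st pos)) Y R sl
      f₁ = proj₁ res
      st₁ = proj₁ (proj₂ res)
      e₁ = proj₂ (proj₂ res)
      σ : Y ++ R ↭ X
      σ = ↭t (Sel-↭ sl) π
      uR : Unique R
      uR = Unique-++ʳ Y (Unique-↭ (↭-sym σ) uX)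
      R⊆ : ∀ {x} → x ∈ R → x ∈ X
      R⊆ i = ∈-resp-↭ σ (∈-++⁺ʳ Y i)
      f₁-b : f₁ b ≡ f b + length Y
      f₁-b = trans (sym (+-identityʳ _)) (trans (cong (f₁ b +_) (sym (cnt-∉ Y (λ i → b∉X (∈-resp-↭ σ (∈-++⁺ˡ i))))))
               (trans (e₁ b) (cong (f b +_) (trans (cong (_* length Y) (δ-refl b)) (+-identityʳ _)))))
      f₁-out : ∀ {w} → w ≢ b → w ∉ X → f₁ w ≡ f w
      f₁-out {w} p q = trans (sym (+-identityʳ _)) (trans (cong (f₁ w +_) (sym (cnt-∉ Y (λ i → q (∈-resp-↭ σ (∈-++⁺ˡ i))))))
               (trans (e₁ w) (trans (cong (λ z → f w + z * length Y) (δ-≢ p)) (+-identityʳ _))))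
      cov₁ : ∀ {k x} → PreCov G b f X k x → Cov G b f₁ k x
      cov₁ (Z , l , c) = Z , l , λ w a p → h (c w a p) p
        where
        h : ∀ {w} → (1 ≤ f w × w ∉ X) ⊎ w ∈ Z → w ≢ b → 1 ≤ f₁ w ⊎ w ∈ Z
        h (inj₁ (x , y)) p = inj₁ (subst (1 ≤_) (sym (f₁-out p y)) x)
        h (inj₂ x) p = inj₂ x

      closeBig : length R + 2 ≤ f b + length Y → ∃[ f′ ] St G f′ × 2 ≤ f′ b
      closeBig le with pushAll G R uR (aX ∘ R⊆) st₁ (cov₁ ∘ cov ∘ R⊆) (subst (length R + 2 ≤_) (sym f₁-b) le)
      ... | f₂ , st₂ , _ , eb , _ = f₂ , st₂ , +-cancelʳ-≤ (length R) 2 (f₂ b) (subst₂ _≤_ (+-comm (length R) 2) (sym (trans eb f₁-b)) le)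

      closeOne : ∀ {x} → x ∈ R → PreCov G b f X 1 x → length R + 1 ≤ f b + length Y → Goal G
      closeOne {x} i c le with extract i
      ... | R′ , ρ = pushLast G uR (aX ∘ R⊆) ρ st₁ (λ j → cov₁ (cov (R⊆ (∈-resp-↭ (↭-sym ρ) (there j)))))
              (subst₂ _≤_ (trans (cong (_+ 1) (↭-length ρ)) (sym (+-suc (length R′) 1))) (sym f₁-b) le)
              (λ f′ ge _ → Cov-mono {G = G} ge (cov₁ c))

      -- If `b y` is restored at `y` before `b x` is restored, `y` has become a path end and only
      -- `z` is left as a possible dead end at `x`.
      closeTwo : ∀ {x y z} → x ∈ R → y ∈ R → x ≢ y →
        (∀ w → Adj G x w → w ≢ b → (1 ≤ f w × w ∉ X) ⊎ (w ≡ y ⊎ w ≡ z)) → length R + 1 ≤ f b + length Y → Goal G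
      closeTwo {x} {y} {z} i j x≢y c le with extract i
      ... | R′ , ρ = pushLast G uR (aX ∘ R⊆) ρ st₁ (λ j → cov₁ (cov (R⊆ (∈-resp-↭ (↭-sym ρ) (there j)))))
              (subst₂ _≤_ (trans (cong (_+ 1) (↭-length ρ)) (sym (+-suc (length R′) 1))) (sym f₁-b) le)
              (λ f′ ge pos′ → z ∷ [] , ≤-refl , λ w a p → h f′ ge pos′ (c w a p) p)
        where
        y∈ : y ∈ R′
        y∈ with ∈-resp-↭ ρ j
        ... | here e = ⊥-elim (x≢y (sym e))
        ... | there q = q
        h : ∀ f′ → (∀ v → v ≢ b → f₁ v ≤ f′ v) → (∀ {y} → y ∈ R′ → 1 ≤ f′ y) → ∀ {w} →
          (1 ≤ f w × w ∉ X) ⊎ (w ≡ y ⊎ w ≡ z) → w ≢ b → 1 ≤ f′ w ⊎ w ∈ z ∷ []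
        h f′ ge pos′ {w} (inj₁ (p , q)) r = inj₁ (≤-trans (subst (1 ≤_) (sym (f₁-out r q)) p) (ge w r))
        h f′ ge pos′ (inj₂ (inj₁ refl)) r = inj₁ (pos′ y∈)
        h f′ ge pos′ (inj₂ (inj₂ refl)) r = inj₂ (here refl)

    -- If the last edge bx to be restored meets x with at most one neighbour x can get stuck at,
    -- two path ends at b suffice. That is so for a single, and for a triple as soon as two of
    -- its vertices have their edge restored at their own end.
    data Unit : List V → Set where
      single : ∀ {x} → x ∈ X → PreCov G b f X 1 x → Unit (x ∷ [])
      triple : ∀ {x y z} → x ∈ X → y ∈ X → z ∈ X → x ≢ y → y ≢ z → x ≢ z →
        (∀ w → Adj G x w → w ≢ b → (1 ≤ f w × w ∉ X) ⊎ (w ≡ y ⊎ w ≡ z)) →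
        (∀ w → Adj G y w → w ≢ b → (1 ≤ f w × w ∉ X) ⊎ (w ≡ x ⊎ w ≡ z)) → Unit (x ∷ y ∷ z ∷ [])

    wt : List V → V → ℕ
    wt W v = sumBy (λ x → δ x v) W

    sum-wt : ∀ W R → sumBy (wt W) R ≡ sumBy (λ x → cnt x R) W
    sum-wt [] R = sumBy-0 (wt []) R (λ _ → refl)
    sum-wt (x ∷ W) R = trans (h R) (cong (cnt x R +_) (sum-wt W R))
      where
      h : ∀ R → sumBy (λ v → δ x v + wt W v) R ≡ cnt x R + sumBy (wt W) R
      h R = sumBy-+ (δ x) (wt W) R

    -- `R` contains at least half of `W`. For a single this is the vertex itself; for a triple it is
    -- at least 3/2, hence two of the three vertices.
    closeUnit : ∀ {W Y R} → Unit W → Sel gs Y R → sumBy (wt W) (verts gs) ≤ 2 * sumBy (wt W) R →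
      length R + 1 ≤ f b + length Y → Goal G
    closeUnit {W} {Y} {R} (single {x} x∈ c) sl h le = Chosen.closeOne sl (∈-cnt (pos1 (subst₂ _≤_ (eqv (verts gs)) (cong (2 *_) (eqv R)) h))) c le
      where
      eqv : ∀ R → sumBy (wt (x ∷ [])) R ≡ cnt x R
      eqv R = trans (sum-wt (x ∷ []) R) (+-identityʳ _)
      pos1 : cnt x (verts gs) ≤ 2 * cnt x R → 1 ≤ cnt x R
      pos1 q with cnt x R
      ... | suc _ = s≤s z≤n
      ... | zero = ⊥-elim (<-irrefl refl (≤-trans (cnt-∈ (∈-resp-↭ (↭-sym π) x∈)) q))
    closeUnit {W} {Y} {R} (triple {x} {y} {z} x∈ y∈ z∈ x≢y y≢z x≢z cx cy) sl h le =
        choose (cnt x R) (cnt y R) (cnt z R) refl refl refl (subst₂ _≤_ (eqv (verts gs)) (cong (2 *_) (eqv R)) h)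
      where
      open Chosen sl
      eqv : ∀ R → sumBy (wt (x ∷ y ∷ z ∷ [])) R ≡ cnt x R + (cnt y R + cnt z R)
      eqv R = trans (sum-wt (x ∷ y ∷ z ∷ []) R) (cong (λ k → cnt x R + (cnt y R + k)) (+-identityʳ _))
      big : 3 ≤ cnt x (verts gs) + (cnt y (verts gs) + cnt z (verts gs))
      big = +-mono-≤ (cnt-∈ (∈-resp-↭ (↭-sym π) x∈)) (+-mono-≤ (cnt-∈ (∈-resp-↭ (↭-sym π) y∈)) (cnt-∈ (∈-resp-↭ (↭-sym π) z∈)))
      mem : ∀ {v k} → cnt v R ≡ suc k → v ∈ R
      mem e = ∈-cnt (subst (1 ≤_) (sym e) (s≤s z≤n))
      many : ∀ {v k} → cnt v R ≡ suc (suc k) → ⊥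
      many {v} e with subst (_≤ 1) e (cnt-unique {x = v} uR)
      ... | s≤s ()
      sw : ∀ {A B C : Set} → A ⊎ (B ⊎ C) → A ⊎ (C ⊎ B)
      sw (inj₁ a) = inj₁ a
      sw (inj₂ (inj₁ b)) = inj₂ (inj₂ b)
      sw (inj₂ (inj₂ c)) = inj₂ (inj₁ c)
      small : ∀ {k} → k ≤ 2 → 3 ≤ k → ⊥
      small p q = <-irrefl refl (≤-trans q p)
      choose : ∀ i j k → cnt x R ≡ i → cnt y R ≡ j → cnt z R ≡ k →
        cnt x (verts gs) + (cnt y (verts gs) + cnt z (verts gs)) ≤ 2 * (i + (j + k)) → Goal G
      choose (suc i) (suc j) k ei ej ek q = closeTwo (mem ei) (mem ej) x≢y cx le
      choose (suc i) zero (suc k) ei ej ek q = closeTwo (mem ei) (mem ek) x≢z (λ w a p → sw (cx w a p)) le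
      choose zero (suc j) (suc k) ei ej ek q = closeTwo (mem ej) (mem ek) y≢z (λ w a p → sw (cy w a p)) le
      choose zero zero zero ei ej ek q = ⊥-elim (small z≤n (≤-trans big q))
      choose (suc zero) zero zero ei ej ek q = ⊥-elim (small ≤-refl (≤-trans big q))
      choose zero (suc zero) zero ei ej ek q = ⊥-elim (small ≤-refl (≤-trans big q))
      choose zero zero (suc zero) ei ej ek q = ⊥-elim (small ≤-refl (≤-trans big q))
      choose (suc (suc i)) zero zero ei ej ek q = ⊥-elim (many ei)
      choose zero (suc (suc j)) zero ei ej ek q = ⊥-elim (many ej)
      choose zero zero (suc (suc k)) ei ej ek q = ⊥-elim (many ek)

    par-ones : pb (length (ones gs)) ≡ pb (length X)
    par-ones = trans (sym (par-verts gs)) (cong pb (↭-length π))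

    -- An odd number of walks leaves one unpaired; together with the end already at `b` this gives
    -- the two ends needed.
    closeOdd : pb (length X) ≡ false → 1 ≤ f b → ∃[ f′ ] St G f′ × 2 ≤ f′ b
    closeOdd odd 1≤ with select (λ _ → 0) gs
    ... | Y , R , sl , l , _ = Chosen.closeBig sl (subst (λ k → length R + 2 ≤ f b + k) (sym l)
            (≤-trans (≤-reflexive (lem (length R))) (+-mono-≤ 1≤ (+-monoʳ-≤ (length R) (pb-odd-pos (trans par-ones odd))))))
      where lem : ∀ r → r + 2 ≡ 1 + (r + 1)
            lem = solve-∀

    manyOnes : 2 ≤ length (ones gs) → Goal G
    manyOnes h with select (λ _ → 0) gs
    ... | Y , R , sl , l , _ = proj₁ big , proj₁ (proj₂ big)
      where
      big = Chosen.closeBig sl (subst (λ k → length R + 2 ≤ f b + k) (sym l) (≤-trans (+-monoʳ-≤ (length R) h) (m≤n+m _ (f b))))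

    -- Unpaired walks all go to `Y`. If none of them starts in `W`, the weight of `W` lies in the
    -- pairs, and half of it reaches `R`.
    unitAvoiding : ∀ {W} → Unit W → sumBy (wt W) (ones gs) ≡ 0 → 1 ≤ f b + length (ones gs) → Goal G
    unitAvoiding {W} un z0 le with select (wt W) gs
    ... | Y , R , sl , l , h = closeUnit un sl (subst (_≤ 2 * sumBy (wt W) R) (sym (trans (sum-verts (wt W) gs) (cong (_+ sumBy (wt W) (pairs gs)) z0))) h)
            (subst (λ k → length R + 1 ≤ f b + k) (sym l) (≤-trans (+-monoʳ-≤ (length R) le) (≤-reflexive (lem (length R) (f b) (length (ones gs))))))
      where lem : ∀ r b o → r + (b + o) ≡ b + (r + o)
            lem = solve-∀

    wt-∉ : ∀ {W v} → v ∉ W → wt W v ≡ 0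
    wt-∉ {W} {v} p = sumBy-0 (λ x → δ x v) W (λ i → δ-≢ (λ { refl → p i }))

    -- An even number of walks leaves none or at least two unpaired. Two of them supply the ends
    -- needed; if there are none, the unit lowers the demand to what `f b ≥ 1` provides.
    closeEven : ∀ {W} → Unit W → pb (length X) ≡ true → 1 ≤ f b → Goal G
    closeEven {W} un even 1≤ = h (ones gs) refl (trans par-ones even)
      where
      h : ∀ O → ones gs ≡ O → pb (length (ones gs)) ≡ true → Goal G
      h [] e _ = unitAvoiding un (cong (sumBy (wt W)) e) (≤-trans 1≤ (m≤m+n _ _))
      h (_ ∷ _ ∷ O) e _ = manyOnes (subst (λ l → 2 ≤ length l) (sym e) (s≤s (s≤s z≤n)))
      h (_ ∷ []) e p = ⊥-elim (t≢f p (cong (pb ∘ length) e))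

    -- With a single unpaired walk, its starting vertex misses one of two disjoint units. That walk
    -- replaces the end that `b` may lack.
    closeOddUnits : ∀ {W W′} → Unit W → Unit W′ → (∀ {x} → x ∈ W → x ∉ W′) → pb (length X) ≡ false → Goal G
    closeOddUnits {W} {W′} un un′ dis odd = h (ones gs) refl (trans par-ones odd)
      where
      le : ∀ {s} → ones gs ≡ s ∷ [] → 1 ≤ f b + length (ones gs)
      le e = subst (λ l → 1 ≤ f b + length l) (sym e) (m≤n+m 1 (f b))
      h : ∀ O → ones gs ≡ O → pb (length (ones gs)) ≡ false → Goal G
      h [] e p = ⊥-elim (t≢f (cong (pb ∘ length) e) p)
      h (_ ∷ _ ∷ O) e _ = manyOnes (subst (λ l → 2 ≤ length l) (sym e) (s≤s (s≤s z≤n)))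
      h (s ∷ []) e _ with memb? _≟_ s W
      ... | no p = unitAvoiding un (trans (cong (sumBy (wt W)) e) (trans (+-identityʳ _) (wt-∉ {W} p))) (le e)
      ... | yes p = unitAvoiding un′ (trans (cong (sumBy (wt W′)) e) (trans (+-identityʳ _) (wt-∉ {W′} (dis p)))) (le e)

  -- Reductions at vertices of the E-subgraph

  reduceL : ∀ (G : Graph n) L → 1 ≤ length L → Valid G L → Deg≤ 3 G → NoSET G → IH (size G) →
    NewIsolated G L → Safe G L → Goal (G ∖ L)
  reduceL G (e ∷ L) _ = reduce G e L

  reduceL₂ : ∀ (G : Graph n) L → 1 ≤ length L → Valid G L → Deg≤ 2 G → NoSET G → IH (size G) →
    (∀ {x} → x ∈ ends L → Fine G L x) → Goal (G ∖ L)
  reduceL₂ G (e ∷ L) _ = reduce₂ G e L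

  odd? : ∀ (G : Graph n) v → ev G v ≡ true ⊎ ev G v ≡ false
  odd? G v with ev G v
  ... | true = inj₁ refl
  ... | false = inj₂ refl

  too-many : ∀ k (G : Graph n) → Deg≤ k G → ∀ {v} W → ev G v ≡ true → Unique W → (∀ {w} → w ∈ W → Adj G v w × ev G w ≡ true) → length W ≤ k
  too-many k G d {v} W e u h = ≤-trans (⊆-length u (λ i → ∈-elist G (proj₁ (h i)) (proj₂ (h i)))) (d v e)

  flip-odd : ∀ (G : Graph n) L → Valid G L → ∀ {x} → ev G x ≡ true → cnt x (ends L) ≡ 1 → ev (G ∖ L) x ≡ false
  flip-odd G L va e c = trans (ev-flip G L va (cong pb c)) (cong not e)

  module EvenStar (G : Graph n) (d3 : Deg≤ 3 G) (ns : NoSET G) (ih : IH (size G)) {a} (ea : ev G a ≡ true) (l3 : length (elist G a) ≡ 3) where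

    X = elist G a
    L = star a X
    H = G ∖ L
    uX = elist-unique G a
    aX : ∀ {x} → x ∈ X → Adj G a x
    aX i = proj₁ (elist-∈ G i)
    eX : ∀ {x} → x ∈ X → ev G x ≡ true
    eX i = proj₂ (elist-∈ G i)
    va = valid-star G a X uX aX
    a∉ : a ∉ X
    a∉ i = Adj-≢ G (aX i) refl

    oddX : ∀ {x} → x ∈ X → ev H x ≡ false
    oddX {x} i = flip-odd G L va (eX i) (trans (ends-star-x a X (λ e → a∉ (subst (_∈ X) e i))) (cnt-one uX i))

    odda : ev H a ≡ false
    odda = trans (ev-flip G L va (cong pb (trans (ends-star-b a X a∉) l3))) (cong not ea)

    even-ends : ∀ {x} → x ∈ ends L → ev G x ≡ true
    even-ends i with ends-star-∈ a X i
    ... | inj₁ refl = ea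
    ... | inj₂ j = eX j

    keeps-odd : ∀ {v} → ev G v ≡ false → ev H v ≡ false
    keeps-odd {v} o = trans (ev-∉ G L va (λ i → t≢f (even-ends i) o)) o

    isolated : NewIsolated G L
    isolated v o e = ⊥-elim (t≢f e (keeps-odd o))

    odd-nbr : ∀ {v} → Adj G a v → ev H v ≡ false
    odd-nbr {v} av with odd? G v
    ... | inj₁ e = oddX (∈-elist G av e)
    ... | inj₂ o = keeps-odd o

    -- Besides `a`, a vertex of `X` has at most two even neighbours; this is where the bound 3
    -- enters. The centre loses three edges and becomes odd, so it has an end to start with.
    solve₃ : Safe G L → Goal G
    solve₃ safe with reduceL G L (subst (1 ≤_) (sym (trans (length-map (a ,_) X) l3)) (s≤s z≤n)) va d3 ns ih isolated safe
    ... | f , st = proj₁ fin , proj₁ (proj₂ fin)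
      where
      pos : ∀ {v} → ev H v ≡ false → 1 ≤ f v
      pos = odd-pos H st
      cov : ∀ {x} → x ∈ X → PreCov G a f X 2 x
      cov {x} i with extract (∈-elist G (Adj-sym G (aX i)) ea)
      ... | Z , ζ = Z , ≤-pred (subst (_≤ 3) (↭-length ζ) (d3 x (eX i))) , h
        where
        h : ∀ w → Adj G x w → w ≢ a → (1 ≤ f w × w ∉ X) ⊎ w ∈ Z
        h w xw w≢a with odd? G w
        ... | inj₂ o = inj₁ (pos (keeps-odd o) , λ j → t≢f (eX j) o)
        ... | inj₁ e with ∈-resp-↭ ζ (∈-elist G xw e)
        ...   | here p = ⊥-elim (w≢a p)
        ...   | there q = inj₂ q
      fin = Close.closeOdd G uX aX st (λ v av → pos (odd-nbr av)) cov (cong pb l3) (pos odda)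

    -- After the deletion all former neighbours of `a` are odd, so `a` sees no triangle. Only a
    -- vertex of `X` adjacent to two vertices of a triangle could fail as a witness.
    safe-if : (∀ {x p q r} → x ∈ X → Tri H p q r → Adj H x p → Adj H x q → ⊥) → Safe G L
    safe-if h e i t₁ t₂ t₃ t@((e₁ , e₂ , e₃) , (a₁₂ , a₂₃ , a₁₃)) with ends-star-∈ a X i
    ... | inj₁ refl = (ne e₁ , ne e₂ , ne e₃) , inj₂ ((λ { (p , _) → far e₁ p }) , (λ { (p , _) → far e₂ p }) , (λ { (p , _) → far e₁ p }))
      where
      ne : ∀ {y} → ev H y ≡ true → a ≢ y
      ne p refl = t≢f p odda
      far : ∀ {y} → ev H y ≡ true → ¬ Adj H a y
      far p q = t≢f p (odd-nbr (∖-Adj G L q))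
    ... | inj₂ j = (ne e₁ , ne e₂ , ne e₃) ,
        inj₂ ((λ { (p , q) → h j t p q }) , (λ { (p , q) → h j ((e₂ , e₃ , e₁) , (a₂₃ , Adj-sym H a₁₃ , Adj-sym H a₁₂)) p q }) ,
              (λ { (p , q) → h j ((e₁ , e₃ , e₂) , (a₁₃ , Adj-sym H a₂₃ , a₁₂)) p q }))
      where
      ne : ∀ {y} → ev H y ≡ true → e ≢ y
      ne p refl = t≢f p (oddX j)

  -- The trace in `G` of an unsafe star at `a`: `p` and `q` would stay even and could lie in a
  -- triangle seen twice from `x`.
  Spread : Graph n → V → V → V → V → Set
  Spread G a x p q = (ev G x ≡ true × ev G p ≡ true × ev G q ≡ true) × (Adj G a x × Adj G x p × Adj G x q) ×
    (p ≢ q × p ≢ a × q ≢ a) × (¬ Adj G a p × ¬ Adj G a q)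

  Good : Graph n → V → Set
  Good G a = (ev G a ≡ true × length (elist G a) ≡ 3) × (∀ x p q → ¬ Spread G a x p q)

  good? : ∀ (G : Graph n) a → Dec (Good G a)
  good? G a = ((ev G a Bool.≟ true) ×-dec (length (elist G a) ℕₚ.≟ 3)) ×-dec
    all? (λ x → all? (λ p → all? (λ q → ¬? (((ev G x Bool.≟ true) ×-dec (ev G p Bool.≟ true) ×-dec (ev G q Bool.≟ true)) ×-dec
      (adj? G a x ×-dec adj? G x p ×-dec adj? G x q) ×-dec (¬? (p ≟ q) ×-dec ¬? (p ≟ a) ×-dec ¬? (q ≟ a)) ×-dec
      (¬? (adj? G a p) ×-dec ¬? (adj? G a q))))))

  -- The even neighbours of `p` are exactly `x`, `q` and `r`. Each of them has, besides `p`, another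
  -- neighbour among them, which leaves room for at most one even neighbour that is neither `p` nor
  -- adjacent to `p`.
  diamond-good : ∀ (G : Graph n) → Deg≤ 3 G → ∀ {x p q r} → ev G x ≡ true → Tri G p q r → x ≢ r → Adj G x p → Adj G x q → Good G p
  diamond-good G d3 {x} {p} {q} {r} ex ((ep , eq , er) , (pq , qr , pr)) x≢r xp xq = (ep , len) , nospread
    where
    inP : ∀ {w} → w ∈ x ∷ q ∷ r ∷ [] → Adj G p w × ev G w ≡ true
    inP (here refl) = Adj-sym G xp , ex
    inP (there (here refl)) = pq , eq
    inP (there (there (here refl))) = pr , er
    uP : Unique (x ∷ q ∷ r ∷ [])
    uP = (Adj-≢ G xq ∷ x≢r ∷ []) ∷ (Adj-≢ G qr ∷ []) ∷ [] ∷ []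
    len : length (elist G p) ≡ 3
    len = ≤-antisym (d3 p ep) (⊆-length uP (λ i → ∈-elist G (proj₁ (inP i)) (proj₂ (inP i))))
    four : ∀ {v w₁ w₂ w₃ w₄} → ev G v ≡ true → (ev G w₁ ≡ true × ev G w₂ ≡ true × ev G w₃ ≡ true × ev G w₄ ≡ true) →
      (Adj G v w₁ × Adj G v w₂ × Adj G v w₃ × Adj G v w₄) → Unique (w₁ ∷ w₂ ∷ w₃ ∷ w₄ ∷ []) → ⊥
    four {v} {w₁} {w₂} {w₃} {w₄} e (e₁ , e₂ , e₃ , e₄) (a₁ , a₂ , a₃ , a₄) u = <-irrefl refl (too-many 3 G d3 (w₁ ∷ w₂ ∷ w₃ ∷ w₄ ∷ []) e u h)
      where
      h : ∀ {w} → w ∈ w₁ ∷ w₂ ∷ w₃ ∷ w₄ ∷ [] → Adj G v w × ev G w ≡ true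
      h (here refl) = a₁ , e₁
      h (there (here refl)) = a₂ , e₂
      h (there (there (here refl))) = a₃ , e₃
      h (there (there (there (here refl)))) = a₄ , e₄
    nospread : ∀ x′ p′ q′ → ¬ Spread G p x′ p′ q′
    nospread x′ p′ q′ ((ex′ , ep′ , eq′) , (px′ , x′p′ , x′q′) , (p′≢q′ , p′≢p , q′≢p) , (¬pp′ , ¬pq′)) = go (memb? _≟_ x′ (x ∷ q ∷ r ∷ []))
      where
      ne : ∀ {u w} → Adj G p u → ¬ Adj G p w → u ≢ w
      ne a b refl = b a
      fr′ : ∀ {u} → Adj G p u → ev G u ≡ true → Adj G x′ u → Adj G x′ p → ⊥
      fr′ {u} pu eu x′u x′p = four ex′ (ep , eu , ep′ , eq′) (x′p , x′u , x′p′ , x′q′)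
        ((Adj-≢ G pu ∷ (λ e → p′≢p (sym e)) ∷ (λ e → q′≢p (sym e)) ∷ []) ∷ (ne pu ¬pp′ ∷ ne pu ¬pq′ ∷ []) ∷ (p′≢q′ ∷ []) ∷ [] ∷ [])
      go : Dec (x′ ∈ x ∷ q ∷ r ∷ []) → ⊥
      go (yes (here refl)) = fr′ pq eq xq xp
      go (yes (there (here refl))) = fr′ (Adj-sym G xp) ex (Adj-sym G xq) (Adj-sym G pq)
      go (yes (there (there (here refl)))) = fr′ pq eq (Adj-sym G qr) (Adj-sym G pr)
      go (no ∉) = four ep (ex′ , ex , eq , er) (px′ , Adj-sym G xp , pq , pr) (All.tabulate (λ { i refl → ∉ i }) ∷ uP)

  -- A star at a `Good` vertex is safe. If there is no such vertex, `diamond-good` excludes two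
  -- triangles with a common edge, and then the star at the given `a` is safe.
  case-deg3 : ∀ (G : Graph n) → Deg≤ 3 G → NoSET G → IH (size G) → ∀ {a} → ev G a ≡ true → length (elist G a) ≡ 3 → Goal G
  case-deg3 G d3 ns ih {a} ea l3 = go (any? (good? G))
    where
    go : Dec (∃ (Good G)) → Goal G
    go (yes (u , (eu , lu) , ns′)) = solve₃ (safe-if h)
      where
      open EvenStar G d3 ns ih eu lu
      h : ∀ {x p q r} → x ∈ X → Tri H p q r → Adj H x p → Adj H x q → ⊥
      h {x} {p} {q} {r} i t@((ep , eq , er) , (pq , _ , _)) xp xq = ns′ x p q
        ((eX i , proj₁ (proj₁ ot) , proj₁ (proj₂ (proj₁ ot))) , (aX i , ∖-Adj G L xp , ∖-Adj G L xq) ,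
         (Adj-≢ H pq , ne ep , ne eq) , (far ep , far eq))
        where
        ot = old-tri G L isolated t
        ne : ∀ {y} → ev H y ≡ true → y ≢ u
        ne e refl = t≢f e odda
        far : ∀ {y} → ev H y ≡ true → ¬ Adj G u y
        far e a′ = t≢f e (odd-nbr a′)
    go (no none) = solve₃ (safe-if h)
      where
      open EvenStar G d3 ns ih ea l3
      h : ∀ {x p q r} → x ∈ X → Tri H p q r → Adj H x p → Adj H x q → ⊥
      h {x} {p} {q} {r} i t xp xq = none (p , diamond-good G d3 (eX i) (old-tri G L isolated t)
        (λ { refl → t≢f (proj₂ (proj₂ (proj₁ t))) (oddX i) }) (∖-Adj G L xp) (∖-Adj G L xq))

  single-∈ : ∀ {x y : V} {l} → l ≡ x ∷ [] → y ∈ l → y ≡ x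
  single-∈ refl (here e) = e

  -- Without `a x` all neighbours of `a` are odd, so nothing can get stuck when the edge is restored
  -- at `a`. If `a` turns even, it is isolated in the E-subgraph for the same reason.
  case-one-even : ∀ (G : Graph n) → Deg≤ 2 G → NoSET G → IH (size G) → ∀ {a x} → elist G a ≡ x ∷ [] → Goal G
  case-one-even G d2 ns ih {a} {x} l = go (reduceL₂ G L (s≤s z≤n) va d2 ns ih fine)
    where
    L = (a , x) ∷ []
    H = G ∖ L
    ax : Adj G a x × ev G x ≡ true
    ax = elist-∈ G (subst (x ∈_) (sym l) (here refl))
    va : Valid G L
    va = proj₁ ax , tt
    oddx : ev H x ≡ false
    oddx = trans (ev-delʳ G (proj₁ ax)) (cong not (proj₂ ax))
    nbr : ∀ v → Adj H a v → ev H v ≡ false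
    nbr v av with odd? G v
    ... | inj₁ e with single-∈ l (∈-elist G (del-Adj G av) e)
    ...   | refl = ⊥-elim (t≢f av (del-gone G a x))
    nbr v av | inj₂ o = trans (ev-del-≢ G (proj₁ ax) (λ e → Adj-≢ H av (sym e)) (λ { refl → t≢f (proj₂ ax) o })) o
    fine : ∀ {y} → y ∈ ends L → Fine G L y
    fine (here refl) with odd? G a
    ... | inj₁ e = inj₁ (e , trans (ev-delˡ G (proj₁ ax)) (cong not e))
    ... | inj₂ o = inj₂ (o , nbr)
    fine (there (here refl)) = inj₁ (proj₂ ax , oddx)
    go : Goal H → Goal G
    go (f , st) = let (f′ , st′ , _) = pullˡ G [] (proj₁ ax) st (λ v av → inj₁ (odd-pos H st (nbr v av))) (odd-pos H st oddx) in f′ , st′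

  two-nbrs : ∀ (G : Graph n) → Deg≤ 2 G → ∀ {v x y} → ev G v ≡ true → Adj G v x → Adj G v y → ev G x ≡ true → ev G y ≡ true → x ≢ y →
    ∀ {w} → Adj G v w → ev G w ≡ true → w ≡ x ⊎ w ≡ y
  two-nbrs G d2 {v} {x} {y} e vx vy ex ey x≢y {w} vw ew with w ≟ x | w ≟ y
  ... | yes p | _ = inj₁ p
  ... | no _ | yes p = inj₂ p
  ... | no p | no q = ⊥-elim (<-irrefl refl (too-many 2 G d2 (w ∷ x ∷ y ∷ []) e ((p ∷ q ∷ []) ∷ (x≢y ∷ []) ∷ [] ∷ []) h))
    where
    h : ∀ {u} → u ∈ w ∷ x ∷ y ∷ [] → Adj G v u × ev G u ≡ true
    h (here refl) = vw , ew
    h (there (here refl)) = vx , ex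
    h (there (there (here refl))) = vy , ey

  -- Restoring pr at p first turns p into an end of a path, so that aq can be restored at a.
  case-cycle : ∀ (G : Graph n) → Deg≤ 2 G → NoSET G → IH (size G) → ∀ {q a p r} →
    (ev G q ≡ true × ev G a ≡ true × ev G p ≡ true × ev G r ≡ true) → (Adj G q a × Adj G a p × Adj G p r) →
    p ≢ q → ¬ Adj G p q → r ≢ a → Goal G
  case-cycle G d2 ns ih {q} {a} {p} {r} (eq , ea , ep , er) (qa , ap , pr) p≢q ¬pq r≢a = go (reduceL₂ G L (s≤s z≤n) va d2 ns ih fine)
    where
    aq = Adj-sym G qa
    L = (p , r) ∷ (a , q) ∷ []
    H = G ∖ L
    K = del a q G
    p≢a : p ≢ a
    p≢a e = Adj-≢ G ap (sym e)
    r≢q : r ≢ q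
    r≢q refl = ¬pq pr
    Kpr : Adj K p r
    Kpr = del-keep G pr (missˡ p≢a p≢q)
    va : Valid G L
    va = Kpr , aq , tt
    u : Unique (ends L)
    u = (Adj-≢ G pr ∷ p≢a ∷ p≢q ∷ []) ∷ (r≢a ∷ r≢q ∷ []) ∷ (Adj-≢ G aq ∷ []) ∷ [] ∷ []
    even : ∀ {x} → x ∈ ends L → ev G x ≡ true
    even (here refl) = ep
    even (there (here refl)) = er
    even (there (there (here refl))) = ea
    even (there (there (there (here refl)))) = eq
    odd : ∀ {x} → x ∈ ends L → ev H x ≡ false
    odd i = flip-odd G L va (even i) (cnt-one u i)
    keeps : ∀ {v} → ev G v ≡ false → ev H v ≡ false
    keeps o = trans (ev-∉ G L va (λ i → t≢f (even i) o)) o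
    fine : ∀ {x} → x ∈ ends L → Fine G L x
    fine i = inj₁ (even i , odd i)
    go : Goal H → Goal G
    go (f , st) with pullˡ K [] Kpr st cov₁ (pos (odd (there (here refl))))
      where
      pos : ∀ {v} → ev H v ≡ false → 1 ≤ f v
      pos = odd-pos H st
      cov₁ : ∀ v → Adj H p v → 1 ≤ f v ⊎ v ∈ []
      cov₁ v pv with odd? G v
      ... | inj₂ o = inj₁ (pos (keeps o))
      ... | inj₁ e with two-nbrs G d2 ep (Adj-sym G ap) pr ea er (λ x → r≢a (sym x)) (∖-Adj G L pv) e
      ...   | inj₁ refl = inj₁ (pos (odd (there (there (here refl)))))
      ...   | inj₂ refl = inj₁ (pos (odd (there (here refl))))
    ... | f₁ , st₁ , e₁ with pullˡ G [] aq st₁ cov₂ (≤-trans (pos (odd (there (there (there (here refl)))))) (shift-≥ {f = f} {f₁} e₁ q (λ x → r≢q (sym x))))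
      where
      pos : ∀ {v} → ev H v ≡ false → 1 ≤ f v
      pos = odd-pos H st
      cov₂ : ∀ v → Adj K a v → 1 ≤ f₁ v ⊎ v ∈ []
      cov₂ v av with odd? G v
      ... | inj₂ o = inj₁ (≤-trans (pos (keeps o)) (shift-≥ {f = f} {f₁} e₁ v (λ { refl → t≢f er o })))
      ... | inj₁ e with two-nbrs G d2 ea ap aq ep eq p≢q (del-Adj G av) e
      ...   | inj₁ refl = inj₁ (≤-trans (pos (odd (here refl))) (shift-≥ {f = f} {f₁} e₁ p (Adj-≢ G pr)))
      ...   | inj₂ refl = ⊥-elim (t≢f av (del-gone G a q))
    ... | f₂ , st₂ , _ = f₂ , st₂

  -- Odd vertices meeting two components of the E-subgraph

  ends-++ : ∀ (L M : List (V × V)) → ends (L ++ M) ≡ ends L ++ ends M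
  ends-++ [] M = refl
  ends-++ ((u , v) ∷ L) M = cong (λ l → u ∷ v ∷ l) (ends-++ L M)

  ends-∈ : ∀ {v} (L : List (V × V)) → v ∈ ends L → ∃[ y ] ∃[ z ] (y , z) ∈ L × (v ≡ y ⊎ v ≡ z)
  ends-∈ ((y , z) ∷ L) (here e) = y , z , here refl , inj₁ e
  ends-∈ ((y , z) ∷ L) (there (here e)) = y , z , here refl , inj₂ e
  ends-∈ (_ ∷ L) (there (there i)) with ends-∈ L i
  ... | y , z , j , e = y , z , there j , e

  ∈-endsˡ : ∀ {y z} {L : List (V × V)} → (y , z) ∈ L → y ∈ ends L
  ∈-endsˡ (here refl) = here refl
  ∈-endsˡ (there i) = there (there (∈-endsˡ i))

  ∈-endsʳ : ∀ {y z} {L : List (V × V)} → (y , z) ∈ L → z ∈ ends L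
  ∈-endsʳ (here refl) = there (here refl)
  ∈-endsʳ (there i) = there (there (∈-endsʳ i))

  -- `P` collects the vertices known to be path ends. Restoring `y z` at `y` takes an end from `z`
  -- only, and `z` is not in `P`; afterwards `y` joins `P`.
  betas : ∀ (G : Graph n) M (P : V → Set) Bs {f} → Valid G (Bs ++ M) → Unique (ends Bs) → St (G ∖ (Bs ++ M)) f →
    (∀ v → P v → 1 ≤ f v) → (∀ {v} → v ∈ ends Bs → 1 ≤ f v) → (∀ {y z} → (y , z) ∈ Bs → ¬ P z) →
    (∀ {y z} → (y , z) ∈ Bs → ∀ v → Adj G y v → v ≢ z → P v) →
    ∃[ f′ ] St (G ∖ M) f′ × (∀ v → P v → 1 ≤ f′ v) × (∀ {y z} → (y , z) ∈ Bs → 1 ≤ f′ y)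
  betas G M P [] {f} va u st pos posE nP nb = f , st , pos , λ ()
  betas G M P ((y , z) ∷ Bs) {f} (yz , va) u st pos posE nP nb
    with pullˡ (G ∖ (Bs ++ M)) [] yz st (λ v a → inj₁ (pos v (nb (here refl) v (∖-Adj G ((y , z) ∷ Bs ++ M) a) (λ { refl → t≢f a (del-gone (G ∖ (Bs ++ M)) y z) }))))
           (posE (there (here refl)))
  ... | f₁ , st₁ , e₁ with betas G M (λ v → P v ⊎ v ≡ y) Bs va (Unique-tail (Unique-tail u)) st₁ pos′ posE′ nP′ (λ i v a p → inj₁ (nb (there i) v a p))
    where
    ge : ∀ v → v ≢ z → f v ≤ f₁ v
    ge = shift-≥ {f = f} {f₁} e₁
    pos′ : ∀ v → P v ⊎ v ≡ y → 1 ≤ f₁ v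
    pos′ v (inj₁ p) = ≤-trans (pos v p) (ge v (λ { refl → nP (here refl) p }))
    pos′ v (inj₂ refl) = ≤-trans (posE (here refl)) (ge y (λ { refl → Unique-head u (here refl) }))
    posE′ : ∀ {v} → v ∈ ends Bs → 1 ≤ f₁ v
    posE′ i = ≤-trans (posE (there (there i))) (ge _ (λ { refl → Unique-head (Unique-tail u) i }))
    nP′ : ∀ {y′ z′} → (y′ , z′) ∈ Bs → ¬ (P z′ ⊎ z′ ≡ y)
    nP′ i (inj₁ p) = nP (there i) p
    nP′ i (inj₂ refl) = Unique-head u (there (∈-endsʳ i))
  ... | f₂ , st₂ , pos₂ , posB = f₂ , st₂ , (λ v p → pos₂ v (inj₁ p)) , λ { (here refl) → pos₂ y (inj₂ refl) ; (there i) → posB i }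

  tri-yxz : ∀ {G : Graph n} {x y z} → Tri G x y z → Tri G y x z
  tri-yxz {G} ((a , b , c) , (d , e , f)) = (b , a , c) , (Adj-sym G d , f , e)

  tri-xzy : ∀ {G : Graph n} {x y z} → Tri G x y z → Tri G x z y
  tri-xzy {G} ((a , b , c) , (d , e , f)) = (a , c , b) , (f , Adj-sym G e , d)

  tri-nbr : ∀ (G : Graph n) → Deg≤ 2 G → ∀ {x y z w} → Tri G x y z → Adj G x w → ev G w ≡ true → w ≡ y ⊎ w ≡ z
  tri-nbr G d2 ((ex , ey , ez) , (xy , yz , xz)) xw ew = two-nbrs G d2 ex xy xz ey ez (Adj-≢ G yz) xw ew

  module TwoComponents (G : Graph n) (d2 : Deg≤ 2 G) (ns : NoSET G) (ih : IH (size G)) {b} (ob : ev G b ≡ false) where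

    S = elist G b

    -- The component of x in the E-subgraph, and how many of its vertices are adjacent to b.
    data Kind (x : V) : Set where
      iso : (∀ w → Adj G x w → ev G w ≡ false) → Kind x
      t₁  : ∀ y z → Tri G x y z → ¬ Adj G b y → ¬ Adj G b z → Kind x
      t₂  : ∀ y z → Tri G x y z → Adj G b y → ¬ Adj G b z → Kind x
      t₃  : ∀ y z → Tri G x y z → Adj G b y → Adj G b z → Kind x

    βs : ∀ {x} → Kind x → List (V × V)
    βs (iso _)        = []
    βs (t₁ y z _ _ _) = (y , z) ∷ []
    βs (t₂ y z _ _ _) = (y , z) ∷ []
    βs (t₃ _ _ _ _ _) = []

    members Ws : ∀ {x} → Kind x → List V
    members {x} (iso _)        = x ∷ []
    members {x} (t₁ y z _ _ _) = x ∷ y ∷ z ∷ []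
    members {x} (t₂ y z _ _ _) = x ∷ y ∷ z ∷ []
    members {x} (t₃ y z _ _ _) = x ∷ y ∷ z ∷ []
    Ws {x} (iso _)        = x ∷ []
    Ws {x} (t₁ _ _ _ _ _) = x ∷ []
    Ws {x} (t₂ _ _ _ _ _) = x ∷ []
    Ws {x} (t₃ y z _ _ _) = x ∷ y ∷ z ∷ []

    -- `t₂` is set apart because its `y` is a neighbour of `b`: deleting `y z` as well as `b y`
    -- would make `y` even again.
    NT₂ : ∀ {x} → Kind x → Set
    NT₂ (t₂ _ _ _ _ _) = ⊥
    NT₂ _ = ⊤

    Ws⊆ : ∀ {x v} (k : Kind x) → v ∈ Ws k → v ∈ members k
    Ws⊆ (iso _) i = i
    Ws⊆ (t₁ _ _ _ _ _) (here e) = here e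
    Ws⊆ (t₂ _ _ _ _ _) (here e) = here e
    Ws⊆ (t₃ _ _ _ _ _) i = i

    ends-βs⊆ : ∀ {x v} (k : Kind x) → v ∈ ends (βs k) → v ∈ members k
    ends-βs⊆ (t₁ _ _ _ _ _) i = there i
    ends-βs⊆ (t₂ _ _ _ _ _) i = there i

    unique-βs : ∀ {x} (k : Kind x) → Unique (ends (βs k))
    unique-βs (iso _) = []
    unique-βs (t₁ y z (_ , (_ , yz , _)) _ _) = (Adj-≢ G yz ∷ []) ∷ [] ∷ []
    unique-βs (t₂ y z (_ , (_ , yz , _)) _ _) = (Adj-≢ G yz ∷ []) ∷ [] ∷ []
    unique-βs (t₃ _ _ _ _ _) = []

    -- When `y z` is restored at `y`, all other neighbours of `y` must be path ends. For even
    -- neighbours this is `closed`, since the vertices of `X` turn odd. For `b` it is `parX`, since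
    -- `b` stays odd exactly if `X` has even length.
    record El (X : List V) (y z : V) : Set where
      constructor el
      field
        yz     : Adj G y z
        ¬bz    : ¬ Adj G b z
        parX   : Adj G b y → pb (length X) ≡ true
        ey     : ev G y ≡ true
        ez     : ev G z ≡ true
        y∉     : y ∉ X
        z∉     : z ∉ X
        closed : ∀ v → Adj G y v → ev G v ≡ true → v ≢ z → v ∈ X

    -- For a triangle x y z with bx deleted, deleting yz as well makes all three vertices odd.
    -- Restoring yz at y before the star at b leaves z as the only vertex at which x can get
    -- stuck, and the edge by may stay in the graph, which changes the parity of |X|.
    module Core (X : List V) (Bs : List (V × V)) (uX : Unique X) (X⊆ : ∀ {x} → x ∈ X → Adj G b x × ev G x ≡ true)
      (uB : Unique (ends Bs)) (els : ∀ {y z} → (y , z) ∈ Bs → El X y z)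
      (kept : ∀ w → Adj G b w → ev G w ≡ true → w ∈ X ⊎ ∃[ z ] (w , z) ∈ Bs) (ne : 1 ≤ length X) where

      M = star b X
      L = Bs ++ M
      H = G ∖ L
      aX : ∀ {x} → x ∈ X → Adj G b x
      aX i = proj₁ (X⊆ i)
      eX : ∀ {x} → x ∈ X → ev G x ≡ true
      eX i = proj₂ (X⊆ i)
      b∉X : b ∉ X
      b∉X i = t≢f (eX i) ob
      eB : ∀ {v} → v ∈ ends Bs → ev G v ≡ true × v ∉ X
      eB i with ends-∈ Bs i
      ... | y , z , j , inj₁ refl = El.ey (els j) , El.y∉ (els j)
      ... | y , z , j , inj₂ refl = El.ez (els j) , El.z∉ (els j)
      b∉B : b ∉ ends Bs
      b∉B i = t≢f (proj₁ (eB i)) ob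
      ends-L : ∀ {v} → v ∈ ends L → v ∈ ends Bs ⊎ (v ≡ b ⊎ v ∈ X)
      ends-L {v} i with ∈-++⁻ (ends Bs) (subst (v ∈_) (ends-++ Bs M) i)
      ... | inj₁ j = inj₁ j
      ... | inj₂ j = inj₂ (ends-star-∈ b X j)
      valid : ∀ Cs → Unique (ends Cs) → (∀ {p} → p ∈ Cs → p ∈ Bs) → Valid G (Cs ++ M)
      valid [] u s = valid-star G b X uX aX
      valid ((y , z) ∷ Cs) u s = ∖-keep G (Cs ++ M) (El.yz (els (s (here refl)))) (miss-ends (Cs ++ M) y∉) , valid Cs (Unique-tail (Unique-tail u)) (s ∘ there)
        where
        y∉ : y ∉ ends (Cs ++ M)
        y∉ i with ∈-++⁻ (ends Cs) (subst (y ∈_) (ends-++ Cs M) i)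
        ... | inj₁ j = Unique-head u (there j)
        ... | inj₂ j with ends-star-∈ b X j
        ...   | inj₁ refl = t≢f (El.ey (els (s (here refl)))) ob
        ...   | inj₂ k = El.y∉ (els (s (here refl))) k
      va : Valid G L
      va = valid Bs uB (λ i → i)
      cntL : ∀ v → cnt v (ends L) ≡ cnt v (ends Bs) + cnt v (ends M)
      cntL v = trans (cong (cnt v) (ends-++ Bs M)) (sumBy-++ (δ v) (ends Bs))
      oddX : ∀ {x} → x ∈ X → ev H x ≡ false
      oddX {x} i = flip-odd G L va (eX i) (trans (cntL x) (cong₂ _+_ (cnt-∉ (ends Bs) (λ j → proj₂ (eB j) i))
        (trans (ends-star-x b X (λ { refl → b∉X i })) (cnt-one uX i))))
      oddB : ∀ {x} → x ∈ ends Bs → ev H x ≡ false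
      oddB {x} i = flip-odd G L va (proj₁ (eB i)) (trans (cntL x) (cong₂ _+_ (cnt-one uB i)
        (trans (ends-star-x b X (λ { refl → b∉B i })) (cnt-∉ X (proj₂ (eB i))))))
      oddb : pb (length X) ≡ true → ev H b ≡ false
      oddb p = trans (ev-same G L va (trans (cong pb (trans (cntL b) (cong₂ _+_ (cnt-∉ (ends Bs) b∉B) (ends-star-b b X b∉X)))) p)) ob
      keeps : ∀ {v} → ev G v ≡ false → v ≢ b → ev H v ≡ false
      keeps {v} o v≢b = trans (ev-∉ G L va h) o
        where
        h : v ∉ ends L
        h i with ends-L i
        ... | inj₁ j = t≢f (proj₁ (eB j)) o
        ... | inj₂ (inj₁ e) = v≢b e
        ... | inj₂ (inj₂ j) = t≢f (eX j) o
      nbr-b : ∀ w → Adj G b w → ev H w ≡ false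
      nbr-b w bw with odd? G w
      ... | inj₂ o = keeps o (λ e → Adj-≢ G bw (sym e))
      ... | inj₁ e with kept w bw e
      ...   | inj₁ i = oddX i
      ...   | inj₂ (z , j) = oddB (∈-endsˡ j)
      fine : ∀ {x} → x ∈ ends L → Fine G L x
      fine i with ends-L i
      ... | inj₁ j = inj₁ (proj₁ (eB j) , oddB j)
      ... | inj₂ (inj₁ refl) = inj₂ (ob , λ w a → nbr-b w (∖-Adj G L a))
      ... | inj₂ (inj₂ j) = inj₁ (eX j , oddX j)
      goalH : Goal H
      goalH = reduceL₂ G L (len Bs) va d2 ns ih fine
        where
        len : ∀ Cs → 1 ≤ length (Cs ++ M)
        len [] = subst (1 ≤_) (sym (length-map (b ,_) X)) ne
        len (_ ∷ _) = s≤s z≤n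
      P : V → Set
      P v = (ev G v ≡ false × v ≢ b) ⊎ (v ∈ X ⊎ (v ≡ b × pb (length X) ≡ true))
      posP : ∀ v → P v → 1 ≤ proj₁ goalH v
      posP v (inj₁ (o , p)) = odd-pos H (proj₂ goalH) (keeps o p)
      posP v (inj₂ (inj₁ i)) = odd-pos H (proj₂ goalH) (oddX i)
      posP v (inj₂ (inj₂ (refl , p))) = odd-pos H (proj₂ goalH) (oddb p)
      nP : ∀ {y z} → (y , z) ∈ Bs → ¬ P z
      nP i (inj₁ (o , _)) = t≢f (El.ez (els i)) o
      nP i (inj₂ (inj₁ j)) = El.z∉ (els i) j
      nP i (inj₂ (inj₂ (refl , _))) = t≢f (El.ez (els i)) ob
      nbB : ∀ {y z} → (y , z) ∈ Bs → ∀ v → Adj G y v → v ≢ z → P v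
      nbB {y} i v yv v≢z with odd? G v
      ... | inj₁ e = inj₂ (inj₁ (El.closed (els i) v yv e v≢z))
      ... | inj₂ o with v ≟ b
      ...   | yes refl = inj₂ (inj₂ (refl , El.parX (els i) (Adj-sym G yv)))
      ...   | no p = inj₁ (o , p)
      opaque
        opened : ∃[ f ] St (G ∖ M) f × (∀ v → P v → 1 ≤ f v) × (∀ {y z} → (y , z) ∈ Bs → 1 ≤ f y)
        opened = betas G M P Bs va uB (proj₂ goalH) posP (λ i → odd-pos H (proj₂ goalH) (oddB i)) nP nbB
      f = proj₁ opened
      st = proj₁ (proj₂ opened)
      posf = proj₁ (proj₂ (proj₂ opened))
      posy : ∀ {y z} → (y , z) ∈ Bs → 1 ≤ f y
      posy = proj₂ (proj₂ (proj₂ opened))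
      odd-out : ∀ {w} → ev G w ≡ false → w ≢ b → 1 ≤ f w × w ∉ X
      odd-out o p = posf _ (inj₁ (o , p)) , λ i → t≢f (eX i) o
      pos : ∀ v → Adj G b v → 1 ≤ f v
      pos v bv with odd? G v
      ... | inj₂ o = posf v (inj₁ (o , λ e → Adj-≢ G bv (sym e)))
      ... | inj₁ e with kept v bv e
      ...   | inj₁ i = posf v (inj₂ (inj₁ i))
      ...   | inj₂ (z , j) = posy j
      cov : ∀ {x} → x ∈ X → PreCov G b f X 2 x
      cov {x} i = elist G x , d2 x (eX i) , h
        where
        h : ∀ w → Adj G x w → w ≢ b → (1 ≤ f w × w ∉ X) ⊎ w ∈ elist G x
        h w xw p with odd? G w
        ... | inj₁ e = inj₂ (∈-elist G xw e)
        ... | inj₂ o = inj₁ (odd-out o p)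
      open Close G uX aX st pos cov public using (Unit; single; triple; closeEven; closeOddUnits)
      posb : pb (length X) ≡ true → 1 ≤ f b
      posb p = posf b (inj₂ (inj₂ (refl , p)))

      unit : ∀ {x} (k : Kind x) → x ∈ X → (∀ {v} → v ∈ Ws k → v ∈ X) → (∀ {p} → p ∈ βs k → p ∈ Bs) → Unit (Ws k)
      unit {x} k x∈ W⊆ B⊆ = go k W⊆ B⊆
        where
        one-β : ∀ {y z} → Tri G x y z → (y , z) ∈ Bs → PreCov G b f X 1 x
        one-β {y} {z} t i = z ∷ [] , ≤-refl , h
          where
          h : ∀ w → Adj G x w → w ≢ b → (1 ≤ f w × w ∉ X) ⊎ w ∈ z ∷ []
          h w xw p with odd? G w
          ... | inj₂ o = inj₁ (odd-out o p)
          ... | inj₁ e with tri-nbr G d2 t xw e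
          ...   | inj₁ refl = inj₁ (posy i , El.y∉ (els i))
          ...   | inj₂ q = inj₂ (here q)
        go : (k : Kind x) → (∀ {v} → v ∈ Ws k → v ∈ X) → (∀ {p} → p ∈ βs k → p ∈ Bs) → Unit (Ws k)
        go (iso h) W⊆ B⊆ = single x∈ ([] , z≤n , λ w xw p → inj₁ (odd-out (h w xw) p))
        go (t₁ y z t _ _) W⊆ B⊆ = single x∈ (one-β t (B⊆ (here refl)))
        go (t₂ y z t _ _) W⊆ B⊆ = single x∈ (one-β t (B⊆ (here refl)))
        go (t₃ y z t@(_ , (xy , yz , xz)) _ _) W⊆ B⊆ = triple x∈ (W⊆ (there (here refl))) (W⊆ (there (there (here refl))))
            (Adj-≢ G xy) (Adj-≢ G yz) (Adj-≢ G xz) (h t) (h (tri-yxz {G} t))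
          where
          h : ∀ {p q r} → Tri G p q r → ∀ w → Adj G p w → w ≢ b → (1 ≤ f w × w ∉ X) ⊎ (w ≡ q ⊎ w ≡ r)
          h t w pw w≢b with odd? G w
          ... | inj₂ o = inj₁ (odd-out o w≢b)
          ... | inj₁ e = inj₂ (tri-nbr G d2 t pw e)

    S⊆ : ∀ {x} → x ∈ S → Adj G b x × ev G x ≡ true
    S⊆ i = elist-∈ G i
    uS : Unique S
    uS = elist-unique G b

    el-nt₂ : ∀ {x y z} (k : Kind x) → NT₂ k → x ∈ S → (y , z) ∈ βs k → El S y z
    el-nt₂ {x} (t₁ y z t@((ex , ey , ez) , (xy , yz , xz)) ¬by ¬bz) _ x∈ (here refl) =
      el yz ¬bz (λ by → ⊥-elim (¬by by)) ey ez (λ i → ¬by (proj₁ (S⊆ i))) (λ i → ¬bz (proj₁ (S⊆ i))) h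
      where
      h : ∀ v → Adj G y v → ev G v ≡ true → v ≢ z → v ∈ S
      h v yv e v≢z with tri-nbr G d2 (tri-yxz {G} t) yv e
      ... | inj₁ refl = x∈
      ... | inj₂ q = ⊥-elim (v≢z q)

    el-t₂ : ∀ {x y z X} → Tri G x y z → ¬ Adj G b z → pb (length X) ≡ true → x ∈ X → y ∉ X → z ∉ X → El X y z
    el-t₂ {x} {y} {z} {X} t@((ex , ey , ez) , (xy , yz , xz)) ¬bz p x∈ y∉ z∉ = el yz ¬bz (λ _ → p) ey ez y∉ z∉ h
      where
      h : ∀ v → Adj G y v → ev G v ≡ true → v ≢ z → v ∈ X
      h v yv e v≢z with tri-nbr G d2 (tri-yxz {G} t) yv e
      ... | inj₁ refl = x∈
      ... | inj₂ q = ⊥-elim (v≢z q)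

    Ws-S : ∀ {x} (k : Kind x) → x ∈ S → ∀ {v} → v ∈ Ws k → v ∈ S
    Ws-S (iso _) x∈ (here refl) = x∈
    Ws-S (t₁ _ _ _ _ _) x∈ (here refl) = x∈
    Ws-S (t₂ _ _ _ _ _) x∈ (here refl) = x∈
    Ws-S (t₃ _ _ _ _ _) x∈ (here refl) = x∈
    Ws-S (t₃ _ _ ((_ , ey , _) , _) by _) x∈ (there (here refl)) = ∈-elist G by ey
    Ws-S (t₃ _ _ ((_ , _ , ez) , _) _ bz) x∈ (there (there (here refl))) = ∈-elist G bz ez

    nonempty : ∀ {x : V} {X} → x ∈ X → 1 ≤ length X
    nonempty (here _) = s≤s z≤n
    nonempty (there _) = s≤s z≤n

    even-nt₂ : ∀ {x} (k : Kind x) → NT₂ k → x ∈ S → pb (length S) ≡ true → Goal G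
    even-nt₂ k nt x∈ p = closeEven (unit k x∈ (Ws-S k x∈) (λ i → i)) p (posb p)
      where
      kept′ : ∀ w → Adj G b w → ev G w ≡ true → w ∈ S ⊎ ∃[ z ] (w , z) ∈ βs k
      kept′ w a e = inj₁ (∈-elist G a e)
      open Core S (βs k) uS S⊆ (unique-βs k) (el-nt₂ k nt x∈) kept′ (nonempty x∈)

    -- The edge `b y` stays in the graph, so that `X`, which is `S` without `y`, has even length.
    -- The deletion of `y z` makes `y` odd nevertheless.
    odd-t₂ : ∀ {x y z} → Tri G x y z → Adj G b y → ¬ Adj G b z → x ∈ S → pb (length S) ≡ false → Goal G
    odd-t₂ {x} {y} {z} t@((ex , ey , ez) , (xy , yz , xz)) by ¬bz x∈ p with extract (∈-elist G by ey)
    ... | X , σ = closeEven (unit k x∈X (λ { (here refl) → x∈X }) (λ i → i)) pX (posb pX)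
      where
      k = t₂ y z t by ¬bz
      uσ = Unique-↭ σ uS
      uX = Unique-tail uσ
      X⊆ : ∀ {v} → v ∈ X → Adj G b v × ev G v ≡ true
      X⊆ i = S⊆ (∈-resp-↭ (↭-sym σ) (there i))
      x∈X : x ∈ X
      x∈X with ∈-resp-↭ σ x∈
      ... | here e = ⊥-elim (Adj-≢ G xy e)
      ... | there i = i
      pX : pb (length X) ≡ true
      pX = trans (sym (not-involutive _)) (cong not (trans (sym (cong pb (↭-length σ))) p))
      els : ∀ {y′ z′} → (y′ , z′) ∈ βs k → El X y′ z′
      els (here refl) = el-t₂ t ¬bz pX x∈X (Unique-head uσ) (λ i → ¬bz (proj₁ (X⊆ i)))
      kept′ : ∀ w → Adj G b w → ev G w ≡ true → w ∈ X ⊎ ∃[ z′ ] (w , z′) ∈ βs k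
      kept′ w a e with ∈-resp-↭ σ (∈-elist G a e)
      ... | here refl = inj₂ (z , here refl)
      ... | there i = inj₁ i
      open Core X (βs k) uX X⊆ (unique-βs k) els kept′ (nonempty x∈X)

    module _ {x₁ x₂} (x₁∈ : x₁ ∈ S) (x₂∈ : x₂ ∈ S) (x₁≢x₂ : x₁ ≢ x₂) (¬x₁x₂ : ¬ Adj G x₁ x₂) where

      tri-center : ∀ {x y z v} → Tri G x y z → v ∈ x ∷ y ∷ z ∷ [] → v ≡ x ⊎ Adj G v x
      tri-center t (here e) = inj₁ e
      tri-center (_ , (xy , _ , _)) (there (here refl)) = inj₂ (Adj-sym G xy)
      tri-center (_ , (_ , _ , xz)) (there (there (here refl))) = inj₂ (Adj-sym G xz)

      to-center : ∀ {v x} (k : Kind x) → v ∈ members k → v ≡ x ⊎ Adj G v x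
      to-center (iso _) (here e) = inj₁ e
      to-center (t₁ _ _ t _ _) = tri-center t
      to-center (t₂ _ _ t _ _) = tri-center t
      to-center (t₃ _ _ t _ _) = tri-center t

      -- x₂ is neither x₁ nor a neighbour of x₁, so it is not reached from the component of x₁.
      off-tri : ∀ {y z} → Tri G x₁ y z → ∀ {v} → v ∈ x₁ ∷ y ∷ z ∷ [] → v ≡ x₂ ⊎ Adj G v x₂ → ⊥
      off-tri t (here refl) (inj₁ e) = x₁≢x₂ e
      off-tri t (here refl) (inj₂ a) = ¬x₁x₂ a
      off-tri (_ , (xy , _ , _)) (there (here refl)) (inj₁ refl) = ¬x₁x₂ xy
      off-tri (_ , (_ , _ , xz)) (there (there (here refl))) (inj₁ refl) = ¬x₁x₂ xz
      off-tri t@(_ , (xy , yz , xz)) (there (here refl)) (inj₂ a) with tri-nbr G d2 (tri-yxz {G} t) a (proj₂ (S⊆ x₂∈))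
      ... | inj₁ e = x₁≢x₂ (sym e)
      ... | inj₂ refl = ¬x₁x₂ xz
      off-tri t@(_ , (xy , yz , xz)) (there (there (here refl))) (inj₂ a) with tri-nbr G d2 (tri-yxz {G} (tri-xzy {G} t)) a (proj₂ (S⊆ x₂∈))
      ... | inj₁ e = x₁≢x₂ (sym e)
      ... | inj₂ refl = ¬x₁x₂ xy

      disjoint′ : ∀ (k₁ : Kind x₁) (k₂ : Kind x₂) {v} → v ∈ members k₁ → v ∉ members k₂
      disjoint′ k₁ k₂ i j = h k₁ i (to-center k₂ j)
        where
        h : ∀ k₁ {v} → v ∈ members k₁ → v ≡ x₂ ⊎ Adj G v x₂ → ⊥
        h (iso _) (here refl) (inj₁ e) = x₁≢x₂ e
        h (iso _) (here refl) (inj₂ a) = ¬x₁x₂ a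
        h (t₁ _ _ t _ _) i c = off-tri t i c
        h (t₂ _ _ t _ _) i c = off-tri t i c
        h (t₃ _ _ t _ _) i c = off-tri t i c

      unique-both : ∀ (k₁ : Kind x₁) (k₂ : Kind x₂) → Unique (ends (βs k₁ ++ βs k₂))
      unique-both k₁ k₂ = subst Unique (sym (ends-++ (βs k₁) (βs k₂))) (UniqueP.++⁺ (unique-βs k₁) (unique-βs k₂)
        (λ { (i , j) → disjoint′ k₁ k₂ (ends-βs⊆ k₁ i) (ends-βs⊆ k₂ j) }))

      odd-nt₂ : ∀ (k₁ : Kind x₁) (k₂ : Kind x₂) → NT₂ k₁ → NT₂ k₂ → pb (length S) ≡ false → Goal G
      odd-nt₂ k₁ k₂ nt₁ nt₂ p = closeOddUnits
          (unit k₁ x₁∈ (Ws-S k₁ x₁∈) ∈-++⁺ˡ)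
          (unit k₂ x₂∈ (Ws-S k₂ x₂∈) (∈-++⁺ʳ (βs k₁)))
          (λ i j → disjoint′ k₁ k₂ (Ws⊆ k₁ i) (Ws⊆ k₂ j)) p
        where
        els : ∀ {y z} → (y , z) ∈ βs k₁ ++ βs k₂ → El S y z
        els i with ∈-++⁻ (βs k₁) i
        ... | inj₁ j = el-nt₂ k₁ nt₁ x₁∈ j
        ... | inj₂ j = el-nt₂ k₂ nt₂ x₂∈ j
        kept′ : ∀ w → Adj G b w → ev G w ≡ true → w ∈ S ⊎ ∃[ z ] (w , z) ∈ βs k₁ ++ βs k₂
        kept′ w a e = inj₁ (∈-elist G a e)
        open Core S (βs k₁ ++ βs k₂) uS S⊆ (unique-both k₁ k₂) els kept′ (nonempty x₁∈)

      -- Leaving out one of the `y`s would make `X` odd, so `b y₁` and `b y₂` both stay. The unit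
      -- comes from the first triangle; `y₂ z₂` is deleted so that `y₂` turns odd too.
      even-t₂ : ∀ {y₁ z₁ y₂ z₂} → Tri G x₁ y₁ z₁ → Adj G b y₁ → ¬ Adj G b z₁ → Tri G x₂ y₂ z₂ → Adj G b y₂ → ¬ Adj G b z₂ →
        pb (length S) ≡ true → Goal G
      even-t₂ {y₁} {z₁} {y₂} {z₂} T₁@((_ , ey₁ , _) , (xy₁ , _ , _)) by₁ ¬bz₁ T₂@((_ , ey₂ , _) , (xy₂ , _ , _)) by₂ ¬bz₂ p with extract (∈-elist G by₁ ey₁)
      ... | S₁ , σ with extract (drop-to (∈-resp-↭ σ (∈-elist G by₂ ey₂)))
        where
        drop-to : y₂ ∈ y₁ ∷ S₁ → y₂ ∈ S₁
        drop-to (here refl) = ⊥-elim (disjoint′ (t₂ y₁ z₁ T₁ by₁ ¬bz₁) (t₂ y₂ z₂ T₂ by₂ ¬bz₂) (there (here refl)) (there (here refl)))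
        drop-to (there i) = i
      ... | X , τ = closeEven (unit k₁ x₁X (λ { (here refl) → x₁X }) ∈-++⁺ˡ) pX (posb pX)
        where
        k₁ = t₂ y₁ z₁ T₁ by₁ ¬bz₁
        k₂ = t₂ y₂ z₂ T₂ by₂ ¬bz₂
        ρ : S ↭ y₁ ∷ y₂ ∷ X
        ρ = ↭t σ (prep y₁ τ)
        uρ = Unique-↭ ρ uS
        uX = Unique-tail (Unique-tail uρ)
        X⊆ : ∀ {v} → v ∈ X → Adj G b v × ev G v ≡ true
        X⊆ i = S⊆ (∈-resp-↭ (↭-sym ρ) (there (there i)))
        x₁X : x₁ ∈ X
        x₁X with ∈-resp-↭ ρ x₁∈
        ... | here e = ⊥-elim (Adj-≢ G xy₁ e)
        ... | there (here e) = ⊥-elim (disjoint′ k₁ k₂ (here refl) (there (here e)))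
        ... | there (there i) = i
        x₂X : x₂ ∈ X
        x₂X with ∈-resp-↭ ρ x₂∈
        ... | here e = ⊥-elim (disjoint′ k₁ k₂ (there (here e)) (here refl))
        ... | there (here e) = ⊥-elim (Adj-≢ G xy₂ e)
        ... | there (there i) = i
        pX : pb (length X) ≡ true
        pX = trans (sym (not-involutive _)) (trans (sym (cong pb (↭-length ρ))) p)
        els : ∀ {y z} → (y , z) ∈ βs k₁ ++ βs k₂ → El X y z
        els (here refl) = el-t₂ T₁ ¬bz₁ pX x₁X (λ i → Unique-head uρ (there i)) (λ i → ¬bz₁ (proj₁ (X⊆ i)))
        els (there (here refl)) = el-t₂ T₂ ¬bz₂ pX x₂X (Unique-head (Unique-tail uρ)) (λ i → ¬bz₂ (proj₁ (X⊆ i)))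
        kept′ : ∀ w → Adj G b w → ev G w ≡ true → w ∈ X ⊎ ∃[ z ] (w , z) ∈ βs k₁ ++ βs k₂
        kept′ w a e with ∈-resp-↭ ρ (∈-elist G a e)
        ... | here refl = inj₂ (z₁ , here refl)
        ... | there (here refl) = inj₂ (z₂ , there (here refl))
        ... | there (there i) = inj₁ i
        open Core X (βs k₁ ++ βs k₂) uX X⊆ (unique-both k₁ k₂) els kept′ (nonempty x₁X)

      Attached₂ : V → Set
      Attached₂ x = ∃[ y ] ∃[ z ] Tri G x y z × Adj G b y × ¬ Adj G b z

      two-attached : ∀ {x} (k : Kind x) → NT₂ k ⊎ Attached₂ x
      two-attached (iso _) = inj₁ tt
      two-attached (t₁ _ _ _ _ _) = inj₁ tt
      two-attached (t₂ y z t by ¬bz) = inj₂ (y , z , t , by , ¬bz)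
      two-attached (t₃ _ _ _ _ _) = inj₁ tt

      solveKinds : Kind x₁ → Kind x₂ → Goal G
      solveKinds k₁ k₂ = go (pb (length S)) refl (two-attached k₁) (two-attached k₂)
        where
        go : ∀ p → pb (length S) ≡ p → NT₂ k₁ ⊎ Attached₂ x₁ → NT₂ k₂ ⊎ Attached₂ x₂ → Goal G
        go true e (inj₁ nt) _ = even-nt₂ k₁ nt x₁∈ e
        go true e (inj₂ _) (inj₁ nt) = even-nt₂ k₂ nt x₂∈ e
        go true e (inj₂ (_ , _ , t , by , ¬bz)) (inj₂ (_ , _ , t′ , by′ , ¬bz′)) = even-t₂ t by ¬bz t′ by′ ¬bz′ e
        go false e (inj₂ (_ , _ , t , by , ¬bz)) _ = odd-t₂ t by ¬bz x₁∈ e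
        go false e (inj₁ _) (inj₂ (_ , _ , t , by , ¬bz)) = odd-t₂ t by ¬bz x₂∈ e
        go false e (inj₁ nt) (inj₁ nt′) = odd-nt₂ k₁ k₂ nt nt′ e

  -- Leaving a triangle

  -- The edges deleted around an odd vertex b whose even neighbours are x, y and, if d = true, z:
  -- x, y, z become odd, and restoring them leaves at least two path ends at b.
  bset : Bool → V → V → V → V → List (V × V)
  bset true  b x y z = star b (x ∷ y ∷ z ∷ [])
  bset false b x y z = (y , z) ∷ (b , x) ∷ []

  bset-cnt : ∀ d b x y z {v : V} → v ≢ b → cnt v (ends (bset d b x y z)) ≡ cnt v (x ∷ y ∷ z ∷ [])
  bset-cnt true b x y z p = ends-star-x b (x ∷ y ∷ z ∷ []) p
  bset-cnt false b x y z {v} p = trans (cong (λ k → δ v y + (δ v z + (k + (δ v x + 0)))) (δ-≢ p)) (lem (δ v x) (δ v y) (δ v z))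
    where lem : ∀ a b c → b + (c + (a + 0)) ≡ a + (b + (c + 0))
          lem = solve-∀

  bset-b : ∀ d b x y z → b ∉ x ∷ y ∷ z ∷ [] → pb (cnt b (ends (bset d b x y z))) ≡ false
  bset-b true b x y z p = cong pb (ends-star-b b (x ∷ y ∷ z ∷ []) p)
  bset-b false b x y z p = cong pb (cong₂ _+_ (δ-≢ {x = b} {y} (λ e → p (there (here e)))) (cong₂ _+_ (δ-≢ {x = b} {z} (λ e → p (there (there (here e)))))
    (cong₂ (λ i j → i + (j + 0)) (δ-refl b) (δ-≢ {x = b} {x} (λ e → p (here e))))))

  bset-∈ : ∀ d b x y z {v : V} → v ∈ ends (bset d b x y z) → v ≡ b ⊎ v ∈ x ∷ y ∷ z ∷ []
  bset-∈ true b x y z i = ends-star-∈ b (x ∷ y ∷ z ∷ []) i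
  bset-∈ false b x y z (here e) = inj₂ (there (here e))
  bset-∈ false b x y z (there (here e)) = inj₂ (there (there (here e)))
  bset-∈ false b x y z (there (there (here e))) = inj₁ e
  bset-∈ false b x y z (there (there (there (here e)))) = inj₂ (here e)

  module Restore (K : Graph n) {b x y z} (d : Bool) (bz : d ≡ true → Adj K b z) (¬bz : d ≡ false → ¬ Adj K b z)
    (bx : Adj K b x) (by : Adj K b y) (yz : Adj K y z) (u : Unique (x ∷ y ∷ z ∷ [])) (b∉ : b ∉ x ∷ y ∷ z ∷ []) where

    xyz : List V
    xyz = x ∷ y ∷ z ∷ []
    x≢y : x ≢ y
    x≢y e = Unique-head u (here e)
    x≢z : x ≢ z
    x≢z e = Unique-head u (there (here e))
    y≢b : y ≢ b
    y≢b e = b∉ (there (here (sym e)))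
    b≢z : b ≢ z
    b≢z e = b∉ (there (there (here e)))

    bxyz : d ≡ true → ∀ {t} → t ∈ xyz → Adj K b t
    bxyz e (here refl) = bx
    bxyz e (there (here refl)) = by
    bxyz e (there (there (here refl))) = bz e

    yz′ : Adj (del b x K) y z
    yz′ = del-keep K yz (missˡ y≢b (λ e → x≢y (sym e)))

    bset-valid : Valid K (bset d b x y z)
    bset-valid = go d refl
      where
      go : ∀ c → d ≡ c → Valid K (bset c b x y z)
      go true e = valid-star K b xyz u (bxyz e)
      go false e = yz′ , bx , tt

    -- If `b` is adjacent to all three vertices, this is an odd star. Otherwise `y z` returns at `y`
    -- at the expense of `z`; as `z` is not adjacent to `b`, it does not matter when `b x` then
    -- returns at `b` and adds a second end there.
    restore : ∀ {f} → St (K ∖ bset d b x y z) f → 1 ≤ f b → (∀ {t} → t ∈ xyz → 1 ≤ f t) → (∀ v → Adj K b v → 1 ≤ f v) →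
      (∀ {t} → t ∈ xyz → ∀ w → Adj K t w → w ≢ b → w ∈ xyz ⊎ 1 ≤ f w) → ∃[ f′ ] St K f′ × 2 ≤ f′ b
    restore {f} st pb′ px hb ht = go d refl st
      where
      go : ∀ c → d ≡ c → St (K ∖ bset c b x y z) f → ∃[ f′ ] St K f′ × 2 ≤ f′ b
      go true e st = Close.closeOdd K u (bxyz e) st hb cov refl pb′
        where
        cov : ∀ {t} → t ∈ xyz → PreCov K b f xyz 2 t
        cov {t} i with extract i
        ... | Z , ζ = Z , ≤-reflexive (suc-injective (sym (↭-length ζ))) , h
          where
          h : ∀ w → Adj K t w → w ≢ b → (1 ≤ f w × w ∉ xyz) ⊎ w ∈ Z
          h w tw p with memb? _≟_ w xyz
          ... | yes j with ∈-resp-↭ ζ j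
          ...   | here q = ⊥-elim (Adj-≢ K tw (sym q))
          ...   | there q = inj₂ q
          h w tw p | no ∉ with ht i w tw p
          ...   | inj₁ j = ⊥-elim (∉ j)
          ...   | inj₂ q = inj₁ (q , ∉)
      go false e st with pullˡ (del b x K) [] yz′ st cov₁ (px (there (there (here refl))))
        where
        cov₁ : ∀ v → Adj (del y z (del b x K)) y v → 1 ≤ f v ⊎ v ∈ []
        cov₁ v a = inj₁ (h (v ≟ b) (del-Adj K (del-Adj (del b x K) a)))
          where
          h : Dec (v ≡ b) → Adj K y v → 1 ≤ f v
          h (yes refl) _ = pb′
          h (no p) a′ with ht (there (here refl)) v a′ p
          ... | inj₁ i = px i
          ... | inj₂ q = q
      ... | f₁ , st₁ , e₁ with pullˡ K [] bx st₁ cov₂ (≤-trans (px (here refl)) (shift-≥ {f = f} {f₁} e₁ x x≢z))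
        where
        cov₂ : ∀ v → Adj (del b x K) b v → 1 ≤ f₁ v ⊎ v ∈ []
        cov₂ v a = inj₁ (≤-trans (hb v (del-Adj K a)) (shift-≥ {f = f} {f₁} e₁ v (λ { refl → ¬bz e (del-Adj K a) })))
      ... | f₂ , st₂ , e₂ = f₂ , st₂ , subst (2 ≤_) (sym (shift-a {f = f₁} {f₂} (Adj-≢ K bx) e₂)) (+-monoˡ-≤ 1 (≤-trans pb′ (shift-≥ {f = f} {f₁} e₁ b b≢z)))

  valid-++ : ∀ (G : Graph n) L M → Valid (G ∖ M) L → Valid G M → Valid G (L ++ M)
  valid-++ G [] M _ v = v
  valid-++ G ((u , w) ∷ L) M (a , v) v′ = subst (λ H → Adj H u w) (sym (∖-++ G L M)) a , valid-++ G L M v v′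

  cnt-ends-++ : ∀ v (L M : List (V × V)) → cnt v (ends (L ++ M)) ≡ cnt v (ends L) + cnt v (ends M)
  cnt-ends-++ v L M = trans (cong (cnt v) (ends-++ L M)) (sumBy-++ (δ v) (ends L))

  record OnTri (G : Graph n) (b x y z : V) : Set where
    constructor onTri
    field
      tri  : Tri G x y z
      oddb : ev G b ≡ false
      bx   : Adj G b x
      by   : Adj G b y
      only : ∀ w → Adj G b w → ev G w ≡ true → w ∈ x ∷ y ∷ z ∷ []

    xyz : List V
    xyz = x ∷ y ∷ z ∷ []
    evens : ∀ {t} → t ∈ xyz → ev G t ≡ true
    evens (here refl) = proj₁ (proj₁ tri)
    evens (there (here refl)) = proj₁ (proj₂ (proj₁ tri))
    evens (there (there (here refl))) = proj₂ (proj₂ (proj₁ tri))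
    b∉ : b ∉ xyz
    b∉ i = t≢f (evens i) oddb
    yz : Adj G y z
    yz = proj₁ (proj₂ (proj₂ tri))
    xy : Adj G x y
    xy = proj₁ (proj₂ tri)
    xz : Adj G x z
    xz = proj₂ (proj₂ (proj₂ tri))
    uniq : Unique xyz
    uniq = (Adj-≢ G xy ∷ Adj-≢ G xz ∷ []) ∷ (Adj-≢ G yz ∷ []) ∷ [] ∷ []

  tri-closed : ∀ (G : Graph n) → Deg≤ 2 G → ∀ {x y z t w} → Tri G x y z → t ∈ x ∷ y ∷ z ∷ [] → Adj G t w → ev G w ≡ true → w ∈ x ∷ y ∷ z ∷ []
  tri-closed G d2 t (here refl) a e with tri-nbr G d2 t a e
  ... | inj₁ p = there (here p)
  ... | inj₂ p = there (there (here p))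
  tri-closed G d2 t (there (here refl)) a e with tri-nbr G d2 (tri-yxz {G = G} t) a e
  ... | inj₁ p = here p
  ... | inj₂ p = there (there (here p))
  tri-closed G d2 t (there (there (here refl))) a e with tri-nbr G d2 (tri-yxz {G = G} (tri-xzy {G = G} t)) a e
  ... | inj₁ p = here p
  ... | inj₂ p = there (here p)

  bool-cases : ∀ {A : Set} (b : Bool) → (b ≡ true → A) → (b ≡ false → A) → A
  bool-cases true f g = f refl
  bool-cases false f g = g refl

  -- `bset` has an odd number of edges at `b`, so deleting `b c` too keeps `b` odd and guarantees it
  -- an end. After `bset` is restored, `b` can pay for `b c`, which returns at `c`, where all
  -- neighbours other than `b` are odd.
  case-exit₀ : ∀ (G : Graph n) → Deg≤ 2 G → NoSET G → IH (size G) → ∀ {b x y z c} → OnTri G b x y z →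
    Adj G b c → ev G c ≡ false → (∀ w → Adj G c w → ev G w ≡ false) → Goal G
  case-exit₀ G d2 ns ih {b} {x} {y} {z} {c} T bc oc far = finish (reduceL₂ G L len va d2 ns ih fine)
    where
    open OnTri T
    d = adj G b z
    K = del b c G
    A = bset d b x y z
    M = (b , c) ∷ []
    L = A ++ M
    H = G ∖ L
    c∉ : c ∉ xyz
    c∉ i = t≢f (evens i) oc
    keepc : ∀ {u t} → t ∈ xyz → Adj G u t → Adj K u t
    keepc i a = del-keep G a (missʳ (λ { refl → b∉ i }) (λ { refl → c∉ i }))
    module R = Restore K {b} {x} {y} {z} d (keepc (there (there (here refl)))) (λ e a → t≢f (del-Adj G a) e)
      (keepc (here refl) bx) (keepc (there (here refl)) by) (keepc (there (there (here refl))) yz) uniq b∉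
    va : Valid G L
    va = valid-++ G A M R.bset-valid (bc , tt)
    len : 1 ≤ length L
    len = h d
      where
      h : ∀ d → 1 ≤ length (bset d b x y z ++ M)
      h true = s≤s z≤n
      h false = s≤s z≤n
    cntL : ∀ v → cnt v (ends L) ≡ cnt v (ends A) + cnt v (ends M)
    cntL v = cnt-ends-++ v A M
    ends-L : ∀ {v} → v ∈ ends L → v ∈ xyz ⊎ (v ≡ b ⊎ v ≡ c)
    ends-L {v} i with ∈-++⁻ (ends A) (subst (v ∈_) (ends-++ A M) i)
    ... | inj₂ (here e) = inj₂ (inj₁ e)
    ... | inj₂ (there (here e)) = inj₂ (inj₂ e)
    ... | inj₁ j with bset-∈ d b x y z j
    ...   | inj₁ e = inj₂ (inj₁ e)
    ...   | inj₂ k = inj₁ k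
    oddT : ∀ {t} → t ∈ xyz → ev H t ≡ false
    oddT {t} i = flip-odd G L va (evens i) (trans (cntL t) (cong₂ _+_ (trans (bset-cnt d b x y z (λ { refl → b∉ i })) (cnt-one uniq i))
      (cnt-∉ {v = t} (ends M) (λ { (here refl) → b∉ i ; (there (here refl)) → c∉ i }))))
    oddB : ev H b ≡ false
    oddB = trans (ev-same G L va (trans (cong pb (trans (cntL b) (cong (cnt b (ends A) +_) (cong₂ (λ i j → i + (j + 0)) (δ-refl b) (δ-≢ (Adj-≢ G bc))))))
      (trans (pb-+false (cnt b (ends A)) 1 refl) (cong not (bset-b d b x y z b∉))))) oddb
    keeps : ∀ {v} → ev G v ≡ false → v ≢ b → v ≢ c → ev H v ≡ false
    keeps {v} o p q = trans (ev-∉ G L va h) o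
      where
      h : v ∉ ends L
      h i with ends-L i
      ... | inj₁ j = t≢f (evens j) o
      ... | inj₂ (inj₁ e) = p e
      ... | inj₂ (inj₂ e) = q e
    nbr-b : ∀ w → Adj K b w → ev H w ≡ false
    nbr-b w a with odd? G w
    ... | inj₁ e = oddT (only w (del-Adj G a) e)
    ... | inj₂ o = keeps o (λ e → Adj-≢ K a (sym e)) (λ { refl → t≢f a (del-gone G b c) })
    toK : ∀ {u w} → Adj H u w → Adj K u w
    toK {u} {w} a = ∖-Adj K A (subst (λ X → Adj X u w) (∖-++ G A M) a)
    fine : ∀ {v} → v ∈ ends L → Fine G L v
    fine i with ends-L i
    ... | inj₁ j = inj₁ (evens j , oddT j)
    ... | inj₂ (inj₁ refl) = inj₂ (oddb , λ w a → nbr-b w (toK a))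
    ... | inj₂ (inj₂ refl) = inj₂ (oc , λ w a → keeps (far w (∖-Adj G L a)) (λ { refl → t≢f (toK a) (del-goneʳ G b c) }) (λ e → Adj-≢ H a (sym e)))
    finish : Goal H → Goal G
    finish (f , st) with R.restore (subst (λ X → St X f) (∖-++ G A M) st) (odd-pos H st oddB) (λ i → odd-pos H st (oddT i)) (λ v a → odd-pos H st (nbr-b v a)) ht
      where
      ht : ∀ {t} → t ∈ xyz → ∀ w → Adj K t w → w ≢ b → w ∈ xyz ⊎ 1 ≤ f w
      ht i w a p with odd? G w
      ... | inj₁ e = inj₁ (tri-closed G d2 tri i (del-Adj G a) e)
      ... | inj₂ o = inj₂ (odd-pos H st (keeps o p (λ { refl → t≢f (evens i) (far _ (Adj-sym G (del-Adj G a))) })))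
    ... | f₁ , st₁ , le with push G {k = 0} bc st₁ ([] , z≤n , λ w a p → inj₁ (odd-pos K st₁ (trans (ev-del-≢ G bc p (λ e → Adj-≢ G a (sym e))) (far w a)))) (≤-trans (s≤s z≤n) le)
    ... | f₂ , st₂ , _ = f₂ , st₂

  -- Deleting `b c` alone would make `c` even beside even vertices, so a `bset` is deleted at `c` as
  -- well and both `b` and `c` stay odd. Once the edges at `c` are back, `b c` returns at `b`, which
  -- then has two ends. Next `y z` returns at `y` at the expense of `z`. Finally `b x` returns at
  -- `x`, where only `z` can be a dead end, so two ends at `b` suffice.
  case-exit₁ : ∀ (G : Graph n) → Deg≤ 2 G → NoSET G → IH (size G) → ∀ {b x y z c x′ y′ z′} → OnTri G b x y z → OnTri G c x′ y′ z′ →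
    Adj G b c → (∀ {t} → t ∈ x ∷ y ∷ z ∷ [] → ¬ Adj G c t) → Goal G
  case-exit₁ G d2 ns ih {b} {x} {y} {z} {c} {x′} {y′} {z′} T T′ bc far = finish (reduceL₂ G L len va d2 ns ih fine)
    where
    open OnTri T
    module T′ = OnTri T′
    d = adj G c z′
    K₂ = del b x G
    K₁ = del y z K₂
    M = (b , c) ∷ (y , z) ∷ (b , x) ∷ []
    K = G ∖ M
    A = bset d c x′ y′ z′
    L = A ++ M
    H = G ∖ L
    c∉ : c ∉ xyz
    c∉ i = t≢f (evens i) T′.oddb
    apart : ∀ {t} → t ∈ xyz → t ∉ T′.xyz
    apart i (here refl) = far i T′.bx
    apart i (there (here refl)) = far i T′.by
    apart i (there (there (here refl))) = far (tri-closed G d2 tri i (Adj-sym G T′.xz) (T′.evens (here refl))) T′.bx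
    b∉′ : b ∉ T′.xyz
    b∉′ i = t≢f (T′.evens i) oddb
    b≢y : b ≢ y
    b≢y e = b∉ (there (here e))
    b≢z : b ≢ z
    b≢z e = b∉ (there (there (here e)))
    yz₂ : Adj K₂ y z
    yz₂ = del-keep G yz (missˡ (λ e → b≢y (sym e)) (λ e → Adj-≢ G xy (sym e)))
    bc₁ : Adj K₁ b c
    bc₁ = del-keep K₂ (del-keep G bc (missʳ (λ e → Adj-≢ G bc (sym e)) (λ e → c∉ (here e)))) (missˡ b≢y b≢z)
    vM : Valid G M
    vM = bc₁ , yz₂ , bx , tt
    miss′ : ∀ {u t} → t ∈ T′.xyz → All (Miss u t) M
    miss′ i = missʳ (λ { refl → b∉′ i }) (λ { refl → T′.b∉ i }) ∷ missʳ (λ { refl → apart (there (here refl)) i }) (λ { refl → apart (there (there (here refl))) i }) ∷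
      missʳ (λ { refl → b∉′ i }) (λ { refl → apart (here refl) i }) ∷ []
    keep′ : ∀ {u t} → t ∈ T′.xyz → Adj G u t → Adj K u t
    keep′ i a = ∖-keep G M a (miss′ i)
    module R = Restore K {c} {x′} {y′} {z′} d (keep′ (there (there (here refl)))) (λ e a → t≢f (∖-Adj G M a) e)
      (keep′ (here refl) T′.bx) (keep′ (there (here refl)) T′.by) (keep′ (there (there (here refl))) T′.yz) T′.uniq T′.b∉
    va : Valid G L
    va = valid-++ G A M R.bset-valid vM
    len : 1 ≤ length L
    len = h d
      where
      h : ∀ d → 1 ≤ length (bset d c x′ y′ z′ ++ M)
      h true = s≤s z≤n
      h false = s≤s z≤n
    cntL : ∀ v → cnt v (ends L) ≡ cnt v (ends A) + cnt v (ends M)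
    cntL v = cnt-ends-++ v A M
    cntM : ∀ {v} → v ≢ b → v ≢ c → cnt v (ends M) ≡ cnt v xyz
    cntM {v} p q = trans (cong₂ (λ i j → i + (j + (δ v y + (δ v z + (i + (δ v x + 0)))))) (δ-≢ p) (δ-≢ q)) (lem (δ v x) (δ v y) (δ v z))
      where lem : ∀ a b c → b + (c + (a + 0)) ≡ a + (b + (c + 0))
            lem = solve-∀
    cntMb : cnt b (ends M) ≡ 2
    cntMb = cong₂ (λ (i : ℕ) (j : ℕ) → i + j) (δ-refl b) (cong₂ _+_ (δ-≢ (Adj-≢ G bc)) (cong₂ _+_ (δ-≢ b≢y) (cong₂ _+_ (δ-≢ b≢z)
      (cong₂ _+_ (δ-refl b) (cong₂ _+_ (δ-≢ (Adj-≢ G bx)) refl)))))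
    cntMc : cnt c (ends M) ≡ 1
    cntMc = cong₂ _+_ (δ-≢ c≢b) (cong₂ _+_ (δ-refl c) (cong₂ _+_ (δ-≢ (λ e → c∉ (there (here e)))) (cong₂ _+_ (δ-≢ (λ e → c∉ (there (there (here e)))))
      (cong₂ _+_ (δ-≢ c≢b) (cong₂ _+_ (δ-≢ (λ e → c∉ (here e))) refl)))))
      where
      c≢b : c ≢ b
      c≢b e = Adj-≢ G bc (sym e)
    ends-M : ∀ {v} → v ∈ ends M → v ∈ xyz ⊎ (v ≡ b ⊎ v ≡ c)
    ends-M (here e) = inj₂ (inj₁ e)
    ends-M (there (here e)) = inj₂ (inj₂ e)
    ends-M (there (there (here e))) = inj₁ (there (here e))
    ends-M (there (there (there (here e)))) = inj₁ (there (there (here e)))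
    ends-M (there (there (there (there (here e))))) = inj₂ (inj₁ e)
    ends-M (there (there (there (there (there (here e)))))) = inj₁ (here e)
    ends-L : ∀ {v} → v ∈ ends L → (v ∈ xyz ⊎ v ∈ T′.xyz) ⊎ (v ≡ b ⊎ v ≡ c)
    ends-L {v} i with ∈-++⁻ (ends A) (subst (v ∈_) (ends-++ A M) i)
    ... | inj₁ j with bset-∈ d c x′ y′ z′ j
    ...   | inj₁ e = inj₂ (inj₂ e)
    ...   | inj₂ k = inj₁ (inj₂ k)
    ends-L i | inj₂ j with ends-M j
    ...   | inj₁ k = inj₁ (inj₁ k)
    ...   | inj₂ e = inj₂ e
    oddT : ∀ {t} → t ∈ xyz → ev H t ≡ false
    oddT {t} i = flip-odd G L va (evens i) (trans (cntL t) (cong₂ _+_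
      (trans (bset-cnt d c x′ y′ z′ (λ { refl → c∉ i })) (cnt-∉ {v = t} T′.xyz (apart i)))
      (trans (cntM {t} (λ { refl → b∉ i }) (λ { refl → c∉ i })) (cnt-one uniq i))))
    oddT′ : ∀ {t} → t ∈ T′.xyz → ev H t ≡ false
    oddT′ {t} i = flip-odd G L va (T′.evens i) (trans (cntL t) (cong₂ _+_
      (trans (bset-cnt d c x′ y′ z′ (λ { refl → T′.b∉ i })) (cnt-one T′.uniq i))
      (trans (cntM {t} (λ { refl → b∉′ i }) (λ { refl → T′.b∉ i })) (cnt-∉ {v = t} xyz (λ j → apart j i)))))
    keeps : ∀ {v} → ev G v ≡ false → ev H v ≡ false
    keeps {v} o = h (v ≟ b) (v ≟ c)
      where
      h : Dec (v ≡ b) → Dec (v ≡ c) → ev H v ≡ false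
      h (yes refl) _ = trans (ev-same G L va (cong pb (trans (cntL v) (cong₂ _+_ (trans (bset-cnt d c x′ y′ z′ (Adj-≢ G bc)) (cnt-∉ T′.xyz b∉′)) cntMb)))) o
      h (no _) (yes refl) = trans (ev-same G L va (trans (cong pb (trans (cntL v) (cong (cnt v (ends A) +_) cntMc)))
        (trans (pb-+false (cnt v (ends A)) 1 refl) (cong not (bset-b d v x′ y′ z′ T′.b∉))))) o
      h (no p) (no q) = trans (ev-∉ G L va g) o
        where
        g : v ∉ ends L
        g i with ends-L i
        ... | inj₁ (inj₁ j) = t≢f (evens j) o
        ... | inj₁ (inj₂ j) = t≢f (T′.evens j) o
        ... | inj₂ (inj₁ e) = p e
        ... | inj₂ (inj₂ e) = q e
    nbr-b : ∀ w → Adj G b w → ev H w ≡ false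
    nbr-b w a with odd? G w
    ... | inj₁ e = oddT (only w a e)
    ... | inj₂ o = keeps o
    nbr-c : ∀ w → Adj G c w → ev H w ≡ false
    nbr-c w a with odd? G w
    ... | inj₁ e = oddT′ (T′.only w a e)
    ... | inj₂ o = keeps o
    fine : ∀ {v} → v ∈ ends L → Fine G L v
    fine i with ends-L i
    ... | inj₁ (inj₁ j) = inj₁ (evens j , oddT j)
    ... | inj₁ (inj₂ j) = inj₁ (T′.evens j , oddT′ j)
    ... | inj₂ (inj₁ refl) = inj₂ (oddb , λ w a → nbr-b w (∖-Adj G L a))
    ... | inj₂ (inj₂ refl) = inj₂ (T′.oddb , λ w a → nbr-c w (∖-Adj G L a))
    oddK : ∀ {t} → t ∈ xyz → ev K t ≡ false
    oddK {t} i = flip-odd G M vM (evens i) (trans (cntM {t} (λ { refl → b∉ i }) (λ { refl → c∉ i })) (cnt-one uniq i))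
    oddKb : ev K b ≡ false
    oddKb = trans (ev-same G M vM (cong pb cntMb)) oddb
    keepsK : ∀ {v} → ev G v ≡ false → v ≢ b → v ≢ c → ev K v ≡ false
    keepsK {v} o p q = trans (ev-∉ G M vM g) o
      where
      g : v ∉ ends M
      g i with ends-M i
      ... | inj₁ j = t≢f (evens j) o
      ... | inj₂ (inj₁ e) = p e
      ... | inj₂ (inj₂ e) = q e
    L₁ = (y , z) ∷ (b , x) ∷ []
    v₁ : Valid G L₁
    v₁ = yz₂ , bx , tt
    u₁ : Unique (ends L₁)
    u₁ = (Adj-≢ G yz ∷ (λ e → b≢y (sym e)) ∷ (λ e → Adj-≢ G xy (sym e)) ∷ []) ∷ ((λ e → b≢z (sym e)) ∷ (λ e → Adj-≢ G xz (sym e)) ∷ []) ∷ (Adj-≢ G bx ∷ []) ∷ [] ∷ []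
    oddK₁ : ∀ {t} → t ∈ xyz → ev K₁ t ≡ false
    oddK₁ i = flip-odd G L₁ v₁ (evens i) (cnt-one u₁ (h i))
      where
      h : ∀ {t} → t ∈ xyz → t ∈ ends L₁
      h (here e) = there (there (there (here e)))
      h (there (here e)) = here e
      h (there (there (here e))) = there (here e)
    keepsK₁ : ∀ {v} → ev G v ≡ false → v ≢ b → ev K₁ v ≡ false
    keepsK₁ {v} o p = trans (ev-∉ G L₁ v₁ g) o
      where
      g : v ∉ ends L₁
      g (here refl) = t≢f (evens (there (here refl))) o
      g (there (here refl)) = t≢f (evens (there (there (here refl)))) o
      g (there (there (here e))) = p e
      g (there (there (there (here refl)))) = t≢f (evens (here refl)) o
    finish : Goal H → Goal G
    finish (f , st) with R.restore (subst (λ X → St X f) (∖-++ G A M) st) (odd-pos H st (keeps T′.oddb)) (λ i → odd-pos H st (oddT′ i))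
        (λ v a → odd-pos H st (nbr-c v (∖-Adj G M a))) ht
      where
      ht : ∀ {t} → t ∈ T′.xyz → ∀ w → Adj K t w → w ≢ c → w ∈ T′.xyz ⊎ 1 ≤ f w
      ht i w a p with odd? G w
      ... | inj₁ e = inj₁ (tri-closed G d2 T′.tri i (∖-Adj G M a) e)
      ... | inj₂ o = inj₂ (odd-pos H st (keeps o))
    ... | f₁ , st₁ , le with pullˡ K₁ [] bc₁ st₁ cov (≤-trans (s≤s z≤n) le)
      where
      cov : ∀ v → Adj K b v → 1 ≤ f₁ v ⊎ v ∈ []
      cov v a with odd? G v
      ... | inj₁ e = inj₁ (odd-pos K st₁ (oddK (only v (∖-Adj G M a) e)))
      ... | inj₂ o = inj₁ (odd-pos K st₁ (keepsK o (λ e → Adj-≢ K a (sym e)) (λ { refl → t≢f a (del-gone K₁ b c) })))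
    ... | f₂ , st₂ , e₂ with pullˡ K₂ [] yz₂ st₂ cov (odd-pos K₁ st₂ (oddK₁ (there (there (here refl)))))
      where
      big : 2 ≤ f₂ b
      big = subst (2 ≤_) (sym (shift-a {f = f₁} {f₂} (Adj-≢ G bc) e₂)) (+-monoˡ-≤ 1 (odd-pos K st₁ oddKb))
      cov : ∀ v → Adj K₁ y v → 1 ≤ f₂ v ⊎ v ∈ []
      cov v a with odd? G v
      ... | inj₁ e = inj₁ (odd-pos K₁ st₂ (oddK₁ (tri-closed G d2 tri (there (here refl)) (∖-Adj G L₁ a) e)))
      ... | inj₂ o = inj₁ (h (v ≟ b))
        where
        h : Dec (v ≡ b) → 1 ≤ f₂ v
        h (yes refl) = ≤-trans (s≤s z≤n) big
        h (no p) = odd-pos K₁ st₂ (keepsK₁ o p)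
    ... | f₃ , st₃ , e₃ with push G {k = 1} bx st₃ (z ∷ [] , ≤-refl , cov) (≤-trans big (shift-≥ {f = f₂} {f₃} e₃ b b≢z))
      where
      big : 2 ≤ f₂ b
      big = subst (2 ≤_) (sym (shift-a {f = f₁} {f₂} (Adj-≢ G bc) e₂)) (+-monoˡ-≤ 1 (odd-pos K st₁ oddKb))
      cov : ∀ w → Adj G x w → w ≢ b → 1 ≤ f₃ w ⊎ w ∈ z ∷ []
      cov w a p with odd? G w
      ... | inj₂ o = inj₁ (odd-pos K₂ st₃ (trans (ev-del-≢ G bx p (λ e → Adj-≢ G a (sym e))) o))
      ... | inj₁ e with tri-nbr G d2 tri a e
      ...   | inj₁ refl = inj₁ (subst (1 ≤_) (sym (shift-a {f = f₂} {f₃} (Adj-≢ G yz) e₃)) (m≤n+m 1 (f₂ y)))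
      ...   | inj₂ q = inj₂ (here q)
    ... | f₄ , st₄ , _ = f₄ , st₄

  -- Assembling the cases and the induction

  another : ∀ {x : V} {l} → x ∈ l → Unique l → length l ≢ 1 → ∃[ y ] y ∈ l × y ≢ x
  another {x} {l} i u ne with extract i
  ... | [] , σ = ⊥-elim (ne (↭-length σ))
  ... | y ∷ l′ , σ = y , ∈-resp-↭ (↭-sym σ) (there (here refl)) , λ { refl → Unique-head (Unique-↭ σ u) (here refl) }

  not-two : ∀ (G : Graph n) {v a b c p q} → NotTwo G v a b c → p ∈ a ∷ b ∷ c ∷ [] → q ∈ a ∷ b ∷ c ∷ [] → p ≢ q → Adj G v p → Adj G v q → ⊥
  not-two G nt (here refl) (here refl) ne vp vq = ne refl
  not-two G (n₁ , n₂ , n₃) (here refl) (there (here refl)) ne vp vq = n₁ (vp , vq)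
  not-two G (n₁ , n₂ , n₃) (here refl) (there (there (here refl))) ne vp vq = n₃ (vp , vq)
  not-two G (n₁ , n₂ , n₃) (there (here refl)) (here refl) ne vp vq = n₁ (vq , vp)
  not-two G nt (there (here refl)) (there (here refl)) ne vp vq = ne refl
  not-two G (n₁ , n₂ , n₃) (there (here refl)) (there (there (here refl))) ne vp vq = n₂ (vp , vq)
  not-two G (n₁ , n₂ , n₃) (there (there (here refl))) (here refl) ne vp vq = n₃ (vq , vp)
  not-two G (n₁ , n₂ , n₃) (there (there (here refl))) (there (here refl)) ne vp vq = n₂ (vq , vp)
  not-two G nt (there (there (here refl))) (there (there (here refl))) ne vp vq = ne refl

  leave : ∀ {G : Graph n} {P : V → Set} → (∀ v → Dec (P v)) → ∀ {a v} → Reach G a v → P a → ¬ P v →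
    ∃[ b ] ∃[ c ] Adj G b c × P b × ¬ P c
  leave P? here p ¬p = ⊥-elim (¬p p)
  leave P? (step {u} {w} a r) p ¬p with P? w
  ... | yes q = leave P? r q ¬p
  ... | no ¬q = u , w , a , p , ¬q

  module Step (G : Graph n) (d2 : Deg≤ 2 G) (ns : NoSET G) (ih : IH (size G))
    (noleaf : ∀ a → length (elist G a) ≢ 1)
    (nocycle : ∀ {a p q} → ev G a ≡ true → ev G p ≡ true → ev G q ≡ true → Adj G a p → Adj G a q → p ≢ q → Adj G p q) where

    -- A single even neighbour is excluded by `noleaf`, and two even neighbours are adjacent by
    -- `nocycle`.
    shape : ∀ {x} → ev G x ≡ true → (∀ w → Adj G x w → ev G w ≡ false) ⊎ ∃[ y ] ∃[ z ] Tri G x y z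
    shape {x} ex = go (elist G x) refl
      where
      go : ∀ l → elist G x ≡ l → (∀ w → Adj G x w → ev G w ≡ false) ⊎ ∃[ y ] ∃[ z ] Tri G x y z
      go [] e = inj₁ h
        where
        none : ∀ {w} → w ∈ [] → ⊥
        none ()
        h : ∀ w → Adj G x w → ev G w ≡ false
        h w a with odd? G w
        ... | inj₂ o = o
        ... | inj₁ e′ = ⊥-elim (none (subst (w ∈_) e (∈-elist G a e′)))
      go (y ∷ []) e = ⊥-elim (noleaf x (cong length e))
      go (y ∷ z ∷ l) e with elist-∈ G {x} {y} (subst (y ∈_) (sym e) (here refl)) | elist-∈ G {x} {z} (subst (z ∈_) (sym e) (there (here refl)))
      ... | xy , ey | xz , ez = inj₂ (y , z , (ex , ey , ez) , (xy , nocycle ex ey ez xy xz y≢z , xz))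
        where
        y≢z : y ≢ z
        y≢z refl = Unique-head (subst Unique e (elist-unique G x)) (here refl)

    kind : ∀ {b} (ob : ev G b ≡ false) {x} → ev G x ≡ true → TwoComponents.Kind G d2 ns ih ob x
    kind {b} ob {x} ex with shape ex
    ... | inj₁ h = TwoComponents.iso h
    ... | inj₂ (y , z , t) with adj? G b y | adj? G b z
    ...   | yes p | yes q = TwoComponents.t₃ y z t p q
    ...   | yes p | no q = TwoComponents.t₂ y z t p q
    ...   | no p | yes q = TwoComponents.t₂ z y (tri-xzy {G = G} t) q p
    ...   | no p | no q = TwoComponents.t₁ y z t p q

    case-two : ∀ {b x₁ x₂} → ev G b ≡ false → ev G x₁ ≡ true → ev G x₂ ≡ true → Adj G b x₁ → Adj G b x₂ → x₁ ≢ x₂ → ¬ Adj G x₁ x₂ → Goal G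
    case-two ob e₁ e₂ b₁ b₂ ne ¬a = TwoComponents.solveKinds G d2 ns ih ob (∈-elist G b₁ e₁) (∈-elist G b₂ e₂) ne ¬a (kind ob e₁) (kind ob e₂)

    module _ (one-comp : ∀ {b x₁ x₂} → ev G b ≡ false → ev G x₁ ≡ true → ev G x₂ ≡ true → Adj G b x₁ → Adj G b x₂ → x₁ ≢ x₂ → Adj G x₁ x₂) where

      -- By `noleaf` there is a second even neighbour, and by `one-comp` it is adjacent to `t`. So
      -- `t` lies in a triangle, which contains all even neighbours of `b`.
      odd-type : ∀ {b t} → ev G b ≡ false → Adj G b t → ev G t ≡ true → ∃[ y ] ∃[ z ] OnTri G b t y z
      odd-type {b} {t} ob bt et with another (∈-elist G bt et) (elist-unique G b) (noleaf b)
      ... | t′ , i , t′≢t with elist-∈ G i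
      ... | bt′ , et′ with one-comp ob et et′ bt bt′ (λ e → t′≢t (sym e)) | shape et
      ...   | tt′ | inj₁ h = ⊥-elim (t≢f et′ (h t′ tt′))
      ...   | tt′ | inj₂ (y , z , tr) = go (tri-nbr G d2 tr tt′ et′)
        where
        within : ∀ w → Adj G b w → ev G w ≡ true → w ≡ t ⊎ (w ≡ y ⊎ w ≡ z)
        within w bw ew with w ≟ t
        ... | yes e = inj₁ e
        ... | no p = inj₂ (tri-nbr G d2 tr (one-comp ob et ew bt bw (λ e → p (sym e))) ew)
        go : t′ ≡ y ⊎ t′ ≡ z → ∃[ y ] ∃[ z ] OnTri G b t y z
        go (inj₁ refl) = y , z , onTri tr ob bt bt′ only
          where
          only : ∀ w → Adj G b w → ev G w ≡ true → w ∈ t ∷ y ∷ z ∷ []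
          only w bw ew with within w bw ew
          ... | inj₁ e = here e
          ... | inj₂ (inj₁ e) = there (here e)
          ... | inj₂ (inj₂ e) = there (there (here e))
        go (inj₂ refl) = z , y , onTri (tri-xzy {G = G} tr) ob bt bt′ only
          where
          only : ∀ w → Adj G b w → ev G w ≡ true → w ∈ t ∷ z ∷ y ∷ []
          only w bw ew with within w bw ew
          ... | inj₁ e = here e
          ... | inj₂ (inj₁ e) = there (there (here e))
          ... | inj₂ (inj₂ e) = there (here e)

      -- `P` is the triangle with its attached odd vertices. The latter have two neighbours in the
      -- triangle, so the witness lies outside `P` and the walk to it leaves `P` along some `b c`.
      -- Neighbours of the triangle belong to `P`, so `b` is odd; all even neighbours of `b` lie in
      -- the triangle, so `c` is odd as well.
      case-tri : ∀ {t₁ t₂ t₃} → Tri G t₁ t₂ t₃ → Goal G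
      case-tri {t₁} {t₂} {t₃} T with ns t₁ t₂ t₃ T
      ... | v , r , off = go (leave P? r (inj₁ (here refl)) ¬Pv)
        where
        Ts = t₁ ∷ t₂ ∷ t₃ ∷ []
        P : V → Set
        P v = v ∈ Ts ⊎ (ev G v ≡ false × ∃[ t ] t ∈ Ts × Adj G v t)
        evT : ∀ {t} → t ∈ Ts → ev G t ≡ true
        evT (here refl) = proj₁ (proj₁ T)
        evT (there (here refl)) = proj₁ (proj₂ (proj₁ T))
        evT (there (there (here refl))) = proj₂ (proj₂ (proj₁ T))
        P? : ∀ v → Dec (P v)
        P? v = memb? _≟_ v Ts ⊎-dec ((ev G v Bool.≟ false) ×-dec any? (λ t → memb? _≟_ t Ts ×-dec adj? G v t))
        ¬Pv : ¬ P v
        ¬Pv (inj₁ (here e)) = proj₁ (proj₁ off) e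
        ¬Pv (inj₁ (there (here e))) = proj₁ (proj₂ (proj₁ off)) e
        ¬Pv (inj₁ (there (there (here e)))) = proj₂ (proj₂ (proj₁ off)) e
        ¬Pv (inj₂ (o , t , i , vt)) with proj₂ off
        ... | inj₁ e = t≢f e o
        ... | inj₂ nt with odd-type o vt (evT i)
        ...   | y , z , O = not-two G nt i (tri-closed G d2 T i (OnTri.xy O) (OnTri.evens O (there (here refl)))) (Adj-≢ G (OnTri.xy O)) vt (OnTri.by O)
        go : ∃[ b ] ∃[ c ] Adj G b c × P b × ¬ P c → Goal G
        go (b , c , bc , inj₁ i , ¬Pc) with odd? G c
        ... | inj₁ e = ⊥-elim (¬Pc (inj₁ (tri-closed G d2 T i bc e)))
        ... | inj₂ o = ⊥-elim (¬Pc (inj₂ (o , b , i , Adj-sym G bc)))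
        go (b , c , bc , inj₂ (o , t , i , bt) , ¬Pc) with odd-type o bt (evT i)
        ... | y , z , O = cs (odd? G c)
          where
          inT : ∀ {s} → s ∈ t ∷ y ∷ z ∷ [] → s ∈ Ts
          inT (here refl) = i
          inT (there (here refl)) = tri-closed G d2 T i (OnTri.xy O) (OnTri.evens O (there (here refl)))
          inT (there (there (here refl))) = tri-closed G d2 T i (OnTri.xz O) (OnTri.evens O (there (there (here refl))))
          cs : ev G c ≡ true ⊎ ev G c ≡ false → Goal G
          cs (inj₁ e) = ⊥-elim (¬Pc (inj₁ (inT (OnTri.only O c bc e))))
          cs (inj₂ oc) with any? (λ w → adj? G c w ×-dec (ev G w Bool.≟ true))
          ... | yes (w , cw , ew) = case-exit₁ G d2 ns ih O (proj₂ (proj₂ (odd-type oc cw ew))) bc (λ j ct → ¬Pc (inj₂ (oc , _ , inT j , ct)))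
          ... | no none = case-exit₀ G d2 ns ih O bc oc h
            where
            h : ∀ w → Adj G c w → ev G w ≡ false
            h w cw with odd? G w
            ... | inj₁ e = ⊥-elim (none (w , cw , e))
            ... | inj₂ o′ = o′

      -- An odd vertex with an even neighbour would be attached to a triangle, so even vertices have
      -- no neighbours at all. One end at each odd vertex is then a prescription without relevant
      -- zeros, with sum at most `n`.
      case-base : (∀ {x y z} → ¬ Tri G x y z) → Goal G
      case-base notri = f , lovasz (size G) G f ≤-refl par (λ z _ → ⊥-elim (nozero z)) , ≤-trans (ΣF-mono {f = f} {g = λ _ → 1} (λ v → b2n≤1 (not (ev G v)))) (≤-reflexive (ΣF-1 {n}))
        where
        f : V → ℕ
        f v = b2n (not (ev G v))
        par : ∀ v → pb (f v) ≡ ev G v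
        par v with ev G v
        ... | true = refl
        ... | false = refl
        even-alone : ∀ {x w} → ev G x ≡ true → ¬ Adj G x w
        even-alone {x} {w} ex xw with shape ex
        ... | inj₂ (y , z , t) = notri t
        ... | inj₁ h = notri (OnTri.tri (proj₂ (proj₂ (odd-type (h w xw) (Adj-sym G xw) ex))))
        nozero : ∀ {y} → ¬ Zero G f y
        nozero {y} ((w , yw) , fy) with ev G y in eq
        ... | true = even-alone eq yw

  step-goal : ∀ (G : Graph n) → Deg≤ 3 G → NoSET G → IH (size G) → Goal G
  step-goal G d3 ns ih = deg3 (any? (λ a → (ev G a Bool.≟ true) ×-dec (length (elist G a) ℕₚ.≟ 3)))
    where
    deg3 : Dec (∃[ a ] ev G a ≡ true × length (elist G a) ≡ 3) → Goal G
    deg3 (yes (a , ea , l)) = case-deg3 G d3 ns ih ea l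
    deg3 (no ¬3) = leaf (any? (λ a → length (elist G a) ℕₚ.≟ 1))
      where
      d2 : Deg≤ 2 G
      d2 v e = ≤-pred (≤∧≢⇒< (d3 v e) (λ l → ¬3 (v , e , l)))
      leaf : Dec (∃[ a ] length (elist G a) ≡ 1) → Goal G
      leaf (yes (a , l)) = go (elist G a) refl l
        where
        go : ∀ l → elist G a ≡ l → length l ≡ 1 → Goal G
        go (x ∷ []) e _ = case-one-even G d2 ns ih e
      leaf (no ¬1) = cyc (any? (λ a → any? (λ p → any? (λ q →
          ((ev G a Bool.≟ true) ×-dec (ev G p Bool.≟ true) ×-dec (ev G q Bool.≟ true)) ×-dec (adj? G a p ×-dec adj? G a q) ×-dec (¬? (p ≟ q) ×-dec ¬? (adj? G p q))))))
        where
        Cyc : V → V → V → Set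
        Cyc a p q = (ev G a ≡ true × ev G p ≡ true × ev G q ≡ true) × (Adj G a p × Adj G a q) × (p ≢ q × ¬ Adj G p q)
        cyc : Dec (∃[ a ] ∃[ p ] ∃[ q ] Cyc a p q) → Goal G
        cyc (yes (a , p , q , (ea , ep , eq) , (ap , aq) , (p≢q , ¬pq))) with another (∈-elist G (Adj-sym G ap) ea) (elist-unique G p) (λ l → ¬1 (p , l))
        ... | r , i , r≢a = case-cycle G d2 ns ih (eq , ea , ep , proj₂ (elist-∈ G i)) (Adj-sym G aq , ap , proj₁ (elist-∈ G i)) p≢q ¬pq r≢a
        cyc (no ¬c) = two? (any? (λ b → any? (λ x → any? (λ y →
            ((ev G b Bool.≟ false) ×-dec (ev G x Bool.≟ true) ×-dec (ev G y Bool.≟ true)) ×-dec (adj? G b x ×-dec adj? G b y) ×-dec (¬? (x ≟ y) ×-dec ¬? (adj? G x y))))))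
          where
          open Step G d2 ns ih (λ a l → ¬1 (a , l))
            (λ {a} {p} {q} ea ep eq ap aq ne → bool-cases (adj G p q) (λ e → e) (λ e → ⊥-elim (¬c (a , p , q , (ea , ep , eq) , (ap , aq) , (ne , λ e′ → t≢f e′ e)))))
          Two : V → V → V → Set
          Two b x y = (ev G b ≡ false × ev G x ≡ true × ev G y ≡ true) × (Adj G b x × Adj G b y) × (x ≢ y × ¬ Adj G x y)
          two? : Dec (∃[ b ] ∃[ x ] ∃[ y ] Two b x y) → Goal G
          two? (yes (b , x , y , (ob , ex , ey) , (bx , by) , (ne , ¬xy))) = case-two ob ex ey bx by ne ¬xy
          two? (no ¬t) = tri? (any? (λ x → any? (λ y → any? (λ z →
              ((ev G x Bool.≟ true) ×-dec (ev G y Bool.≟ true) ×-dec (ev G z Bool.≟ true)) ×-dec (adj? G x y ×-dec adj? G y z ×-dec adj? G x z)))))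
            where
            one-comp : ∀ {b x₁ x₂} → ev G b ≡ false → ev G x₁ ≡ true → ev G x₂ ≡ true → Adj G b x₁ → Adj G b x₂ → x₁ ≢ x₂ → Adj G x₁ x₂
            one-comp {b} {x} {y} ob ex ey bx by ne = bool-cases (adj G x y) (λ e → e) (λ e → ⊥-elim (¬t (b , x , y , (ob , ex , ey) , (bx , by) , (ne , λ e′ → t≢f e′ e))))
            tri? : Dec (∃[ x ] ∃[ y ] ∃[ z ] Tri G x y z) → Goal G
            tri? (yes (x , y , z , t)) = case-tri one-comp t
            tri? (no ¬t′) = case-base one-comp (λ {x} {y} {z} t → ¬t′ (x , y , z , t))

  main : ∀ k (G : Graph n) → size G < k → Deg≤ 3 G → NoSET G → Goal G
  main (suc k) G (s≤s le) d3 ns = step-goal G d3 ns (λ H lt → main k H (≤-trans lt le))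

  -- Conclusion for connected graphs

  off? : ∀ (G : Graph n) v a b c → Dec (Off G v a b c)
  off? G v a b c = (¬? (v ≟ a) ×-dec ¬? (v ≟ b) ×-dec ¬? (v ≟ c)) ×-dec ((ev G v Bool.≟ true) ⊎-dec
    (¬? (adj? G v a ×-dec adj? G v b) ×-dec ¬? (adj? G v b ×-dec adj? G v c) ×-dec ¬? (adj? G v a ×-dec adj? G v c)))

  tri-dec : ∀ (G : Graph n) x y z → Dec (Tri G x y z)
  tri-dec G x y z = ((ev G x Bool.≟ true) ×-dec (ev G y Bool.≟ true) ×-dec (ev G z Bool.≟ true)) ×-dec (adj? G x y ×-dec adj? G y z ×-dec adj? G x z)

  set-graph : ∀ (G : Graph n) {a b c} → Tri G a b c → (∀ v → ¬ Off G v a b c) → SETGraph G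
  set-graph G {a} {b} {c} t@((ea , eb , ec′) , (ab , bc , ac)) none =
      (a , b , c , (Adj-≢ G ab , Adj-≢ G bc , Adj-≢ G ac) , (even-pb (degree G a) ea , even-pb (degree G b) eb , even-pb (degree G c) ec′) , (ab , bc , ac) , inside) , enough
    where
    inside : ∀ v → EvenV G v → v ≡ a ⊎ v ≡ b ⊎ v ≡ c
    inside v e with v ≟ a | v ≟ b | v ≟ c
    ... | yes p | _ | _ = inj₁ p
    ... | no _ | yes p | _ = inj₂ (inj₁ p)
    ... | no _ | no _ | yes p = inj₂ (inj₂ p)
    ... | no p | no q | no r = ⊥-elim (none v ((p , q , r) , inj₁ (pb-even (degree G v) e)))
    enough : ∀ v → OddV G v → 2 ≤ evenNeighbours G v
    enough v o = subst (2 ≤_) (elist-length G v) (go (adj? G v a) (adj? G v b) (adj? G v c))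
      where
      ne : ∀ {x} → ev G x ≡ true → v ≢ x
      ne e refl = o (even-pb (degree G v) e)
      pair : ∀ {x y} → Adj G v x → Adj G v y → ev G x ≡ true → ev G y ≡ true → x ≢ y → 2 ≤ length (elist G v)
      pair {x} {y} vx vy ex ey p = ⊆-length {xs = x ∷ y ∷ []} ((p ∷ []) ∷ [] ∷ []) (λ { (here refl) → ∈-elist G vx ex ; (there (here refl)) → ∈-elist G vy ey })
      go : Dec (Adj G v a) → Dec (Adj G v b) → Dec (Adj G v c) → 2 ≤ length (elist G v)
      go (yes p) (yes q) _ = pair p q ea eb (Adj-≢ G ab)
      go (yes p) (no _) (yes r) = pair p r ea ec′ (Adj-≢ G ac)
      go (no _) (yes q) (yes r) = pair q r eb ec′ (Adj-≢ G bc)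
      go (yes _) (no q) (no r) = ⊥-elim (none v ((ne ea , ne eb , ne ec′) , inj₂ ((λ (_ , y) → q y) , (λ (_ , y) → r y) , (λ (_ , y) → r y))))
      go (no p) (yes _) (no r) = ⊥-elim (none v ((ne ea , ne eb , ne ec′) , inj₂ ((λ (x , _) → p x) , (λ (_ , y) → r y) , (λ (x , _) → p x))))
      go (no p) (no q) _ = ⊥-elim (none v ((ne ea , ne eb , ne ec′) , inj₂ ((λ (x , _) → p x) , (λ (x , _) → q x) , (λ (x , _) → p x))))

-- A triangle without a witness anywhere makes the whole graph a SET graph. Otherwise every triangle
-- has a witness, connectedness makes it reachable, and `NoSET` holds.
theorem3p1 : (n : ℕ) (G : Graph n) → Connected G → MaxDegEV≤ G 3 →
    PnAtMost G (n / 2) ⊎ SETGraph G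
theorem3p1 n G conn deg = go (any? (λ a → any? (λ b → any? (λ c → tri-dec G a b c ×-dec all? (λ v → ¬? (off? G v a b c))))))
  where
  go : Dec (∃[ a ] ∃[ b ] ∃[ c ] Tri G a b c × (∀ v → ¬ Off G v a b c)) → PnAtMost G (n / 2) ⊎ SETGraph G
  go (yes (a , b , c , t , none)) = inj₂ (set-graph G t none)
  go (no ¬set) = inj₁ (St-Pn G (proj₂ (main (suc (size G)) G ≤-refl d3 ns)))
    where
    d3 : Deg≤ 3 G
    d3 v e = subst (_≤ 3) (sym (elist-length G v)) (deg v (even-pb (degree G v) e))
    ns : NoSET G
    ns a b c t with any? (λ v → off? G v a b c)
    ... | yes (v , off) = v , conn a v , off
    ... | no none = ⊥-elim (¬set (a , b , c , t , λ v off → none (v , off)))
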